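{- Let $\mathrm{d} = q\frac{d}{dq}$ acting on $\mathbb{Q}[[q]]$, and for $r\ge 1$ and $k_1,\dots,k_r\ge 1$ let $g^{\mathrm{sh}}_{k_1,\dots,k_r}\in\mathbb{Q}[[q]]$ be the $q$-series defined in the context. (i) For every integer $k\ge 1$, $$\frac{1}{k}\,\mathrm{d}\, g^{\mathrm{sh}}_k = (k+1)\, g^{\mathrm{sh}}_{k+2} - \sum_{n=2}^{k+1} (2^n-2)\, g^{\mathrm{sh}}_{k+2-n,\,n}.$$ (ii) For all integers $k_1,k_2,k_3\ge 2$, the series $\mathrm{d}\, g^{\mathrm{sh}}_{k_1,k_2}$ and $\mathrm{d}\, g^{\mathrm{sh}}_{k_1,k_2,k_3}$ can be written as $\mathbb{Q}$-linear combinations of the series $g^{\mathrm{sh}}_{l_1,\dots,l_r}$ with $r\ge 0$ and $l_1,\dots,l_r\ge 1$ (where for $r=0$ the series is $1$).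
   Context: For integers $n_1,\dots,n_m\ge 1$ set $$H\binom{n_1,\dots,n_m}{X_1,\dots,X_m} = \sum_{0<d_1<\dots<d_m} e^{d_1X_1}\left(\frac{q^{d_1}}{1-q^{d_1}}\right)^{n_1}\cdots e^{d_mX_m}\left(\frac{q^{d_m}}{1-q^{d_m}}\right)^{n_m},$$ a formal power series in $X_1,\dots,X_m$ with coefficients in $\mathbb{Q}[[q]]$. For $k_1,\dots,k_r\ge1$ ($r\geq 1$) the $q$-series $g^{\mathrm{sh}}_{k_1,\dots,k_r}\in\mathbb{Q}[[q]]$ are defined as the coefficients of the generating function $$\sum_{k_1,\dots,k_r\ge1} g^{\mathrm{sh}}_{k_1,\dots,k_r}X_1^{k_1-1}\cdots X_r^{k_r-1} := \sum_{m=1}^{r}\ \sum_{\substack{i_1+\dots+i_m=r\\ i_1,\dots,i_m\ge1}}\frac{1}{i_1!\cdots i_m!}\,H\binom{i_1,\,i_2,\,\dots,\,i_m}{X_r-X_{r-i_1},\;X_{r-i_1}-X_{r-i_1-i_2},\;\dots,\;X_{i_m}},$$ i.e. the $j$-th lower entry is $X_{r-i_1-\dots-i_{j-1}}-X_{r-i_1-\dots-i_j}$ with the convention $X_0=0$. For $r=0$ the series is set to $1$. -}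

module Defs where

open import Data.Bool.Base using (if_then_else_)
open import Data.Integer.Base using (+_)
open import Data.List.Base as List using (List; []; _∷_; applyUpTo; concatMap)
open import Data.List.Relation.Unary.All using (All)
open import Data.Nat.Base as ℕ using (ℕ; zero; suc; pred; _∸_; _≤_; _≡ᵇ_; _!)
open import Data.Nat.Divisibility using (_∣?_)
open import Data.Nat.Properties using (_!≢0; _≟_)
open import Data.Fin.Base using (toℕ)
open import Data.Product.Base using (_×_; _,_; proj₂; ∃-syntax)
open import Data.Rational.Base using (ℚ; 0ℚ; 1ℚ; _/_) renaming (_+_ to _+ℚ_; _*_ to _*ℚ_; _-_ to _-ℚ_)
open import Data.Vec.Base as Vec using (Vec; []; _∷_; foldr′; fromList; replicate; tabulate; zipWith)
open import Data.Vec.Properties using (≡-dec)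
open import Function.Base using (_∘_)
open import Relation.Binary.PropositionalEquality using (_≗_)
open import Relation.Nullary.Decidable using (does)

fromℕ : ℕ → ℚ
fromℕ n = + n / 1

1/_! : ℕ → ℚ
1/ n ! = (+ 1 / n !) {{n !≢0}}

-- The list a, a + 1, …, b (empty when a > b).
[_⋯_] : ℕ → ℕ → List ℕ
[ a ⋯ b ] = applyUpTo (a ℕ.+_) (suc b ∸ a)

-- A formal power series is its coefficient function A → ℚ, where A is the type
-- of exponents; equality of series is pointwise equality _≗_.

infixl 6 _⊖_
infixr 7 _·_

_⊖_ : {A : Set} → (A → ℚ) → (A → ℚ) → (A → ℚ)
(f ⊖ g) a = f a -ℚ g a

_·_ : {A : Set} → ℚ → (A → ℚ) → (A → ℚ)
(c · f) a = c *ℚ f a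

∑ : {I : Set} → List I → (I → ℚ) → ℚ
∑ is f = List.foldr (λ i s → f i +ℚ s) 0ℚ is

∑ₛ : {I A : Set} → List I → (I → A → ℚ) → (A → ℚ)
∑ₛ is f a = ∑ is (λ i → f i a)

ℚ⟦q⟧ : Set
ℚ⟦q⟧ = ℕ → ℚ

1q : ℚ⟦q⟧
1q zero    = 1ℚ
1q (suc _) = 0ℚ

infixl 7 _*q_
_*q_ : ℚ⟦q⟧ → ℚ⟦q⟧ → ℚ⟦q⟧
(f *q g) N = ∑ [ 0 ⋯ N ] (λ i → f i *ℚ g (N ∸ i))

∏q : {n : ℕ} → Vec ℚ⟦q⟧ n → ℚ⟦q⟧
∏q = foldr′ _*q_ 1q

infixr 8 _^q_
_^q_ : ℚ⟦q⟧ → ℕ → ℚ⟦q⟧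
f ^q n = ∏q (replicate n f)

-- q d/dq
𝕕 : ℚ⟦q⟧ → ℚ⟦q⟧
𝕕 f N = fromℕ N *ℚ f N

-- q^d / (1 - q^d) = Σ_{j ≥ 1} q^{dj}, for d ≥ 1.
q^_/1-q^ : ℕ → ℚ⟦q⟧
q^ d /1-q^ zero      = 0ℚ
q^ d /1-q^ N@(suc _) = if does (d ∣? N) then 1ℚ else 0ℚ

-- ℚ[[X₁,…,X_r]], a monomial being given by its vector of exponents.
ℚ⟦X⟧ : ℕ → Set
ℚ⟦X⟧ r = Vec ℕ r → ℚ

δ : {r : ℕ} → Vec ℕ r → ℚ⟦X⟧ r
δ α β = if does (≡-dec _≟_ α β) then 1ℚ else 0ℚ

1X : {r : ℕ} → ℚ⟦X⟧ r
1X = δ (replicate _ 0)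

-- The variable X_s for 1 ≤ s ≤ r, with the convention X₀ = 0.
X : {r : ℕ} → ℕ → ℚ⟦X⟧ r
X zero    = λ _ → 0ℚ
X (suc s) = δ (tabulate (λ t → if toℕ t ≡ᵇ s then 1 else 0))

-- All β with β ≤ α componentwise.
below : {r : ℕ} → Vec ℕ r → List (Vec ℕ r)
below []      = [] ∷ []
below (a ∷ α) = concatMap (λ b → List.map (b ∷_) (below α)) [ 0 ⋯ a ]

infixl 7 _*X_
_*X_ : {r : ℕ} → ℚ⟦X⟧ r → ℚ⟦X⟧ r → ℚ⟦X⟧ r
(f *X g) α = ∑ (below α) (λ β → f β *ℚ g (zipWith _∸_ α β))

∏X : {r n : ℕ} → Vec (ℚ⟦X⟧ r) n → ℚ⟦X⟧ r
∏X = foldr′ _*X_ 1X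

infixr 8 _^X_
_^X_ : {r : ℕ} → ℚ⟦X⟧ r → ℕ → ℚ⟦X⟧ r
f ^X n = ∏X (replicate n f)

-- Σ_j f^j / j!, for f with zero constant term: f^j has no monomials of total
-- degree below j, so only the terms with j ≤ |α| contribute at α.
exp : {r : ℕ} → ℚ⟦X⟧ r → ℚ⟦X⟧ r
exp f α = ∑ [ 0 ⋯ Vec.sum α ] (λ j → 1/ j ! *ℚ (f ^X j) α)

-- All (d₁,…,d_m) with a < d₁ < … < d_m ≤ N.
increasing : (m a N : ℕ) → List (Vec ℕ m)
increasing zero    a N = [] ∷ []
increasing (suc m) a N =
  concatMap (λ d₁ → List.map (d₁ ∷_) (increasing m d₁ N)) [ suc a ⋯ N ]

-- (ℚ[[q]])[[X₁,…,X_r]]: the coefficient of each monomial in X is a q-series.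
ℚ⟦q⟧⟦X⟧ : ℕ → Set
ℚ⟦q⟧⟦X⟧ r = Vec ℕ r → ℚ⟦q⟧

-- The series H with upper entries n₁,…,n_m ≥ 1 and lower entries Y₁,…,Y_m
-- without constant term.  The summand for d₁ < … < d_m is divisible by
-- q^{d_m}, so only d_m ≤ N contributes to the coefficient of q^N.
H : {m r : ℕ} → Vec ℕ m → Vec (ℚ⟦X⟧ r) m → ℚ⟦q⟧⟦X⟧ r
H {m} ns Ys α N = ∑ (increasing m 0 N) (λ ds →
    ∏X (zipWith (λ d Y → exp (fromℕ d · Y)) ds Ys) α
      *ℚ
    ∏q (zipWith (λ d n → (q^ d /1-q^) ^q n) ds ns) N)

-- All (i₁,…,i_m) with i₁ + … + i_m = r and every i_j ≥ 1.
compositions : (m r : ℕ) → List (Vec ℕ m)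
compositions zero    zero    = [] ∷ []
compositions zero    (suc _) = []
compositions (suc m) r       =
  concatMap (λ i → List.map (i ∷_) (compositions m (r ∸ i))) [ 1 ⋯ r ]

-- X_s - X_{s-i₁}, X_{s-i₁} - X_{s-i₁-i₂}, …
lower : {m r : ℕ} → ℕ → Vec ℕ m → Vec (ℚ⟦X⟧ r) m
lower s []       = []
lower s (i ∷ is) = (X s ⊖ X (s ∸ i)) ∷ lower (s ∸ i) is

generating : (r : ℕ) → ℚ⟦q⟧⟦X⟧ r
generating r α =
  ∑ₛ [ 1 ⋯ r ] λ m →
  ∑ₛ (compositions m r) λ is →
  foldr′ _*ℚ_ 1ℚ (Vec.map 1/_! is) · H is (lower r is) α

-- g^sh_{k₁,…,k_r}; only meaningful when every k_j ≥ 1.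
gsh : List ℕ → ℚ⟦q⟧
gsh []         = 1q
gsh ks@(_ ∷ _) = generating (List.length ks) (Vec.map pred (fromList ks))

-- f is a finite ℚ-linear combination of series g^sh_l with all entries of l ≥ 1.
IsCombination : ℚ⟦q⟧ → Set
IsCombination f =
  ∃[ terms ] All (All (1 ≤_) ∘ proj₂) terms
           × f ≗ ∑ₛ {ℚ × List ℕ} terms (λ (c , l) → c · gsh l)

{-# OPTIONS --safe #-}

-- Put L_d = q^d / (1 - q^d).  Collecting equal indices, g^sh_{k_r,…,k₁} is the sum over
-- 0 = d₀ ≤ d₁ ≤ … ≤ d_r of ∏ (d_j - d_{j-1})^{k_j - 1} / (k_j - 1)!, where a block of i equal
-- indices d > 0 has the weight L_d^i / i!.  With powers of the d_j in place of the gaps these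
-- sums multiply by the shuffle product, being ordered products of exponentials in d; by the
-- binomial theorem both kinds of sums span the same space V, so V is closed under products.
--
-- Expanding L_d = ∑ q^{dn} and exchanging the roles of the gaps and the partial sums of the n
-- gives sums over N₁ > … > N_r > 0 of ∏ x_j(q^{N_j}), which multiply by the quasi-shuffle
-- product.  An index k > 1 becomes the letter x(u) = u^{k-1} / (k-1)!, an index 1 at the head
-- becomes ẑ = q/(1-q), and a single index 1 further down becomes ẑ + 1/2, where the letter 1
-- counts the indices N between its two neighbours.  Multiplying a word by a word that starts
-- with ẑ moves ẑ to any position modulo V, so inserting the letter 1 below the head stays in V.
-- Finally 𝕕 multiplies by ∑ u_j N_j, where u_j is the gap that belongs to N_j, and each N_j is
-- a count of this kind.  Part (i) compares the two expansions of H(1;X)² coefficientwise.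
module Submission where

open import Defs
open import Algebra.Bundles using (CommutativeRing)
import Data.Bool.Base as Bool
open import Data.Bool.Base using (true; false; if_then_else_)
open import Data.Integer.Base as ℤ using (+_)
import Data.Integer.Properties as ℤₚ
open import Data.List.Base using (List; []; _∷_; _++_; applyDownFrom; applyUpTo; concatMap; length; map; reverse)
import Data.List.Properties as Listₚ
open import Data.List.Relation.Unary.All using (All; []; _∷_)
open import Data.List.Relation.Unary.All.Properties using (map⁺)
open import Data.Nat.Base using (ℕ; zero; suc; pred; NonZero; _+_; _*_; _∸_; _^_; _≤_; _<_; z≤n; s≤s; _!; _≡ᵇ_; _≤ᵇ_)
open import Data.Nat.Divisibility using (_∣_; divides; _∣?_; ∣-refl; ∣⇒≤; ∣m∣n⇒∣m+n; ∣m+n∣m⇒∣n)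
import Data.Nat.Properties as ℕₚ
open import Data.Product.Base using (_×_; _,_; proj₁; proj₂; Σ; ∃-syntax)
open import Data.Rational.Base using (_-_)
open import Data.Rational.Base using (ℚ; 0ℚ; 1ℚ; _/_; fromℚᵘ) renaming (_+_ to _+ℚ_; _*_ to _*ℚ_; _-_ to _-ℚ_; -_ to -ℚ_)
import Data.Rational.Properties as ℚₚ
open import Data.Rational.Solver using (module +-*-Solver)
import Data.Rational.Unnormalised.Base as ℚᵘ
import Data.Rational.Unnormalised.Properties as ℚᵘₚ
open import Data.Vec.Base as Vec using (Vec; []; _∷_; foldr′; fromList; replicate; tabulate; zipWith)
open import Function.Base using (_∘_; id)
open import Relation.Binary.PropositionalEquality using (_≡_; _≗_; refl; sym; trans; cong; cong₂; subst; module ≡-Reasoning)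
open import Relation.Nullary.Decidable using (yes; no)
open import Relation.Nullary.Negation using (¬_; contradiction)
open +-*-Solver using (solve; con; _:+_; _:*_; _:-_; :-_; _:=_)

-- Rational numbers and finite sums

-- All sums are cut off at an order B, and the identities between them hold modulo q^(B+1).
-- Membership in V is therefore stated for all pairs of an order B and an exponent i ≤ B at once:
-- the coefficients cannot depend on B, so a genuine combination of q-series results. The obstacle
-- in (ii) is the letter 1, which the count of indices inserts but which is not the letter of any
-- index. It comes from a tie: two equal indices form a block of weight 1/2!, which gives the letter
-- of an index 1 below the head the constant term 1/2, where ẑ has 0. Indices ≥ 2 give letters that
-- vanish at u = 0, so ties occur only at an inserted index 1. Such letters span the polynomials in
-- u without constant term, a class closed under products, also with ẑ, and under multiplication by
-- u; this keeps quasi-shuffles within the words already treated. In (i) the same 1/2 produces the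
-- derivative: the shuffle product gives H(1;X)² with coefficients 2^n, the quasi-shuffle product
-- gives it as twice the words without the 1/2 plus terms of depth one. Subtracting twice the words
-- with the 1/2 leaves the count below N.

fromℚᵘ-+ : ∀ p q → fromℚᵘ (p ℚᵘ.+ q) ≡ fromℚᵘ p +ℚ fromℚᵘ q
fromℚᵘ-+ p q = ℚₚ.toℚᵘ-injective (ℚᵘₚ.≃-trans (ℚₚ.toℚᵘ-fromℚᵘ (p ℚᵘ.+ q))
  (ℚᵘₚ.≃-trans (ℚᵘₚ.≃-sym (ℚᵘₚ.+-cong (ℚₚ.toℚᵘ-fromℚᵘ p) (ℚₚ.toℚᵘ-fromℚᵘ q)))
    (ℚᵘₚ.≃-sym (ℚₚ.toℚᵘ-homo-+ (fromℚᵘ p) (fromℚᵘ q)))))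

fromℚᵘ-* : ∀ p q → fromℚᵘ (p ℚᵘ.* q) ≡ fromℚᵘ p *ℚ fromℚᵘ q
fromℚᵘ-* p q = ℚₚ.toℚᵘ-injective (ℚᵘₚ.≃-trans (ℚₚ.toℚᵘ-fromℚᵘ (p ℚᵘ.* q))
  (ℚᵘₚ.≃-trans (ℚᵘₚ.≃-sym (ℚᵘₚ.*-cong (ℚₚ.toℚᵘ-fromℚᵘ p) (ℚₚ.toℚᵘ-fromℚᵘ q)))
    (ℚᵘₚ.≃-sym (ℚₚ.toℚᵘ-homo-* (fromℚᵘ p) (fromℚᵘ q)))))

fromℕ-+ : ∀ m n → fromℕ (m + n) ≡ fromℕ m +ℚ fromℕ n
fromℕ-+ m n = trans (ℚₚ.fromℚᵘ-cong {ℚᵘ.mkℚᵘ (+ (m + n)) 0} {ℚᵘ.mkℚᵘ (+ m) 0 ℚᵘ.+ ℚᵘ.mkℚᵘ (+ n) 0}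
    (ℚᵘ.*≡* (cong (ℤ._* ℤ.1ℤ) (trans (ℤₚ.pos-+ m n)
      (sym (cong₂ ℤ._+_ (ℤₚ.*-identityʳ (+ m)) (ℤₚ.*-identityʳ (+ n))))))))
  (fromℚᵘ-+ (ℚᵘ.mkℚᵘ (+ m) 0) (ℚᵘ.mkℚᵘ (+ n) 0))

fromℕ-suc : ∀ n → fromℕ (suc n) ≡ 1ℚ +ℚ fromℕ n
fromℕ-suc n = fromℕ-+ 1 n

fromℕ-* : ∀ m n → fromℕ (m * n) ≡ fromℕ m *ℚ fromℕ n
fromℕ-* m n = trans (ℚₚ.fromℚᵘ-cong {ℚᵘ.mkℚᵘ (+ (m * n)) 0} {ℚᵘ.mkℚᵘ (+ m) 0 ℚᵘ.* ℚᵘ.mkℚᵘ (+ n) 0}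
    (ℚᵘ.*≡* (cong (ℤ._* ℤ.1ℤ) (ℤₚ.pos-* m n))))
  (fromℚᵘ-* (ℚᵘ.mkℚᵘ (+ m) 0) (ℚᵘ.mkℚᵘ (+ n) 0))

1/-* : ∀ m n .{{_ : NonZero m}} .{{_ : NonZero n}} .{{_ : NonZero (m * n)}} → + 1 / (m * n) ≡ (+ 1 / m) *ℚ (+ 1 / n)
1/-* (suc m) (suc n) = fromℚᵘ-* (ℚᵘ.mkℚᵘ (+ 1) m) (ℚᵘ.mkℚᵘ (+ 1) n)

*-1/ : ∀ n .{{_ : NonZero n}} → fromℕ n *ℚ (+ 1 / n) ≡ 1ℚ
*-1/ (suc n) = trans (sym (fromℚᵘ-* (ℚᵘ.mkℚᵘ (+ suc n) 0) (ℚᵘ.mkℚᵘ (+ 1) n)))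
  (ℚₚ.fromℚᵘ-cong {ℚᵘ.mkℚᵘ (+ suc n) 0 ℚᵘ.* ℚᵘ.mkℚᵘ (+ 1) n} {ℚᵘ.mkℚᵘ (+ 1) 0} (ℚᵘ.*≡* eq))
  where
  eq : (+ suc n ℤ.* + 1) ℤ.* + 1 ≡ + 1 ℤ.* (+ 1 ℤ.* + suc n)
  eq = trans (ℤₚ.*-identityʳ (+ suc n ℤ.* + 1)) (trans (ℤₚ.*-identityʳ (+ suc n))
    (sym (trans (ℤₚ.*-identityˡ (+ 1 ℤ.* + suc n)) (ℤₚ.*-identityˡ (+ suc n)))))

1/1+_ : ℕ → ℚ
1/1+ k = + 1 / suc k

1/1+-inverse : ∀ k → fromℕ (suc k) *ℚ (1/1+ k) ≡ 1ℚ
1/1+-inverse k = *-1/ (suc k)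

1/suc! : ∀ n → 1/ suc n ! ≡ (1/1+ n) *ℚ 1/ n !
1/suc! n = 1/-* (suc n) (n !) {{_}} {{n ℕₚ.!≢0}} {{suc n ℕₚ.!≢0}}

1/1+-cancel : ∀ k x → (1/1+ k) *ℚ (fromℕ (suc k) *ℚ x) ≡ x
1/1+-cancel k x = trans (solve 3 (λ a b c → a :* (b :* c) := (b :* a) :* c) refl (1/1+ k) (fromℕ (suc k)) x)
  (trans (cong (_*ℚ x) (1/1+-inverse k)) (ℚₚ.*-identityˡ x))

+ℚ-interchange : ∀ a b c d → (a +ℚ b) +ℚ (c +ℚ d) ≡ (a +ℚ c) +ℚ (b +ℚ d)
+ℚ-interchange = solve 4 (λ a b c d → (a :+ b) :+ (c :+ d) := (a :+ c) :+ (b :+ d)) refl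

*ℚ-left-comm : ∀ a b c → a *ℚ (b *ℚ c) ≡ b *ℚ (a *ℚ c)
*ℚ-left-comm = solve 3 (λ a b c → a :* (b :* c) := b :* (a :* c)) refl

-- c^k / k!
pw : ℕ → ℚ → ℚ
pw zero    c = 1ℚ
pw (suc k) c = (1/1+ k) *ℚ (c *ℚ pw k c)

suc*pw : ∀ k c → fromℕ (suc k) *ℚ pw (suc k) c ≡ c *ℚ pw k c
suc*pw k c = trans (sym (ℚₚ.*-assoc (fromℕ (suc k)) (1/1+ k) _))
  (trans (cong (_*ℚ (c *ℚ pw k c)) (1/1+-inverse k)) (ℚₚ.*-identityˡ _))

pw-suc-0 : ∀ k → pw (suc k) 0ℚ ≡ 0ℚ
pw-suc-0 k = trans (cong ((1/1+ k) *ℚ_) (ℚₚ.*-zeroˡ (pw k 0ℚ))) (ℚₚ.*-zeroʳ (1/1+ k))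

*ℚ-pw : ∀ k c → c *ℚ pw k c ≡ fromℕ (suc k) *ℚ pw (suc k) c
*ℚ-pw k c = sym (suc*pw k c)

-- Peeled at the top end, unlike `∑`: raising the bound by one adds a last term by definition, which
-- drives the inductions on the largest summation index.
Σℚ : ℕ → (ℕ → ℚ) → ℚ
Σℚ zero    f = 0ℚ
Σℚ (suc n) f = Σℚ n f +ℚ f n

Σℚ-cong< : ∀ n {f g : ℕ → ℚ} → (∀ i → i < n → f i ≡ g i) → Σℚ n f ≡ Σℚ n g
Σℚ-cong< zero    e = refl
Σℚ-cong< (suc n) e = cong₂ _+ℚ_ (Σℚ-cong< n (λ i i<n → e i (ℕₚ.m<n⇒m<1+n i<n))) (e n (ℕₚ.n<1+n n))

Σℚ-cong : ∀ n {f g : ℕ → ℚ} → (∀ i → f i ≡ g i) → Σℚ n f ≡ Σℚ n g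
Σℚ-cong n e = Σℚ-cong< n (λ i _ → e i)

Σℚ-0 : ∀ n → Σℚ n (λ _ → 0ℚ) ≡ 0ℚ
Σℚ-0 zero    = refl
Σℚ-0 (suc n) = cong (_+ℚ 0ℚ) (Σℚ-0 n)

Σℚ-+ : ∀ n f g → Σℚ n (λ i → f i +ℚ g i) ≡ Σℚ n f +ℚ Σℚ n g
Σℚ-+ zero    f g = refl
Σℚ-+ (suc n) f g = trans (cong (_+ℚ (f n +ℚ g n)) (Σℚ-+ n f g))
  (+ℚ-interchange (Σℚ n f) (Σℚ n g) (f n) (g n))

Σℚ-*ˡ : ∀ n c f → Σℚ n (λ i → c *ℚ f i) ≡ c *ℚ Σℚ n f
Σℚ-*ˡ zero    c f = sym (ℚₚ.*-zeroʳ c)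
Σℚ-*ˡ (suc n) c f = trans (cong (_+ℚ (c *ℚ f n)) (Σℚ-*ˡ n c f)) (sym (ℚₚ.*-distribˡ-+ c (Σℚ n f) (f n)))

Σℚ-*ʳ : ∀ n c f → Σℚ n (λ i → f i *ℚ c) ≡ Σℚ n f *ℚ c
Σℚ-*ʳ n c f = trans (Σℚ-cong n (λ i → ℚₚ.*-comm (f i) c)) (trans (Σℚ-*ˡ n c f) (ℚₚ.*-comm c _))

Σℚ-swap : ∀ m n (f : ℕ → ℕ → ℚ) → Σℚ m (λ i → Σℚ n (f i)) ≡ Σℚ n (λ j → Σℚ m (λ i → f i j))
Σℚ-swap zero    n f = sym (Σℚ-0 n)
Σℚ-swap (suc m) n f = trans (cong (_+ℚ Σℚ n (f m)) (Σℚ-swap m n f)) (sym (Σℚ-+ n _ _))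

Σℚ-head : ∀ n f → Σℚ (suc n) f ≡ f 0 +ℚ Σℚ n (f ∘ suc)
Σℚ-head zero    f = trans (ℚₚ.+-identityˡ (f 0)) (sym (ℚₚ.+-identityʳ (f 0)))
Σℚ-head (suc n) f = trans (cong (_+ℚ f (suc n)) (Σℚ-head n f)) (ℚₚ.+-assoc (f 0) (Σℚ n (f ∘ suc)) (f (suc n)))

Σℚ-split : ∀ m n f → Σℚ (m + n) f ≡ Σℚ m f +ℚ Σℚ n (λ i → f (m + i))
Σℚ-split zero    n f = sym (ℚₚ.+-identityˡ _)
Σℚ-split (suc m) n f = trans (Σℚ-head (m + n) f) (trans (cong (f 0 +ℚ_) (Σℚ-split m n (f ∘ suc)))
  (trans (sym (ℚₚ.+-assoc (f 0) (Σℚ m (f ∘ suc)) (Σℚ n (λ i → f (suc m + i))))) (cong (_+ℚ Σℚ n (λ i → f (suc m + i))) (sym (Σℚ-head m f)))))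

Σℚ-vanish : ∀ n f → (∀ i → i < n → f i ≡ 0ℚ) → Σℚ n f ≡ 0ℚ
Σℚ-vanish n f e = trans (Σℚ-cong< n e) (Σℚ-0 n)

Σℚ-extend : ∀ m n f → m ≤ n → (∀ i → m ≤ i → f i ≡ 0ℚ) → Σℚ n f ≡ Σℚ m f
Σℚ-extend m n f m≤n e = trans (cong (λ t → Σℚ t f) (sym (ℕₚ.m+[n∸m]≡n m≤n))) (trans (Σℚ-split m (n ∸ m) f)
  (trans (cong (Σℚ m f +ℚ_) (Σℚ-vanish (n ∸ m) _ (λ i _ → e (m + i) (ℕₚ.m≤m+n m i)))) (ℚₚ.+-identityʳ _)))

∑-cong : {I : Set} (is : List I) {f g : I → ℚ} → (∀ i → f i ≡ g i) → ∑ is f ≡ ∑ is g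
∑-cong []       e = refl
∑-cong (i ∷ is) e = cong₂ _+ℚ_ (e i) (∑-cong is e)

∑-*ˡ : {I : Set} (is : List I) (c : ℚ) (f : I → ℚ) → ∑ is (λ i → c *ℚ f i) ≡ c *ℚ ∑ is f
∑-*ˡ []       c f = sym (ℚₚ.*-zeroʳ c)
∑-*ˡ (i ∷ is) c f = trans (cong ((c *ℚ f i) +ℚ_) (∑-*ˡ is c f)) (sym (ℚₚ.*-distribˡ-+ c (f i) (∑ is f)))

∑-++ : {I : Set} (is js : List I) (f : I → ℚ) → ∑ (is ++ js) f ≡ ∑ is f +ℚ ∑ js f
∑-++ []       js f = sym (ℚₚ.+-identityˡ _)
∑-++ (i ∷ is) js f = trans (cong (f i +ℚ_) (∑-++ is js f)) (sym (ℚₚ.+-assoc (f i) (∑ is f) (∑ js f)))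

∑-map : {I J : Set} (h : I → J) (is : List I) (f : J → ℚ) → ∑ (map h is) f ≡ ∑ is (f ∘ h)
∑-map h []       f = refl
∑-map h (i ∷ is) f = cong (f (h i) +ℚ_) (∑-map h is f)

∑-concatMap : {I J : Set} (h : I → List J) (is : List I) (f : J → ℚ) → ∑ (concatMap h is) f ≡ ∑ is (λ i → ∑ (h i) f)
∑-concatMap h []       f = refl
∑-concatMap h (i ∷ is) f = trans (∑-++ (h i) (concatMap h is) f) (cong (∑ (h i) f +ℚ_) (∑-concatMap h is f))

∑-+ : {I : Set} (is : List I) (f g : I → ℚ) → ∑ is (λ i → f i +ℚ g i) ≡ ∑ is f +ℚ ∑ is g
∑-+ []       f g = refl
∑-+ (i ∷ is) f g = trans (cong ((f i +ℚ g i) +ℚ_) (∑-+ is f g))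
  (+ℚ-interchange (f i) (g i) (∑ is f) (∑ is g))

∑-0 : {I : Set} (is : List I) → ∑ is (λ _ → 0ℚ) ≡ 0ℚ
∑-0 []       = refl
∑-0 (i ∷ is) = trans (ℚₚ.+-identityˡ _) (∑-0 is)

∑-swap : {I J : Set} (is : List I) (js : List J) (f : I → J → ℚ) →
         ∑ is (λ i → ∑ js (f i)) ≡ ∑ js (λ j → ∑ is (λ i → f i j))
∑-swap []       js f = sym (∑-0 js)
∑-swap (i ∷ is) js f = trans (cong (∑ js (f i) +ℚ_) (∑-swap is js f)) (sym (∑-+ js (f i) (λ j → ∑ is (λ i → f i j))))

∑-applyUpTo : {I : Set} (h : ℕ → I) (n : ℕ) (f : I → ℚ) → ∑ (applyUpTo h n) f ≡ Σℚ n (f ∘ h)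
∑-applyUpTo h zero    f = refl
∑-applyUpTo h (suc n) f = trans (cong (f (h 0) +ℚ_) (∑-applyUpTo (h ∘ suc) n f)) (sym (Σℚ-head n (f ∘ h)))

-- The ring of q-series

infixl 6 _⊕_
_⊕_ : {A : Set} → (A → ℚ) → (A → ℚ) → (A → ℚ)
(f ⊕ g) a = f a +ℚ g a

𝟘 : {A : Set} → A → ℚ
𝟘 _ = 0ℚ

neg : {A : Set} → (A → ℚ) → (A → ℚ)
neg f a = -ℚ f a

*q-Σℚ : ∀ f g N → (f *q g) N ≡ Σℚ (suc N) (λ i → f i *ℚ g (N ∸ i))
*q-Σℚ f g N = ∑-applyUpTo id (suc N) (λ i → f i *ℚ g (N ∸ i))

*q-0 : ∀ f g → (f *q g) 0 ≡ f 0 *ℚ g 0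
*q-0 f g = ℚₚ.+-identityʳ (f 0 *ℚ g 0)

-- Peeling the constant coefficient of the left factor gives a recursion on the exponent, so that
-- commutativity, associativity and the unit law are inductions instead of reindexings of double
-- sums.
*q-suc : ∀ f g N → (f *q g) (suc N) ≡ f 0 *ℚ g (suc N) +ℚ ((f ∘ suc) *q g) N
*q-suc f g N = trans (*q-Σℚ f g (suc N)) (trans (Σℚ-head (suc N) _)
  (cong (f 0 *ℚ g (suc N) +ℚ_) (sym (*q-Σℚ (f ∘ suc) g N))))

-- A coefficient of a product only sees the coefficients of the factors up to the same exponent,
-- which makes congruence modulo q^(B+1) compatible with products.
*q-cong≤ : ∀ {f f′ g g′ : ℚ⟦q⟧} N → (∀ i → i ≤ N → f i ≡ f′ i) → (∀ i → i ≤ N → g i ≡ g′ i) → (f *q g) N ≡ (f′ *q g′) N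
*q-cong≤ {f} {f′} {g} {g′} N e e′ = trans (*q-Σℚ f g N)
  (trans (Σℚ-cong< (suc N) (λ { i (s≤s i≤N) → cong₂ _*ℚ_ (e i i≤N) (e′ (N ∸ i) (ℕₚ.m∸n≤m N i)) }))
    (sym (*q-Σℚ f′ g′ N)))

*q-cong : ∀ {f f′ g g′ : ℚ⟦q⟧} → f ≗ f′ → g ≗ g′ → f *q g ≗ f′ *q g′
*q-cong e e′ N = *q-cong≤ N (λ i _ → e i) (λ i _ → e′ i)

*q-congˡ : ∀ {f g g′ : ℚ⟦q⟧} → g ≗ g′ → f *q g ≗ f *q g′
*q-congˡ {f} = *q-cong {f} (λ _ → refl)

*q-suc′ : ∀ f g N → (f *q g) (suc N) ≡ (f *q (g ∘ suc)) N +ℚ f (suc N) *ℚ g 0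
*q-suc′ f g N = trans (*q-Σℚ f g (suc N)) (cong₂ _+ℚ_
  (trans (Σℚ-cong< (suc N) (λ { i (s≤s i≤N) → cong (λ j → f i *ℚ g j) (ℕₚ.+-∸-assoc 1 i≤N) })) (sym (*q-Σℚ f (g ∘ suc) N)))
  (cong (λ j → f (suc N) *ℚ g j) (ℕₚ.n∸n≡0 N)))

*q-comm : ∀ f g → f *q g ≗ g *q f
*q-comm f g zero    = trans (*q-0 f g) (trans (ℚₚ.*-comm (f 0) (g 0)) (sym (*q-0 g f)))
*q-comm f g (suc N) = trans (*q-suc f g N) (trans (cong₂ _+ℚ_ (ℚₚ.*-comm (f 0) (g (suc N))) (*q-comm (f ∘ suc) g N))
  (trans (ℚₚ.+-comm (g (suc N) *ℚ f 0) ((g *q (f ∘ suc)) N)) (sym (*q-suc′ g f N))))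

*q-distribʳ : ∀ f g h → (f ⊕ g) *q h ≗ (f *q h) ⊕ (g *q h)
*q-distribʳ f g h N = trans (∑-cong [ 0 ⋯ N ] (λ i → ℚₚ.*-distribʳ-+ (h (N ∸ i)) (f i) (g i))) (∑-+ [ 0 ⋯ N ] (λ i → f i *ℚ h (N ∸ i)) (λ i → g i *ℚ h (N ∸ i)))

*q-distribˡ : ∀ f g h → f *q (g ⊕ h) ≗ (f *q g) ⊕ (f *q h)
*q-distribˡ f g h N = trans (*q-comm f (g ⊕ h) N) (trans (*q-distribʳ g h f N) (cong₂ _+ℚ_ (*q-comm g f N) (*q-comm h f N)))

*q-·ˡ : ∀ c f g → (c · f) *q g ≗ c · (f *q g)
*q-·ˡ c f g N = trans (∑-cong [ 0 ⋯ N ] (λ i → ℚₚ.*-assoc c (f i) (g (N ∸ i)))) (∑-*ˡ [ 0 ⋯ N ] c _)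

*q-assoc : ∀ f g h → (f *q g) *q h ≗ f *q (g *q h)
*q-assoc f g h zero    = trans (*q-0 (f *q g) h) (trans (cong (_*ℚ h 0) (*q-0 f g))
  (trans (ℚₚ.*-assoc (f 0) (g 0) (h 0)) (sym (trans (*q-0 f (g *q h)) (cong (f 0 *ℚ_) (*q-0 g h))))))
*q-assoc f g h (suc N) = begin
  ((f *q g) *q h) (suc N)
    ≡⟨ *q-suc (f *q g) h N ⟩
  (f *q g) 0 *ℚ h (suc N) +ℚ (((f *q g) ∘ suc) *q h) N
    ≡⟨ cong₂ _+ℚ_ (cong (_*ℚ h (suc N)) (*q-0 f g)) (*q-cong {g = h} (*q-suc f g) (λ _ → refl) N) ⟩
  f 0 *ℚ g 0 *ℚ h (suc N) +ℚ (((f 0 · (g ∘ suc)) ⊕ ((f ∘ suc) *q g)) *q h) N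
    ≡⟨ cong (f 0 *ℚ g 0 *ℚ h (suc N) +ℚ_) (*q-distribʳ (f 0 · (g ∘ suc)) ((f ∘ suc) *q g) h N) ⟩
  f 0 *ℚ g 0 *ℚ h (suc N) +ℚ (((f 0 · (g ∘ suc)) *q h) N +ℚ (((f ∘ suc) *q g) *q h) N)
    ≡⟨ cong (f 0 *ℚ g 0 *ℚ h (suc N) +ℚ_) (cong₂ _+ℚ_ (*q-·ˡ (f 0) (g ∘ suc) h N) (*q-assoc (f ∘ suc) g h N)) ⟩
  f 0 *ℚ g 0 *ℚ h (suc N) +ℚ (f 0 *ℚ ((g ∘ suc) *q h) N +ℚ ((f ∘ suc) *q (g *q h)) N)
    ≡⟨ solve 5 (λ a b c d e → a :* b :* c :+ (a :* d :+ e) := a :* (b :* c :+ d) :+ e) refl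
         (f 0) (g 0) (h (suc N)) (((g ∘ suc) *q h) N) (((f ∘ suc) *q (g *q h)) N) ⟩
  f 0 *ℚ (g 0 *ℚ h (suc N) +ℚ ((g ∘ suc) *q h) N) +ℚ ((f ∘ suc) *q (g *q h)) N
    ≡⟨ cong (λ t → f 0 *ℚ t +ℚ ((f ∘ suc) *q (g *q h)) N) (*q-suc g h N) ⟨
  f 0 *ℚ (g *q h) (suc N) +ℚ ((f ∘ suc) *q (g *q h)) N
    ≡⟨ *q-suc f (g *q h) N ⟨
  (f *q (g *q h)) (suc N) ∎
  where open ≡-Reasoning

*q-zeroˡ : ∀ f → 𝟘 *q f ≗ 𝟘
*q-zeroˡ f N = trans (∑-cong [ 0 ⋯ N ] (λ i → ℚₚ.*-zeroˡ (f (N ∸ i)))) (∑-0 [ 0 ⋯ N ])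

*q-identityˡ : ∀ f → 1q *q f ≗ f
*q-identityˡ f zero    = trans (*q-0 1q f) (ℚₚ.*-identityˡ (f 0))
*q-identityˡ f (suc N) = trans (*q-suc 1q f N)
  (trans (cong₂ _+ℚ_ (ℚₚ.*-identityˡ (f (suc N))) (*q-zeroˡ f N)) (ℚₚ.+-identityʳ _))

*q-Σˡ : ∀ n (f : ℕ → ℚ⟦q⟧) g → (λ i → Σℚ n (λ k → f k i)) *q g ≗ (λ i → Σℚ n (λ k → (f k *q g) i))
*q-Σˡ zero    f g N = *q-zeroˡ g N
*q-Σˡ (suc n) f g N = trans (*q-distribʳ (λ i → Σℚ n (λ k → f k i)) (f n) g N) (cong (_+ℚ (f n *q g) N) (*q-Σˡ n f g N))

𝕕-*q : ∀ f g → 𝕕 (f *q g) ≗ (𝕕 f *q g) ⊕ (f *q 𝕕 g)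
𝕕-*q f g N = begin
  fromℕ N *ℚ (f *q g) N
    ≡⟨ cong (fromℕ N *ℚ_) (*q-Σℚ f g N) ⟩
  fromℕ N *ℚ Σℚ (suc N) (λ i → f i *ℚ g (N ∸ i))
    ≡⟨ Σℚ-*ˡ (suc N) (fromℕ N) _ ⟨
  Σℚ (suc N) (λ i → fromℕ N *ℚ (f i *ℚ g (N ∸ i)))
    ≡⟨ Σℚ-cong< (suc N) (λ { i (s≤s i≤N) → trans (cong (λ t → t *ℚ (f i *ℚ g (N ∸ i)))
         (trans (cong fromℕ (sym (ℕₚ.m+[n∸m]≡n i≤N))) (fromℕ-+ i (N ∸ i))))
         (solve 4 (λ a b x y → (a :+ b) :* (x :* y) := (a :* x) :* y :+ x :* (b :* y)) refl (fromℕ i) (fromℕ (N ∸ i)) (f i) (g (N ∸ i))) }) ⟩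
  Σℚ (suc N) (λ i → 𝕕 f i *ℚ g (N ∸ i) +ℚ f i *ℚ 𝕕 g (N ∸ i))
    ≡⟨ Σℚ-+ (suc N) (λ i → 𝕕 f i *ℚ g (N ∸ i)) (λ i → f i *ℚ 𝕕 g (N ∸ i)) ⟩
  Σℚ (suc N) (λ i → 𝕕 f i *ℚ g (N ∸ i)) +ℚ Σℚ (suc N) (λ i → f i *ℚ 𝕕 g (N ∸ i))
    ≡⟨ cong₂ _+ℚ_ (*q-Σℚ (𝕕 f) g N) (*q-Σℚ f (𝕕 g) N) ⟨
  ((𝕕 f *q g) ⊕ (f *q 𝕕 g)) N ∎
  where open ≡-Reasoning

-- The exponential series in two variables multiply by the Leibniz rule for 𝕕.
pw-binomial : ∀ k a b → ((λ i → pw i a) *q (λ i → pw i b)) k ≡ pw k (a +ℚ b)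
pw-binomial zero    a b = refl
pw-binomial (suc k) a b = begin
  P (suc k)
    ≡⟨ 1/1+-cancel k (P (suc k)) ⟨
  (1/1+ k) *ℚ (fromℕ (suc k) *ℚ P (suc k))
    ≡⟨ cong ((1/1+ k) *ℚ_) (𝕕-*q A B (suc k)) ⟩
  (1/1+ k) *ℚ ((𝕕 A *q B) (suc k) +ℚ (A *q 𝕕 B) (suc k))
    ≡⟨ cong ((1/1+ k) *ℚ_) (cong₂ _+ℚ_ (left a b) (trans (*q-comm A (𝕕 B) (suc k)) (left b a))) ⟩
  (1/1+ k) *ℚ (a *ℚ P k +ℚ b *ℚ (B *q A) k)
    ≡⟨ cong (λ t → (1/1+ k) *ℚ (a *ℚ P k +ℚ b *ℚ t)) (*q-comm B A k) ⟩
  (1/1+ k) *ℚ (a *ℚ P k +ℚ b *ℚ P k)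
    ≡⟨ cong ((1/1+ k) *ℚ_) (sym (ℚₚ.*-distribʳ-+ (P k) a b)) ⟩
  (1/1+ k) *ℚ ((a +ℚ b) *ℚ P k)
    ≡⟨ cong (λ t → (1/1+ k) *ℚ ((a +ℚ b) *ℚ t)) (pw-binomial k a b) ⟩
  pw (suc k) (a +ℚ b) ∎
  where
  open ≡-Reasoning
  A B P : ℚ⟦q⟧
  A i = pw i a
  B i = pw i b
  P = A *q B
  -- `𝕕` multiplies the exponential series of `a` by `a` and shifts it by one degree.
  left : ∀ a b → (𝕕 (λ i → pw i a) *q (λ i → pw i b)) (suc k) ≡ a *ℚ ((λ i → pw i a) *q (λ i → pw i b)) k
  left a b = trans (*q-suc (𝕕 (λ i → pw i a)) (λ i → pw i b) k)
    (trans (cong (_+ℚ ((λ i → 𝕕 (λ i → pw i a) (suc i)) *q (λ i → pw i b)) k)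
        (trans (cong (_*ℚ pw (suc k) b) (ℚₚ.*-zeroˡ (pw 0 a))) (ℚₚ.*-zeroˡ (pw (suc k) b))))
      (trans (ℚₚ.+-identityˡ _) (trans (*q-cong {g = λ i → pw i b} (λ i → suc*pw i a) (λ _ → refl) k)
        (*q-·ˡ a (λ i → pw i a) (λ i → pw i b) k))))

pw-+ : ∀ k a b → pw k (a +ℚ b) ≡ Σℚ (suc k) (λ i → pw i a *ℚ pw (k ∸ i) b)
pw-+ k a b = trans (sym (pw-binomial k a b)) (*q-Σℚ (λ i → pw i a) (λ i → pw i b) k)

-- Congruence modulo q^(B+1), packaged as a commutative ring for setoid reasoning and the ring
-- solver. It is a record so that both series can be recovered by unification.
module Truncated (B : ℕ) where

  infix 4 _≈_
  record _≈_ (f g : ℚ⟦q⟧) : Set where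
    constructor mod
    field at : ∀ i → i ≤ B → f i ≡ g i
  open _≈_ public

  ≗⇒≈ : ∀ {f g} → f ≗ g → f ≈ g
  ≗⇒≈ e = mod λ i _ → e i

  ring : CommutativeRing _ _
  ring = record
    { Carrier = ℚ⟦q⟧ ; _≈_ = _≈_ ; _+_ = _⊕_ ; _*_ = _*q_ ; -_ = neg ; 0# = 𝟘 ; 1# = 1q
    ; isCommutativeRing = record
      { isRing = record
        { +-isAbelianGroup = record
          { isGroup = record
            { isMonoid = record
              { isSemigroup = record
                { isMagma = record
                  { isEquivalence = record
                    { refl = ≗⇒≈ λ _ → refl
                    ; sym = λ e → mod λ i l → sym (at e i l)
                    ; trans = λ e e′ → mod λ i l → trans (at e i l) (at e′ i l) }
                  ; ∙-cong = λ e e′ → mod λ i l → cong₂ _+ℚ_ (at e i l) (at e′ i l) }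
                ; assoc = λ f g h → ≗⇒≈ λ i → ℚₚ.+-assoc (f i) (g i) (h i) }
              ; identity = (λ f → ≗⇒≈ λ i → ℚₚ.+-identityˡ (f i)) , (λ f → ≗⇒≈ λ i → ℚₚ.+-identityʳ (f i)) }
            ; inverse = (λ f → ≗⇒≈ λ i → ℚₚ.+-inverseˡ (f i)) , (λ f → ≗⇒≈ λ i → ℚₚ.+-inverseʳ (f i))
            ; ⁻¹-cong = λ e → mod λ i l → cong -ℚ_ (at e i l) }
          ; comm = λ f g → ≗⇒≈ λ i → ℚₚ.+-comm (f i) (g i) }
        ; *-cong = λ e e′ → mod λ i l → *q-cong≤ i (λ j l′ → at e j (ℕₚ.≤-trans l′ l)) (λ j l′ → at e′ j (ℕₚ.≤-trans l′ l))
        ; *-assoc = λ f g h → ≗⇒≈ (*q-assoc f g h)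
        ; *-identity = (λ f → ≗⇒≈ (*q-identityˡ f)) , (λ f → ≗⇒≈ λ N → trans (*q-comm f 1q N) (*q-identityˡ f N))
        ; distrib = (λ f g h → ≗⇒≈ (*q-distribˡ f g h))
                  , (λ f g h → ≗⇒≈ (*q-distribʳ g h f)) }
      ; *-comm = λ f g → ≗⇒≈ (*q-comm f g) } }

-- Exponentials of linear forms

*X-cons : ∀ {r} (f g : ℚ⟦X⟧ (suc r)) a α →
  (f *X g) (a ∷ α) ≡ Σℚ (suc a) (λ b → ((λ β → f (b ∷ β)) *X (λ β → g (a ∸ b ∷ β))) α)
*X-cons f g a α = trans (∑-concatMap (λ b → map (b ∷_) (below α)) [ 0 ⋯ a ] (λ β → f β *ℚ g (zipWith _∸_ (a ∷ α) β)))
  (trans (∑-cong [ 0 ⋯ a ] (λ b → ∑-map (b ∷_) (below α) (λ β → f β *ℚ g (zipWith _∸_ (a ∷ α) β))))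
    (∑-applyUpTo id (suc a) (λ b → ((λ β → f (b ∷ β)) *X (λ β → g (a ∸ b ∷ β))) α)))

*X-cong : ∀ {r} {f f′ g g′ : ℚ⟦X⟧ r} → f ≗ f′ → g ≗ g′ → f *X g ≗ f′ *X g′
*X-cong e e′ α = ∑-cong (below α) (λ β → cong₂ _*ℚ_ (e β) (e′ (zipWith _∸_ α β)))

*X-·ˡ : ∀ {r} c (f g : ℚ⟦X⟧ r) → (c · f) *X g ≗ c · (f *X g)
*X-·ˡ c f g α = trans (∑-cong (below α) (λ β → ℚₚ.*-assoc c (f β) (g (zipWith _∸_ α β)))) (∑-*ˡ (below α) c _)

*X-·ʳ : ∀ {r} c (f g : ℚ⟦X⟧ r) → f *X (c · g) ≗ c · (f *X g)
*X-·ʳ c f g α = trans (∑-cong (below α) (λ β →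
  *ℚ-left-comm (f β) c (g (zipWith _∸_ α β)))) (∑-*ˡ (below α) c _)

*X-zeroˡ : ∀ {r} (g : ℚ⟦X⟧ r) → 𝟘 *X g ≗ 𝟘
*X-zeroˡ g α = trans (∑-cong (below α) (λ β → ℚₚ.*-zeroˡ (g (zipWith _∸_ α β)))) (∑-0 (below α))

-- The coefficients of exp (c 0 X₁ + c 1 X₂ + …).
E : {r : ℕ} → (ℕ → ℚ) → ℚ⟦X⟧ r
E c []      = 1ℚ
E c (a ∷ α) = pw a (c 0) *ℚ E (c ∘ suc) α

E-*X : ∀ {r} c c′ → E {r} c *X E c′ ≗ E (c ⊕ c′)
E-*X c c′ []      = refl
E-*X c c′ (a ∷ α) = begin
  (E c *X E c′) (a ∷ α)
    ≡⟨ *X-cons (E c) (E c′) a α ⟩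
  Σℚ (suc a) (λ b → ((pw b (c 0) · E (c ∘ suc)) *X (pw (a ∸ b) (c′ 0) · E (c′ ∘ suc))) α)
    ≡⟨ Σℚ-cong (suc a) (λ b → trans (*X-·ˡ (pw b (c 0)) (E (c ∘ suc)) (pw (a ∸ b) (c′ 0) · E (c′ ∘ suc)) α)
         (trans (cong (pw b (c 0) *ℚ_) (trans (*X-·ʳ (pw (a ∸ b) (c′ 0)) (E (c ∘ suc)) (E (c′ ∘ suc)) α)
             (cong (pw (a ∸ b) (c′ 0) *ℚ_) (E-*X (c ∘ suc) (c′ ∘ suc) α))))
           (sym (ℚₚ.*-assoc (pw b (c 0)) (pw (a ∸ b) (c′ 0)) (E ((c ∘ suc) ⊕ (c′ ∘ suc)) α))))) ⟩
  Σℚ (suc a) (λ b → pw b (c 0) *ℚ pw (a ∸ b) (c′ 0) *ℚ E ((c ∘ suc) ⊕ (c′ ∘ suc)) α)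
    ≡⟨ Σℚ-*ʳ (suc a) (E ((c ∘ suc) ⊕ (c′ ∘ suc)) α) (λ b → pw b (c 0) *ℚ pw (a ∸ b) (c′ 0)) ⟩
  Σℚ (suc a) (λ b → pw b (c 0) *ℚ pw (a ∸ b) (c′ 0)) *ℚ E ((c ∘ suc) ⊕ (c′ ∘ suc)) α
    ≡⟨ cong (_*ℚ E ((c ∘ suc) ⊕ (c′ ∘ suc)) α) (pw-+ a (c 0) (c′ 0)) ⟨
  E (c ⊕ c′) (a ∷ α) ∎
  where open ≡-Reasoning

1X≗E : ∀ {r} → 1X {r} ≗ E 𝟘
1X≗E []            = refl
1X≗E (zero ∷ α)    = trans (1X≗E α) (sym (ℚₚ.*-identityˡ (E 𝟘 α)))
1X≗E (suc a ∷ α)   = sym (trans (cong (_*ℚ E 𝟘 α) (pw-suc-0 a)) (ℚₚ.*-zeroˡ (E 𝟘 α)))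

-- The linear form c 0 X₁ + c 1 X₂ + ….
ℓ : {r : ℕ} → (ℕ → ℚ) → ℚ⟦X⟧ r
ℓ c []                = 0ℚ
ℓ c (zero ∷ α)        = ℓ (c ∘ suc) α
ℓ c (suc zero ∷ α)    = c 0 *ℚ 1X α
ℓ c (suc (suc a) ∷ α) = 0ℚ

ℓ-𝟘 : ∀ {r} {c : ℕ → ℚ} → c ≗ 𝟘 → ℓ {r} c ≗ 𝟘
ℓ-𝟘 e []                = refl
ℓ-𝟘 e (zero ∷ α)        = ℓ-𝟘 (e ∘ suc) α
ℓ-𝟘 e (suc zero ∷ α)    = trans (cong (_*ℚ 1X α) (e 0)) (ℚₚ.*-zeroˡ (1X α))
ℓ-𝟘 e (suc (suc a) ∷ α) = refl

ℓ-⊖ : ∀ {r} c c′ → ℓ {r} (c ⊖ c′) ≗ ℓ c ⊖ ℓ c′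
ℓ-⊖ c c′ []                = refl
ℓ-⊖ c c′ (zero ∷ α)        = ℓ-⊖ (c ∘ suc) (c′ ∘ suc) α
ℓ-⊖ c c′ (suc zero ∷ α)    = solve 3 (λ a b x → (a :- b) :* x := a :* x :- b :* x) refl (c 0) (c′ 0) (1X α)
ℓ-⊖ c c′ (suc (suc a) ∷ α) = refl

ℓ-· : ∀ {r} x c → ℓ {r} (x · c) ≗ x · ℓ c
ℓ-· x c []                = sym (ℚₚ.*-zeroʳ x)
ℓ-· x c (zero ∷ α)        = ℓ-· x (c ∘ suc) α
ℓ-· x c (suc zero ∷ α)    = ℚₚ.*-assoc x (c 0) (1X α)
ℓ-· x c (suc (suc a) ∷ α) = sym (ℚₚ.*-zeroʳ x)

unit : ℕ → ℕ → ℚ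
unit s t = if suc t ≡ᵇ s then 1ℚ else 0ℚ

tabulate-0 : ∀ r → tabulate {n = r} (λ _ → 0) ≡ replicate r 0
tabulate-0 zero    = refl
tabulate-0 (suc r) = cong (0 ∷_) (tabulate-0 r)

-- The bound matters: for `s > r` the exponent vector in `X s` is zero, so `X s` would be the
-- constant 1, while the linear form vanishes.
X≗ℓ : ∀ {r} s → s ≤ r → X {r} s ≗ ℓ (unit s)
X≗ℓ zero s≤r α = sym (ℓ-𝟘 (λ _ → refl) α)
X≗ℓ (suc zero)    (s≤s l) (zero ∷ α)        = sym (ℓ-𝟘 (λ _ → refl) α)
X≗ℓ (suc (suc s)) (s≤s l) (zero ∷ α)        = X≗ℓ (suc s) l α
X≗ℓ {suc r} (suc zero) (s≤s l) (suc zero ∷ α) =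
  trans (cong (λ v → δ v α) (tabulate-0 r)) (sym (ℚₚ.*-identityˡ (1X α)))
X≗ℓ (suc (suc s)) (s≤s l) (suc zero ∷ α)    = sym (ℚₚ.*-zeroˡ (1X α))
X≗ℓ (suc zero)    (s≤s l) (suc (suc a) ∷ α) = refl
X≗ℓ (suc (suc s)) (s≤s l) (suc (suc a) ∷ α) = refl

*X-identityˡ : ∀ {r} (g : ℚ⟦X⟧ r) → 1X *X g ≗ g
*X-identityˡ g []      = trans (ℚₚ.+-identityʳ _) (ℚₚ.*-identityˡ (g []))
*X-identityˡ g (a ∷ α) = trans (*X-cons 1X g a α) (trans (Σℚ-head a _)
  (trans (cong₂ _+ℚ_ (*X-identityˡ (λ β → g (a ∷ β)) α)
                     (Σℚ-vanish a _ (λ i _ → *X-zeroˡ (λ β → g (a ∸ suc i ∷ β)) α)))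
    (ℚₚ.+-identityʳ (g (a ∷ α)))))

ℓ-*X-zero : ∀ {r} c (g : ℚ⟦X⟧ (suc r)) α → (ℓ c *X g) (0 ∷ α) ≡ (ℓ (c ∘ suc) *X (λ β → g (0 ∷ β))) α
ℓ-*X-zero c g α = trans (*X-cons (ℓ c) g 0 α) (ℚₚ.+-identityˡ _)

ℓ-*X-suc : ∀ {r} c (g : ℚ⟦X⟧ (suc r)) a α →
  (ℓ c *X g) (suc a ∷ α) ≡ (ℓ (c ∘ suc) *X (λ β → g (suc a ∷ β))) α +ℚ c 0 *ℚ g (a ∷ α)
ℓ-*X-suc c g a α = trans (*X-cons (ℓ c) g (suc a) α) (trans (Σℚ-head (suc a) _)
  (cong ((ℓ (c ∘ suc) *X (λ β → g (suc a ∷ β))) α +ℚ_) (trans (Σℚ-head a _)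
    (trans (cong₂ _+ℚ_ (trans (*X-·ˡ (c 0) 1X (λ β → g (a ∷ β)) α) (cong (c 0 *ℚ_) (*X-identityˡ (λ β → g (a ∷ β)) α)))
        (Σℚ-vanish a _ (λ i _ → *X-zeroˡ (λ β → g (suc a ∸ suc (suc i) ∷ β)) α)))
      (ℚₚ.+-identityʳ (c 0 *ℚ g (a ∷ α)))))))

-- Euler's identity: multiplication by a linear form raises the degree, so the
-- weight χ of the degree turns into θ with θ (1 + n) = χ n.
ℓ-*X-E : ∀ {r} c (χ θ : ℕ → ℚ) → (∀ n → θ (suc n) ≡ χ n) → (α : Vec ℕ r) →
  (ℓ c *X (λ β → χ (Vec.sum β) *ℚ E c β)) α ≡ fromℕ (Vec.sum α) *ℚ (θ (Vec.sum α) *ℚ E c α)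
ℓ-*X-E c χ θ e [] = trans (ℚₚ.+-identityʳ (0ℚ *ℚ (χ 0 *ℚ 1ℚ))) (trans (ℚₚ.*-zeroˡ (χ 0 *ℚ 1ℚ)) (sym (ℚₚ.*-zeroˡ (θ 0 *ℚ 1ℚ))))
ℓ-*X-E c χ θ e (zero ∷ α) = trans (ℓ-*X-zero c (λ β → χ (Vec.sum β) *ℚ E c β) α)
  (trans (*X-cong {f = ℓ (c ∘ suc)} (λ _ → refl) (λ β → cong (χ (Vec.sum β) *ℚ_) (ℚₚ.*-identityˡ (E (c ∘ suc) β))) α)
    (trans (ℓ-*X-E (c ∘ suc) χ θ e α)
      (cong (λ t → fromℕ (Vec.sum α) *ℚ (θ (Vec.sum α) *ℚ t)) (sym (ℚₚ.*-identityˡ (E (c ∘ suc) α))))))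
ℓ-*X-E {suc r} c χ θ e (suc a ∷ α) = begin
  (ℓ c *X (λ β → χ (Vec.sum β) *ℚ E c β)) (suc a ∷ α)
    ≡⟨ ℓ-*X-suc c (λ β → χ (Vec.sum β) *ℚ E c β) a α ⟩
  (ℓ (c ∘ suc) *X (λ β → χ (suc a + Vec.sum β) *ℚ (p *ℚ E (c ∘ suc) β))) α +ℚ c 0 *ℚ (χ (a + n) *ℚ (pw a (c 0) *ℚ e′))
    ≡⟨ cong (_+ℚ c 0 *ℚ (χ (a + n) *ℚ (pw a (c 0) *ℚ e′)))
         (trans (*X-cong {f = ℓ (c ∘ suc)} (λ _ → refl) (λ β →
           *ℚ-left-comm (χ (suc a + Vec.sum β)) p (E (c ∘ suc) β)) α)
         (trans (*X-·ʳ p (ℓ (c ∘ suc)) (λ β → χ (suc a + Vec.sum β) *ℚ E (c ∘ suc) β) α)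
           (cong (p *ℚ_) (ℓ-*X-E (c ∘ suc) (λ m → χ (suc a + m)) (λ m → θ (suc a + m))
             (λ m → trans (cong θ (ℕₚ.+-suc (suc a) m)) (e (suc a + m))) α)))) ⟩
  p *ℚ (fromℕ n *ℚ (θ (suc a + n) *ℚ e′)) +ℚ c 0 *ℚ (χ (a + n) *ℚ (pw a (c 0) *ℚ e′))
    ≡⟨ cong (λ t → p *ℚ (fromℕ n *ℚ (θ (suc a + n) *ℚ e′)) +ℚ c 0 *ℚ (t *ℚ (pw a (c 0) *ℚ e′))) (e (a + n)) ⟨
  p *ℚ (fromℕ n *ℚ (θ (suc a + n) *ℚ e′)) +ℚ c 0 *ℚ (θ (suc a + n) *ℚ (pw a (c 0) *ℚ e′))
    ≡⟨ solve 6 (λ p n t e c w → p :* (n :* (t :* e)) :+ c :* (t :* (w :* e)) := n :* (t :* (p :* e)) :+ (c :* w) :* (t :* e)) refl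
         p (fromℕ n) (θ (suc a + n)) e′ (c 0) (pw a (c 0)) ⟩
  fromℕ n *ℚ (θ (suc a + n) *ℚ (p *ℚ e′)) +ℚ (c 0 *ℚ pw a (c 0)) *ℚ (θ (suc a + n) *ℚ e′)
    ≡⟨ cong (λ t → fromℕ n *ℚ (θ (suc a + n) *ℚ (p *ℚ e′)) +ℚ t *ℚ (θ (suc a + n) *ℚ e′)) (*ℚ-pw a (c 0)) ⟩
  fromℕ n *ℚ (θ (suc a + n) *ℚ (p *ℚ e′)) +ℚ (fromℕ (suc a) *ℚ p) *ℚ (θ (suc a + n) *ℚ e′)
    ≡⟨ solve 5 (λ n t p e a → n :* (t :* (p :* e)) :+ (a :* p) :* (t :* e) := (a :+ n) :* (t :* (p :* e))) refl
         (fromℕ n) (θ (suc a + n)) p e′ (fromℕ (suc a)) ⟩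
  (fromℕ (suc a) +ℚ fromℕ n) *ℚ (θ (suc a + n) *ℚ (p *ℚ e′))
    ≡⟨ cong (_*ℚ (θ (suc a + n) *ℚ (p *ℚ e′))) (fromℕ-+ (suc a) n) ⟨
  fromℕ (suc a + n) *ℚ (θ (suc a + n) *ℚ (p *ℚ e′)) ∎
  where
  open ≡-Reasoning
  n = Vec.sum α
  p = pw (suc a) (c 0)
  e′ = E (c ∘ suc) α

[_≟_] : ℕ → ℕ → ℚ
[ n ≟ j ] = if n ≡ᵇ j then 1ℚ else 0ℚ

[≟]-cancel : ∀ n j x → fromℕ n *ℚ ([ n ≟ j ] *ℚ x) ≡ fromℕ j *ℚ ([ n ≟ j ] *ℚ x)
[≟]-cancel n j x = go (n ≡ᵇ j) refl
  where
  go : ∀ b → (n ≡ᵇ j) ≡ b → fromℕ n *ℚ ((if b then 1ℚ else 0ℚ) *ℚ x) ≡ fromℕ j *ℚ ((if b then 1ℚ else 0ℚ) *ℚ x)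
  go true  e = cong (λ m → fromℕ m *ℚ (1ℚ *ℚ x)) (ℕₚ.≡ᵇ⇒≡ n j (subst Bool.T (sym e) _))
  go false e = trans (cong (fromℕ n *ℚ_) (ℚₚ.*-zeroˡ x)) (trans (ℚₚ.*-zeroʳ (fromℕ n))
    (sym (trans (cong (fromℕ j *ℚ_) (ℚₚ.*-zeroˡ x)) (ℚₚ.*-zeroʳ (fromℕ j)))))

1X≗[≟] : ∀ {r} c (α : Vec ℕ r) → 1X α ≡ [ Vec.sum α ≟ 0 ] *ℚ E c α
1X≗[≟] c []          = refl
1X≗[≟] c (zero ∷ α)  = trans (1X≗[≟] (c ∘ suc) α) (cong ([ Vec.sum α ≟ 0 ] *ℚ_) (sym (ℚₚ.*-identityˡ (E (c ∘ suc) α))))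
1X≗[≟] c (suc a ∷ α) = sym (ℚₚ.*-zeroˡ (E c (suc a ∷ α)))

-- The j-th power over j! is the part of total degree j of the exponential. By Euler's identity one
-- more factor of the form yields the total degree of the monomial, which equals `j + 1` wherever
-- the delta is nonzero and cancels against `1/1+ j`.
ℓ-^X : ∀ {r} c j (α : Vec ℕ r) → 1/ j ! *ℚ (ℓ c ^X j) α ≡ [ Vec.sum α ≟ j ] *ℚ E c α
ℓ-^X c zero    α = trans (ℚₚ.*-identityˡ (1X α)) (1X≗[≟] c α)
ℓ-^X c (suc j) α = begin
  1/ suc j ! *ℚ (ℓ c *X (ℓ c ^X j)) α
    ≡⟨ cong (_*ℚ (ℓ c *X (ℓ c ^X j)) α) (1/suc! j) ⟩
  (1/1+ j) *ℚ 1/ j ! *ℚ (ℓ c *X (ℓ c ^X j)) α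
    ≡⟨ ℚₚ.*-assoc (1/1+ j) (1/ j !) _ ⟩
  (1/1+ j) *ℚ (1/ j ! *ℚ (ℓ c *X (ℓ c ^X j)) α)
    ≡⟨ cong ((1/1+ j) *ℚ_) (*X-·ʳ (1/ j !) (ℓ c) (ℓ c ^X j) α) ⟨
  (1/1+ j) *ℚ (ℓ c *X (1/ j ! · (ℓ c ^X j))) α
    ≡⟨ cong ((1/1+ j) *ℚ_) (*X-cong {f = ℓ c} (λ _ → refl) (ℓ-^X c j) α) ⟩
  (1/1+ j) *ℚ (ℓ c *X (λ β → [ Vec.sum β ≟ j ] *ℚ E c β)) α
    ≡⟨ cong ((1/1+ j) *ℚ_) (ℓ-*X-E c [_≟ j ] [_≟ suc j ] (λ _ → refl) α) ⟩
  (1/1+ j) *ℚ (fromℕ (Vec.sum α) *ℚ ([ Vec.sum α ≟ suc j ] *ℚ E c α))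
    ≡⟨ cong ((1/1+ j) *ℚ_) ([≟]-cancel (Vec.sum α) (suc j) (E c α)) ⟩
  (1/1+ j) *ℚ (fromℕ (suc j) *ℚ ([ Vec.sum α ≟ suc j ] *ℚ E c α))
    ≡⟨ 1/1+-cancel j _ ⟩
  [ Vec.sum α ≟ suc j ] *ℚ E c α ∎
  where open ≡-Reasoning

[≟]-refl : ∀ n → [ n ≟ n ] ≡ 1ℚ
[≟]-refl zero    = refl
[≟]-refl (suc n) = [≟]-refl n

[≟]-> : ∀ {n j} → j < n → [ n ≟ j ] ≡ 0ℚ
[≟]-> {suc n} {zero}  l       = refl
[≟]-> {suc n} {suc j} (s≤s l) = [≟]-> l

exp-ℓ : ∀ {r} c → exp (ℓ {r} c) ≗ E c
exp-ℓ c α = begin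
  exp (ℓ c) α
    ≡⟨ ∑-cong [ 0 ⋯ n ] (λ j → ℓ-^X c j α) ⟩
  ∑ [ 0 ⋯ n ] (λ j → [ n ≟ j ] *ℚ E c α)
    ≡⟨ ∑-applyUpTo id (suc n) (λ j → [ n ≟ j ] *ℚ E c α) ⟩
  Σℚ n (λ j → [ n ≟ j ] *ℚ E c α) +ℚ [ n ≟ n ] *ℚ E c α
    -- The cutoff of `exp` at the total degree `n` lets exactly one term survive, the last.
    ≡⟨ cong₂ _+ℚ_ (Σℚ-vanish n _ (λ j l → trans (cong (_*ℚ E c α) ([≟]-> l)) (ℚₚ.*-zeroˡ (E c α))))
                  (cong (_*ℚ E c α) ([≟]-refl n)) ⟩
  0ℚ +ℚ 1ℚ *ℚ E c α
    ≡⟨ trans (ℚₚ.+-identityˡ _) (ℚₚ.*-identityˡ (E c α)) ⟩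
  E c α ∎
  where
  open ≡-Reasoning
  n = Vec.sum α

^X-cong : ∀ {r} {f g : ℚ⟦X⟧ r} → f ≗ g → ∀ j → f ^X j ≗ g ^X j
^X-cong e zero    α = refl
^X-cong e (suc j) α = *X-cong e (^X-cong e j) α

exp-cong : ∀ {r} {f g : ℚ⟦X⟧ r} → f ≗ g → exp f ≗ exp g
exp-cong e α = ∑-cong [ 0 ⋯ Vec.sum α ] (λ j → cong (1/ j ! *ℚ_) (^X-cong e j α))

-- The coefficients of the linear form ∑ d_j Y_j, where the Y_j are the entries of `lower s is`.
slope : ∀ {m} → ℕ → Vec ℕ m → Vec ℕ m → ℕ → ℚ
slope s []       []       = 𝟘
slope s (i ∷ is) (d ∷ ds) = (fromℕ d · (unit s ⊖ unit (s ∸ i))) ⊕ slope (s ∸ i) is ds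

∏X-exp-lower : ∀ {m r} s → s ≤ r → (is ds : Vec ℕ m) →
  ∏X {r} (zipWith (λ d Y → exp (fromℕ d · Y)) ds (lower s is)) ≗ E (slope s is ds)
∏X-exp-lower s s≤r []       []       = 1X≗E
∏X-exp-lower s s≤r (i ∷ is) (d ∷ ds) α = trans
  (*X-cong (λ β → trans (exp-cong factor β) (exp-ℓ (fromℕ d · (unit s ⊖ unit (s ∸ i))) β))
    (∏X-exp-lower (s ∸ i) s∸i≤r is ds) α)
  (E-*X _ (slope (s ∸ i) is ds) α)
  where
  s∸i≤r = ℕₚ.≤-trans (ℕₚ.m∸n≤m s i) s≤r
  factor : fromℕ d · (X s ⊖ X (s ∸ i)) ≗ ℓ (fromℕ d · (unit s ⊖ unit (s ∸ i)))
  factor β = sym (trans (ℓ-· (fromℕ d) (unit s ⊖ unit (s ∸ i)) β) (cong (fromℕ d *ℚ_)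
    (trans (ℓ-⊖ (unit s) (unit (s ∸ i)) β) (sym (cong₂ _-ℚ_ (X≗ℓ s s≤r β) (X≗ℓ (s ∸ i) s∸i≤r β))))))

-- The series g^sh as sums over weakly increasing indices

L : ℕ → ℚ⟦q⟧
L d = q^ d /1-q^

-- The weight λ(d′, d) of a summation index d following d′.
Letter : Set
Letter = ℕ → ℕ → ℚ

gap : ℕ → Letter
gap k d′ d = pw k (fromℕ d -ℚ fromℕ d′)

module Words (B : ℕ) where

  ∑> : ℕ → (ℕ → ℚ⟦q⟧) → ℚ⟦q⟧
  ∑> a f M = Σℚ (B ∸ a) (λ k → f (suc (a + k)) M)

  -- The sum over all d ≤ d₁ ≤ d₂ ≤ … ≤ B in which the block of indices equal to
  -- d already has i members; a block of size i gets the weight L_d^i / i!.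
  K : ℕ → ℕ → List Letter → ℚ⟦q⟧
  K d i []      = 1q
  K d i (x ∷ w) = ((x d d *ℚ (1/1+ i)) · (L d *q K d (suc i) w)) ⊕ ∑> d (λ d′ → x d d′ · (L d′ *q K d′ 1 w))

  -- All indices lie strictly above `d`, so the first of them opens a new block.
  F : ℕ → List Letter → ℚ⟦q⟧
  F d []      = 1q
  F d (x ∷ w) = ∑> d (λ d′ → x d d′ · (L d′ *q K d′ 1 w))

  gaps : (ℕ → ℕ) → ℕ → List Letter
  gaps α s = map gap (applyDownFrom α s)

*q-∑ʳ : ∀ {I : Set} (is : List I) (f : ℚ⟦q⟧) (g : I → ℚ⟦q⟧) M → (f *q (λ N → ∑ is (λ i → g i N))) M ≡ ∑ is (λ i → (f *q g i) M)
*q-∑ʳ is f g M = trans (∑-cong [ 0 ⋯ M ] (λ j → sym (∑-*ˡ is (f j) (λ i → g i (M ∸ j)))))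
  (∑-swap [ 0 ⋯ M ] is (λ j i → f j *ℚ g i (M ∸ j)))

*q-·ʳ : ∀ c f g → f *q (c · g) ≗ c · (f *q g)
*q-·ʳ c f g M = trans (*q-comm f (c · g) M) (trans (*q-·ˡ c g f M) (cong (c *ℚ_) (*q-comm g f M)))

*q-Σʳ : ∀ n (f : ℚ⟦q⟧) (g : ℕ → ℚ⟦q⟧) M → (f *q (λ N → Σℚ n (λ i → g i N))) M ≡ Σℚ n (λ i → (f *q g i) M)
*q-Σʳ n f g M = trans (*q-comm f (λ N → Σℚ n (λ i → g i N)) M) (trans (*q-Σˡ n g f M) (Σℚ-cong n (λ i → *q-comm (g i) f M)))

-- The product `E`, peeled from its last variable: the blocks consume the variables from X_r
-- downwards, whereas vectors open from X₁.
Epart : (ℕ → ℕ) → ℕ → (ℕ → ℚ) → ℚ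
Epart α zero    c = 1ℚ
Epart α (suc s) c = pw (α s) (c s) *ℚ Epart α s c

Epart-head : ∀ α s c → Epart α (suc s) c ≡ pw (α 0) (c 0) *ℚ Epart (α ∘ suc) s (c ∘ suc)
Epart-head α zero    c = refl
Epart-head α (suc s) c = trans (cong (pw (α (suc s)) (c (suc s)) *ℚ_) (Epart-head α s c))
  (*ℚ-left-comm (pw (α (suc s)) (c (suc s))) (pw (α 0) (c 0)) (Epart (α ∘ suc) s (c ∘ suc)))

Epart-cong : ∀ α s {c c′ : ℕ → ℚ} → (∀ t → t < s → c t ≡ c′ t) → Epart α s c ≡ Epart α s c′
Epart-cong α zero    e = refl
Epart-cong α (suc s) e = cong₂ _*ℚ_ (cong (pw (α s)) (e s (ℕₚ.n<1+n s))) (Epart-cong α s (λ t l → e t (ℕₚ.m<n⇒m<1+n l)))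

nth : ∀ {r} → Vec ℕ r → ℕ → ℕ
nth []      t       = 0
nth (a ∷ α) zero    = a
nth (a ∷ α) (suc t) = nth α t

E-Epart : ∀ {r} c (α : Vec ℕ r) → E c α ≡ Epart (nth α) r c
E-Epart c []      = refl
E-Epart {suc r} c (a ∷ α) = trans (cong (pw a (c 0) *ℚ_) (E-Epart (c ∘ suc) α)) (sym (Epart-head (nth (a ∷ α)) r c))

-- The weight of the j vanishing gaps inside a block of size j + 1.
inner : (ℕ → ℕ) → ℕ → ℕ → ℚ
inner α s       zero    = 1ℚ
inner α zero    (suc j) = 0ℚ
inner α (suc s) (suc j) = pw (α s) 0ℚ *ℚ inner α s j

unit-≥ : ∀ s t → s ≤ t → unit s t ≡ 0ℚ
unit-≥ zero    t       l       = refl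
unit-≥ (suc s) (suc t) (s≤s l) = unit-≥ s t l

unit-top : ∀ s → unit (suc s) s ≡ 1ℚ
unit-top zero    = refl
unit-top (suc s) = unit-top s

unit-< : ∀ s t → suc t < s → unit s t ≡ 0ℚ
unit-< (suc (suc s)) zero    l       = refl
unit-< (suc s)       (suc t) (s≤s l) = unit-< s t l

slope-≥ : ∀ {m} s (is ds : Vec ℕ m) t → s ≤ t → slope s is ds t ≡ 0ℚ
slope-≥ s []       []       t l = refl
slope-≥ s (i ∷ is) (d ∷ ds) t l = trans (cong₂ _+ℚ_
    (cong (fromℕ d *ℚ_) (cong₂ _-ℚ_ (unit-≥ s t l) (unit-≥ (s ∸ i) t s∸i≤t)))
    (slope-≥ (s ∸ i) is ds t s∸i≤t))
  (trans (ℚₚ.+-identityʳ _) (ℚₚ.*-zeroʳ (fromℕ d)))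
  where s∸i≤t = ℕₚ.≤-trans (ℕₚ.m∸n≤m s i) l

-- A block of size i with index d leaves the term - d X_(s-i). It is charged to the next block,
-- whose leading coefficient thereby becomes the gap to the previous index.
slope-from : ∀ {m} → ℕ → ℕ → Vec ℕ m → Vec ℕ m → ℕ → ℚ
slope-from s a is ds = slope s is ds ⊖ (fromℕ a · unit s)

slope-from-≥ : ∀ {m} s a (is ds : Vec ℕ m) t → s ≤ t → slope-from s a is ds t ≡ 0ℚ
slope-from-≥ s a is ds t l = trans (cong₂ _-ℚ_ (slope-≥ s is ds t l) (trans (cong (fromℕ a *ℚ_) (unit-≥ s t l)) (ℚₚ.*-zeroʳ (fromℕ a)))) refl

slope-from-∷ : ∀ {m} s a i d (is ds : Vec ℕ m) t →
  slope-from s a (i ∷ is) (d ∷ ds) t ≡ (fromℕ d -ℚ fromℕ a) *ℚ unit s t +ℚ slope-from (s ∸ i) d is ds t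
slope-from-∷ s a i d is ds t = solve 5 (λ d a u v s → (d :* (u :- v) :+ s) :- a :* u := (d :- a) :* u :+ (s :- d :* v)) refl
  (fromℕ d) (fromℕ a) (unit s t) (unit (s ∸ i) t) (slope (s ∸ i) is ds t)

Epart-vanishing : ∀ α s j c → j ≤ s → (∀ t → s ∸ j ≤ t → t < s → c t ≡ 0ℚ) → Epart α s c ≡ inner α s j *ℚ Epart α (s ∸ j) c
Epart-vanishing α s       zero    c l e = sym (ℚₚ.*-identityˡ (Epart α s c))
Epart-vanishing α (suc s) (suc j) c (s≤s l) e = trans (cong₂ _*ℚ_
    (cong (pw (α s)) (e s (ℕₚ.m∸n≤m s j) (ℕₚ.n<1+n s)))
    (Epart-vanishing α s j c l (λ t l₁ l₂ → e t l₁ (ℕₚ.m<n⇒m<1+n l₂))))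
  (sym (ℚₚ.*-assoc (pw (α s) 0ℚ) (inner α s j) (Epart α (s ∸ j) c)))

-- Only the top variable of a block can have a nonzero coefficient, namely the gap; the `j`
-- variables below it have coefficient 0 and contribute `inner`.
Epart-block : ∀ {m} α s j a d (is ds : Vec ℕ m) → j ≤ s →
  Epart α (suc s) (slope-from (suc s) a (suc j ∷ is) (d ∷ ds))
    ≡ (gap (α s) a d *ℚ inner α s j) *ℚ Epart α (s ∸ j) (slope-from (s ∸ j) d is ds)
Epart-block α s j a d is ds l = trans (cong₂ _*ℚ_ (cong (pw (α s)) top)
    (trans (Epart-cong α s {c′ = slope-from (s ∸ j) d is ds} below-top)
      (Epart-vanishing α s j (slope-from (s ∸ j) d is ds) l (λ t l₁ _ → slope-from-≥ (s ∸ j) d is ds t l₁))))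
  (sym (ℚₚ.*-assoc (gap (α s) a d) (inner α s j) _))
  where
  top : slope-from (suc s) a (suc j ∷ is) (d ∷ ds) s ≡ fromℕ d -ℚ fromℕ a
  top = trans (slope-from-∷ (suc s) a (suc j) d is ds s) (trans (cong₂ _+ℚ_
      (trans (cong ((fromℕ d -ℚ fromℕ a) *ℚ_) (unit-top s)) (ℚₚ.*-identityʳ (fromℕ d -ℚ fromℕ a)))
      (slope-from-≥ (s ∸ j) d is ds s (ℕₚ.m∸n≤m s j)))
    (ℚₚ.+-identityʳ (fromℕ d -ℚ fromℕ a)))
  below-top : ∀ t → t < s → slope-from (suc s) a (suc j ∷ is) (d ∷ ds) t ≡ slope-from (s ∸ j) d is ds t
  below-top t t<s = trans (slope-from-∷ (suc s) a (suc j) d is ds t) (trans (cong (_+ℚ slope-from (s ∸ j) d is ds t)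
      (trans (cong ((fromℕ d -ℚ fromℕ a) *ℚ_) (unit-< (suc s) t (s≤s t<s))) (ℚₚ.*-zeroʳ (fromℕ d -ℚ fromℕ a))))
    (ℚₚ.+-identityˡ _))

-- Regrouping the defining sum by blocks of equal indices

module _ (B : ℕ) where
  open Words B

  ∏L : ∀ {m} → Vec ℕ m → Vec ℕ m → ℚ⟦q⟧
  ∏L is ds = ∏q (zipWith (λ d n → L d ^q n) ds is)

  invFact : ∀ {m} → Vec ℕ m → ℚ
  invFact is = foldr′ _*ℚ_ 1ℚ (Vec.map 1/_! is)

  -- The part of the defining sum with exactly `m` blocks, all of whose indices lie above `a`.
  blocks : (α : ℕ → ℕ) (m s a : ℕ) → ℚ⟦q⟧
  blocks α m s a M = ∑ (compositions m s) (λ is → invFact is *ℚ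
    ∑ (increasing m a B) (λ ds → Epart α s (slope-from s a is ds) *ℚ ∏L is ds M))

  blocks-suc : ∀ α m s a M → blocks α (suc m) (suc s) a M ≡
    Σℚ (suc s) (λ j → ∑> a (λ d → (1/ suc j ! *ℚ (gap (α s) a d *ℚ inner α s j)) · ((L d ^q suc j) *q blocks α m (s ∸ j) d)) M)
  blocks-suc α m s a M = begin
    blocks α (suc m) (suc s) a M
      ≡⟨ ∑-concatMap (λ i → map (i ∷_) (compositions m (suc s ∸ i))) [ 1 ⋯ suc s ] summand ⟩
    ∑ [ 1 ⋯ suc s ] (λ i → ∑ (map (i ∷_) (compositions m (suc s ∸ i))) summand)
      ≡⟨ ∑-applyUpTo suc (suc s) (λ i → ∑ (map (i ∷_) (compositions m (suc s ∸ i))) summand) ⟩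
    Σℚ (suc s) (λ j → ∑ (map (suc j ∷_) (compositions m (s ∸ j))) summand)
      ≡⟨ Σℚ-cong< (suc s) (λ { j (s≤s l) → step j l }) ⟩
    Σℚ (suc s) (λ j → ∑> a (λ d → κ j d · ((L d ^q suc j) *q blocks α m (s ∸ j) d)) M) ∎
    where
    open ≡-Reasoning
    κ : ℕ → ℕ → ℚ
    κ j d = 1/ suc j ! *ℚ (gap (α s) a d *ℚ inner α s j)
    inside : Vec ℕ (suc m) → Vec ℕ (suc m) → ℚ
    inside is ds = Epart α (suc s) (slope-from (suc s) a is ds) *ℚ ∏L is ds M
    summand : Vec ℕ (suc m) → ℚ
    summand is = invFact is *ℚ ∑ (increasing (suc m) a B) (inside is)
    step : ∀ j → j ≤ s → ∑ (map (suc j ∷_) (compositions m (s ∸ j))) summand ≡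
      ∑> a (λ d → κ j d · ((L d ^q suc j) *q blocks α m (s ∸ j) d)) M
    step j l = begin
      ∑ (map (suc j ∷_) C) summand
        ≡⟨ ∑-map (suc j ∷_) C summand ⟩
      ∑ C (λ is → (1/ suc j ! *ℚ invFact is) *ℚ ∑ (increasing (suc m) a B) (inside (suc j ∷ is)))
        ≡⟨ ∑-cong C (λ is → trans (cong ((1/ suc j ! *ℚ invFact is) *ℚ_)
             (trans (∑-concatMap (λ d → map (d ∷_) (increasing m d B)) [ suc a ⋯ B ] (inside (suc j ∷ is)))
             (trans (∑-applyUpTo (λ k → suc (a + k)) (B ∸ a) (λ d → ∑ (map (d ∷_) (increasing m d B)) (inside (suc j ∷ is))))
               (Σℚ-cong (B ∸ a) (λ k → trans (∑-map (suc (a + k) ∷_) (increasing m (suc (a + k)) B) (inside (suc j ∷ is)))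
                 (inner-sum is (suc (a + k))))))))
             (sym (Σℚ-*ˡ (B ∸ a) (1/ suc j ! *ℚ invFact is) (λ k → G is (suc (a + k)))))) ⟩
      ∑ C (λ is → Σℚ (B ∸ a) (λ k → (1/ suc j ! *ℚ invFact is) *ℚ G is (suc (a + k))))
        ≡⟨ ∑-Σℚ C (B ∸ a) (λ is k → (1/ suc j ! *ℚ invFact is) *ℚ G is (suc (a + k))) ⟩
      Σℚ (B ∸ a) (λ k → ∑ C (λ is → (1/ suc j ! *ℚ invFact is) *ℚ G is (suc (a + k))))
        ≡⟨ Σℚ-cong (B ∸ a) (λ k → outer-sum (suc (a + k))) ⟩
      ∑> a (λ d → κ j d · ((L d ^q suc j) *q blocks α m (s ∸ j) d)) M ∎
      where
      C = compositions m (s ∸ j)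
      w : Vec ℕ m → ℕ → ℚ⟦q⟧
      w is d N = ∑ (increasing m d B) (λ ds → Epart α (s ∸ j) (slope-from (s ∸ j) d is ds) *ℚ ∏L is ds N)
      G : Vec ℕ m → ℕ → ℚ
      G is d = (gap (α s) a d *ℚ inner α s j) *ℚ ((L d ^q suc j) *q w is d) M
      ∑-Σℚ : ∀ {I : Set} (is : List I) n (f : I → ℕ → ℚ) → ∑ is (λ i → Σℚ n (f i)) ≡ Σℚ n (λ k → ∑ is (λ i → f i k))
      ∑-Σℚ []       n f = sym (Σℚ-0 n)
      ∑-Σℚ (i ∷ is) n f = trans (cong (Σℚ n (f i) +ℚ_) (∑-Σℚ is n f)) (sym (Σℚ-+ n (f i) (λ k → ∑ is (λ i → f i k))))
      inner-sum : ∀ is d → ∑ (increasing m d B) (λ ds → inside (suc j ∷ is) (d ∷ ds)) ≡ G is d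
      inner-sum is d = begin
        ∑ I (λ ds → inside (suc j ∷ is) (d ∷ ds))
          ≡⟨ ∑-cong I (λ ds → trans (cong (_*ℚ ((L d ^q suc j) *q ∏L is ds) M) (Epart-block α s j a d is ds l))
               (trans (ℚₚ.*-assoc g (p ds) (((L d ^q suc j) *q ∏L is ds) M))
                 (cong (g *ℚ_) (sym (*q-·ʳ (p ds) (L d ^q suc j) (∏L is ds) M))))) ⟩
        ∑ I (λ ds → g *ℚ ((L d ^q suc j) *q (p ds · ∏L is ds)) M)
          ≡⟨ ∑-*ˡ I g (λ ds → ((L d ^q suc j) *q (p ds · ∏L is ds)) M) ⟩
        g *ℚ ∑ I (λ ds → ((L d ^q suc j) *q (p ds · ∏L is ds)) M)
          ≡⟨ cong (g *ℚ_) (*q-∑ʳ I (L d ^q suc j) (λ ds → p ds · ∏L is ds) M) ⟨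
        G is d ∎
        where
        I = increasing m d B
        g = gap (α s) a d *ℚ inner α s j
        p : Vec ℕ m → ℚ
        p ds = Epart α (s ∸ j) (slope-from (s ∸ j) d is ds)
      outer-sum : ∀ d → ∑ C (λ is → (1/ suc j ! *ℚ invFact is) *ℚ G is d) ≡ κ j d *ℚ ((L d ^q suc j) *q blocks α m (s ∸ j) d) M
      outer-sum d = begin
        ∑ C (λ is → (1/ suc j ! *ℚ invFact is) *ℚ G is d)
          ≡⟨ ∑-cong C (λ is → trans (solve 4 (λ a b c x → (a :* b) :* (c :* x) := (a :* c) :* (b :* x)) refl
               (1/ suc j !) (invFact is) (gap (α s) a d *ℚ inner α s j) (((L d ^q suc j) *q w is d) M))
               (cong (κ j d *ℚ_) (sym (*q-·ʳ (invFact is) (L d ^q suc j) (w is d) M)))) ⟩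
        ∑ C (λ is → κ j d *ℚ ((L d ^q suc j) *q (invFact is · w is d)) M)
          ≡⟨ ∑-*ˡ C (κ j d) (λ is → ((L d ^q suc j) *q (invFact is · w is d)) M) ⟩
        κ j d *ℚ ∑ C (λ is → ((L d ^q suc j) *q (invFact is · w is d)) M)
          ≡⟨ cong (κ j d *ℚ_) (*q-∑ʳ C (L d ^q suc j) (λ is → invFact is · w is d) M) ⟨
        κ j d *ℚ ((L d ^q suc j) *q blocks α m (s ∸ j) d) M ∎

  -- i! / (i + j)!
  fall : ℕ → ℕ → ℚ
  fall i zero    = 1ℚ
  fall i (suc j) = (1/1+ i) *ℚ fall (suc i) j

  fall-last : ∀ i j → fall i (suc j) ≡ (1/1+ (i + j)) *ℚ fall i j
  fall-last i zero    = cong (λ n → (1/1+ n) *ℚ 1ℚ) (sym (ℕₚ.+-identityʳ i))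
  fall-last i (suc j) = trans (cong ((1/1+ i) *ℚ_) (fall-last (suc i) j))
    (trans (*ℚ-left-comm (1/1+ i) (1/1+ (suc i + j)) (fall (suc i) j))
      (cong (λ n → (1/1+ n) *ℚ fall i (suc j)) (sym (ℕₚ.+-suc i j))))

  fall-0 : ∀ j → fall 0 j ≡ 1/ j !
  fall-0 zero    = refl
  fall-0 (suc j) = trans (fall-last 0 j) (trans (cong ((1/1+ j) *ℚ_) (fall-0 j)) (sym (1/suc! j)))

  fall-1 : ∀ j → fall 1 j ≡ 1/ suc j !
  fall-1 j = trans (sym (ℚₚ.*-identityˡ (fall 1 j))) (fall-0 (suc j))

  gap-self : ∀ k d → gap k d d ≡ pw k 0ℚ
  gap-self k d = cong (pw k) (ℚₚ.+-inverseʳ (fromℕ d))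

  -- Unrolls `K` until the current block closes, `j` members later; the weights 1/(i+1), ...,
  -- 1/(i+j) collected on the way multiply to `fall i j`.
  K-blocks : ∀ α d i s M → K d i (gaps α s) M ≡
    Σℚ (suc s) (λ j → (inner α s j *ℚ fall i j) *ℚ ((L d ^q j) *q F d (gaps α (s ∸ j))) M)
  K-blocks α d i zero    M = sym (trans (ℚₚ.+-identityˡ _) (trans (ℚₚ.*-identityˡ _) (*q-identityˡ 1q M)))
  K-blocks α d i (suc s) M = begin
    (gap (α s) d d *ℚ (1/1+ i)) *ℚ (L d *q K d (suc i) (gaps α s)) M +ℚ F d (gaps α (suc s)) M
      ≡⟨ cong₂ _+ℚ_ (cong₂ _*ℚ_ (cong (_*ℚ (1/1+ i)) (gap-self (α s) d))
           (trans (*q-congˡ {L d} (K-blocks α d (suc i) s) M)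
             (*q-Σʳ (suc s) (L d) (λ j → (inner α s j *ℚ fall (suc i) j) · ((L d ^q j) *q F d (gaps α (s ∸ j)))) M)))
           (sym (trans (ℚₚ.*-identityˡ _) (*q-identityˡ (F d (gaps α (suc s))) M))) ⟩
    (pw (α s) 0ℚ *ℚ (1/1+ i)) *ℚ Σℚ (suc s) (λ j → (L d *q ((inner α s j *ℚ fall (suc i) j) · ((L d ^q j) *q F d (gaps α (s ∸ j))))) M) +ℚ head
      ≡⟨ cong (_+ℚ head) (trans (sym (Σℚ-*ˡ (suc s) (pw (α s) 0ℚ *ℚ (1/1+ i)) _)) (Σℚ-cong (suc s) (λ j →
           trans (cong ((pw (α s) 0ℚ *ℚ (1/1+ i)) *ℚ_) (trans (*q-·ʳ (inner α s j *ℚ fall (suc i) j) (L d) ((L d ^q j) *q F d (gaps α (s ∸ j))) M)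
               (cong ((inner α s j *ℚ fall (suc i) j) *ℚ_) (sym (*q-assoc (L d) (L d ^q j) (F d (gaps α (s ∸ j))) M)))))
             (solve 5 (λ p w z f x → (p :* w) :* ((z :* f) :* x) := ((p :* z) :* (w :* f)) :* x) refl
               (pw (α s) 0ℚ) (1/1+ i) (inner α s j) (fall (suc i) j) ((L d *q (L d ^q j) *q F d (gaps α (s ∸ j))) M))))) ⟩
    Σℚ (suc s) (λ j → (inner α (suc s) (suc j) *ℚ fall i (suc j)) *ℚ ((L d ^q suc j) *q F d (gaps α (s ∸ j))) M) +ℚ head
      ≡⟨ ℚₚ.+-comm _ head ⟩
    head +ℚ Σℚ (suc s) (λ j → (inner α (suc s) (suc j) *ℚ fall i (suc j)) *ℚ ((L d ^q suc j) *q F d (gaps α (s ∸ j))) M)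
      ≡⟨ Σℚ-head (suc s) (λ j → (inner α (suc s) j *ℚ fall i j) *ℚ ((L d ^q j) *q F d (gaps α (suc s ∸ j))) M) ⟨
    Σℚ (suc (suc s)) (λ j → (inner α (suc s) j *ℚ fall i j) *ℚ ((L d ^q j) *q F d (gaps α (suc s ∸ j))) M) ∎
    where
    open ≡-Reasoning
    head = (1ℚ *ℚ 1ℚ) *ℚ (1q *q F d (gaps α (suc s))) M


  -- Every block uses at least one of the `s` variables, so a bound `n ≥ s` exhausts the numbers of
  -- blocks. The first block, of size `j + 1`, is split off, and `K-blocks` reassembles the sum over
  -- `j`.
  ∑-blocks : ∀ α n s a → s ≤ n → ∀ M → Σℚ (suc n) (λ m → blocks α m s a M) ≡ F a (gaps α s) M
  ∑-blocks α n zero a l M = trans (Σℚ-head n (λ m → blocks α m 0 a M)) (trans (cong₂ _+ℚ_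
      (trans (ℚₚ.+-identityʳ _) (trans (ℚₚ.*-identityˡ _) (trans (ℚₚ.+-identityʳ _) (ℚₚ.*-identityˡ (1q M)))))
      (Σℚ-0 n))
    (ℚₚ.+-identityʳ (1q M)))
  ∑-blocks α (suc n) (suc s) a (s≤s l) M = begin
    Σℚ (suc (suc n)) (λ m → blocks α m (suc s) a M)
      ≡⟨ trans (Σℚ-head (suc n) (λ m → blocks α m (suc s) a M)) (ℚₚ.+-identityˡ _) ⟩
    Σℚ (suc n) (λ m → blocks α (suc m) (suc s) a M)
      ≡⟨ Σℚ-cong (suc n) (λ m → blocks-suc α m s a M) ⟩
    Σℚ (suc n) (λ m → Σℚ (suc s) (λ j → Σℚ (B ∸ a) (λ k → T m j (suc (a + k)))))
      ≡⟨ Σℚ-swap (suc n) (suc s) (λ m j → Σℚ (B ∸ a) (λ k → T m j (suc (a + k)))) ⟩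
    Σℚ (suc s) (λ j → Σℚ (suc n) (λ m → Σℚ (B ∸ a) (λ k → T m j (suc (a + k)))))
      ≡⟨ Σℚ-cong (suc s) (λ j → trans (Σℚ-swap (suc n) (B ∸ a) (λ m k → T m j (suc (a + k))))
           (Σℚ-cong (B ∸ a) (λ k → sum-m j (suc (a + k))))) ⟩
    Σℚ (suc s) (λ j → Σℚ (B ∸ a) (λ k → U j (suc (a + k))))
      ≡⟨ Σℚ-swap (suc s) (B ∸ a) (λ j k → U j (suc (a + k))) ⟩
    Σℚ (B ∸ a) (λ k → Σℚ (suc s) (λ j → U j (suc (a + k))))
      ≡⟨ Σℚ-cong (B ∸ a) (λ k → sum-j (suc (a + k))) ⟩
    F a (gaps α (suc s)) M ∎
    where
    open ≡-Reasoning
    T : ℕ → ℕ → ℕ → ℚ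
    T m j d = (1/ suc j ! *ℚ (gap (α s) a d *ℚ inner α s j)) *ℚ ((L d ^q suc j) *q blocks α m (s ∸ j) d) M
    U : ℕ → ℕ → ℚ
    U j d = (1/ suc j ! *ℚ (gap (α s) a d *ℚ inner α s j)) *ℚ ((L d ^q suc j) *q F d (gaps α (s ∸ j))) M
    sum-m : ∀ j d → Σℚ (suc n) (λ m → T m j d) ≡ U j d
    sum-m j d = trans (Σℚ-*ˡ (suc n) (1/ suc j ! *ℚ (gap (α s) a d *ℚ inner α s j)) (λ m → ((L d ^q suc j) *q blocks α m (s ∸ j) d) M))
      (cong ((1/ suc j ! *ℚ (gap (α s) a d *ℚ inner α s j)) *ℚ_)
        (trans (sym (*q-Σʳ (suc n) (L d ^q suc j) (λ m → blocks α m (s ∸ j) d) M))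
          (*q-congˡ {L d ^q suc j} (∑-blocks α n (s ∸ j) d (ℕₚ.≤-trans (ℕₚ.m∸n≤m s j) l)) M)))
    sum-j : ∀ d → Σℚ (suc s) (λ j → U j d) ≡ gap (α s) a d *ℚ (L d *q K d 1 (gaps α s)) M
    sum-j d = begin
      Σℚ (suc s) (λ j → U j d)
        ≡⟨ Σℚ-cong (suc s) (λ j → trans (cong₂ (λ f x → (f *ℚ (gap (α s) a d *ℚ inner α s j)) *ℚ x) (sym (fall-1 j))
                (*q-assoc (L d) (L d ^q j) (F d (gaps α (s ∸ j))) M))
             (trans (solve 4 (λ f g z x → (f :* (g :* z)) :* x := g :* ((z :* f) :* x)) refl (fall 1 j) (gap (α s) a d) (inner α s j) ((L d *q ((L d ^q j) *q F d (gaps α (s ∸ j)))) M))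
               (cong (gap (α s) a d *ℚ_) (sym (*q-·ʳ (inner α s j *ℚ fall 1 j) (L d) ((L d ^q j) *q F d (gaps α (s ∸ j))) M))))) ⟩
      Σℚ (suc s) (λ j → gap (α s) a d *ℚ (L d *q ((inner α s j *ℚ fall 1 j) · ((L d ^q j) *q F d (gaps α (s ∸ j))))) M)
        ≡⟨ Σℚ-*ˡ (suc s) (gap (α s) a d) (λ j → (L d *q ((inner α s j *ℚ fall 1 j) · ((L d ^q j) *q F d (gaps α (s ∸ j))))) M) ⟩
      gap (α s) a d *ℚ Σℚ (suc s) (λ j → (L d *q ((inner α s j *ℚ fall 1 j) · ((L d ^q j) *q F d (gaps α (s ∸ j))))) M)
        ≡⟨ cong (gap (α s) a d *ℚ_) (*q-Σʳ (suc s) (L d) (λ j → (inner α s j *ℚ fall 1 j) · ((L d ^q j) *q F d (gaps α (s ∸ j)))) M) ⟨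
      gap (α s) a d *ℚ (L d *q (λ N → Σℚ (suc s) (λ j → (inner α s j *ℚ fall 1 j) *ℚ ((L d ^q j) *q F d (gaps α (s ∸ j))) N))) M
        ≡⟨ cong (gap (α s) a d *ℚ_) (*q-congˡ {L d} (K-blocks α d 1 s) M) ⟨
      gap (α s) a d *ℚ (L d *q K d 1 (gaps α s)) M ∎

-- `H` cuts the indices off at the exponent `N` itself, so `N` also serves as the order of
-- truncation.
generating-F : ∀ r (v : Vec ℕ (suc r)) N → generating (suc r) v N ≡ Words.F N 0 (Words.gaps N (nth v) (suc r)) N
generating-F r v N = begin
  generating (suc r) v N
    ≡⟨ ∑-applyUpTo suc (suc r) (λ m → ∑ (compositions m (suc r)) (λ is → invFact N is *ℚ H is (lower (suc r) is) v N)) ⟩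
  Σℚ (suc r) (λ m → ∑ (compositions (suc m) (suc r)) (λ is → invFact N is *ℚ H is (lower (suc r) is) v N))
    ≡⟨ Σℚ-cong (suc r) (λ m → ∑-cong (compositions (suc m) (suc r)) (λ is → cong (invFact N is *ℚ_)
         (∑-cong (increasing (suc m) 0 N) (λ ds → cong (_*ℚ ∏L N is ds N) (coefficient is ds))))) ⟩
  Σℚ (suc r) (λ m → blocks N (nth v) (suc m) (suc r) 0 N)
    ≡⟨ trans (Σℚ-head (suc r) (λ m → blocks N (nth v) m (suc r) 0 N)) (ℚₚ.+-identityˡ _) ⟨
  Σℚ (suc (suc r)) (λ m → blocks N (nth v) m (suc r) 0 N)
    ≡⟨ ∑-blocks N (nth v) (suc r) (suc r) 0 ℕₚ.≤-refl N ⟩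
  Words.F N 0 (Words.gaps N (nth v) (suc r)) N ∎
  where
  open ≡-Reasoning
  coefficient : ∀ {m} (is ds : Vec ℕ m) →
    ∏X (zipWith (λ d Y → exp (fromℕ d · Y)) ds (lower (suc r) is)) v ≡ Epart (nth v) (suc r) (slope-from (suc r) 0 is ds)
  coefficient is ds = trans (∏X-exp-lower (suc r) ℕₚ.≤-refl is ds v) (trans (E-Epart (slope (suc r) is ds) v)
    (Epart-cong (nth v) (suc r) (λ t _ → sym (trans (cong (λ x → slope (suc r) is ds t -ℚ x) (ℚₚ.*-zeroˡ (unit (suc r) t)))
      (ℚₚ.+-identityʳ (slope (suc r) is ds t))))))

-- Spans and truncation

module _ {I A : Set} where

  Span : (I → A → ℚ) → (A → ℚ) → Set
  Span b f = ∃[ ts ] f ≗ ∑ₛ {ℚ × I} ts (λ (c , i) → c · b i)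

  span-≗ : ∀ {b f g} → f ≗ g → Span b f → Span b g
  span-≗ e (ts , p) = ts , λ a → trans (sym (e a)) (p a)

  span-basis : ∀ {b} i → Span b (b i)
  span-basis {b} i = (1ℚ , i) ∷ [] , λ a → sym (trans (ℚₚ.+-identityʳ _) (ℚₚ.*-identityˡ (b i a)))

  span-𝟘 : ∀ {b} → Span b 𝟘
  span-𝟘 = [] , λ _ → refl

  span-⊕ : ∀ {b f g} → Span b f → Span b g → Span b (f ⊕ g)
  span-⊕ {b} (ts , p) (us , r) = ts ++ us , λ a → trans (cong₂ _+ℚ_ (p a) (r a)) (sym (∑-++ ts us (λ (c , i) → c *ℚ b i a)))

  span-· : ∀ {b f} c → Span b f → Span b (c · f)
  span-· {b} {f} c (ts , p) = map (λ (x , i) → c *ℚ x , i) ts , λ a → trans (cong (c *ℚ_) (p a)) (sym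
    (trans (∑-map (λ (x , i) → c *ℚ x , i) ts (λ (x , i) → x *ℚ b i a))
      (trans (∑-cong ts (λ (x , i) → ℚₚ.*-assoc c x (b i a))) (∑-*ˡ ts c (λ (x , i) → x *ℚ b i a)))))

  span-⊖ : ∀ {b f g} → Span b f → Span b g → Span b (f ⊖ g)
  span-⊖ {f = f} {g} p r = span-≗ (λ a → solve 2 (λ x y → x :+ con (-ℚ 1ℚ) :* y := x :- y) refl (f a) (g a)) (span-⊕ p (span-· (-ℚ 1ℚ) r))

  span-Σ : ∀ {b} n {f : ℕ → A → ℚ} → (∀ i → Span b (f i)) → Span b (λ a → Σℚ n (λ i → f i a))
  span-Σ zero    p = span-𝟘
  span-Σ (suc n) p = span-⊕ (span-Σ n p) (p n)

-- `T-cong` is a field of its own because series are compared pointwise, and an arbitrary operator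
-- need not respect that.
record Linear {A A′ : Set} (T : (A → ℚ) → (A′ → ℚ)) : Set where
  field
    T-cong : ∀ {f g} → f ≗ g → T f ≗ T g
    T-⊕    : ∀ f g → T (f ⊕ g) ≗ T f ⊕ T g
    T-·    : ∀ c f → T (c · f) ≗ c · T f
  T-𝟘 : T 𝟘 ≗ 𝟘
  T-𝟘 a = trans (T-cong (λ _ → sym (ℚₚ.*-zeroˡ 0ℚ)) a) (trans (T-· 0ℚ 𝟘 a) (ℚₚ.*-zeroˡ (T 𝟘 a)))

module _ {A A′ : Set} {T : (A → ℚ) → (A′ → ℚ)} (lin : Linear T) {I J : Set} {b : I → A → ℚ} {b′ : J → A′ → ℚ} where
  open Linear lin

  span-map : (∀ i → Span b′ (T (b i))) → ∀ {f} → Span b f → Span b′ (T f)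
  span-map p (ts , e) = span-≗ (λ a → sym (T-cong e a)) (go ts)
    where
    go : ∀ ts → Span b′ (T (∑ₛ {ℚ × I} ts (λ (c , i) → c · b i)))
    go []             = span-≗ (λ a → sym (T-𝟘 a)) span-𝟘
    go ((c , i) ∷ ts) = span-≗ (λ a → sym (trans (T-⊕ (c · b i) (∑ₛ ts (λ (c , i) → c · b i)) a)
        (cong (_+ℚ T (∑ₛ ts (λ (c , i) → c · b i)) a) (T-· c (b i) a))))
      (span-⊕ (span-· c (p i)) (go ts))

id-linear : ∀ {A : Set} → Linear {A} {A} id
id-linear = record { T-cong = id ; T-⊕ = λ _ _ _ → refl ; T-· = λ _ _ _ → refl }

*q-linearʳ : ∀ f → Linear (f *q_)
*q-linearʳ f = record { T-cong = λ e → *q-congˡ {f} e ; T-⊕ = *q-distribˡ f ; T-· = λ c g → *q-·ʳ c f g }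

*q-linearˡ : ∀ g → Linear (_*q g)
*q-linearˡ g = record { T-cong = λ e → *q-cong {g = g} e (λ _ → refl) ; T-⊕ = λ f f′ → *q-distribʳ f f′ g ; T-· = λ c f → *q-·ˡ c f g }

∑q : ℕ → (ℕ → ℚ⟦q⟧) → ℚ⟦q⟧
∑q n f M = Σℚ n (λ i → f i M)

∘-linear : ∀ {A A′ A″ : Set} {S : (A′ → ℚ) → (A″ → ℚ)} {T : (A → ℚ) → (A′ → ℚ)} → Linear S → Linear T → Linear (S ∘ T)
∘-linear {S = S} {T} s t = record
  { T-cong = λ e → s.T-cong (t.T-cong e)
  ; T-⊕ = λ f g a → trans (s.T-cong (t.T-⊕ f g) a) (s.T-⊕ (T f) (T g) a)
  ; T-· = λ c f a → trans (s.T-cong (t.T-· c f) a) (s.T-· c (T f) a) }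
  where
  module s = Linear s
  module t = Linear t

∑q-linear : ∀ {A : Set} n {T : ℕ → (A → ℚ) → ℚ⟦q⟧} → (∀ i → Linear (T i)) → Linear (λ x → ∑q n (λ i → T i x))
∑q-linear n {T} l = record
  { T-cong = λ e M → Σℚ-cong n (λ i → Linear.T-cong (l i) e M)
  ; T-⊕ = λ f g M → trans (Σℚ-cong n (λ i → Linear.T-⊕ (l i) f g M)) (Σℚ-+ n (λ i → T i f M) (λ i → T i g M))
  ; T-· = λ c f M → trans (Σℚ-cong n (λ i → Linear.T-· (l i) c f M)) (Σℚ-*ˡ n c (λ i → T i f M)) }

·-linear : ∀ {A : Set} c → Linear {A} (c ·_)
·-linear c = record
  { T-cong = λ e a → cong (c *ℚ_) (e a)
  ; T-⊕ = λ f g a → ℚₚ.*-distribˡ-+ c (f a) (g a)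
  ; T-· = λ c′ f a → solve 3 (λ c c′ x → c :* (c′ :* x) := c′ :* (c :* x)) refl c c′ (f a) }

⊕-linear : ∀ {A A′ : Set} {S T : (A → ℚ) → (A′ → ℚ)} → Linear S → Linear T → Linear (λ f → S f ⊕ T f)
⊕-linear {S = S} {T} s t = record
  { T-cong = λ e a → cong₂ _+ℚ_ (s.T-cong e a) (t.T-cong e a)
  ; T-⊕ = λ f g a → trans (cong₂ _+ℚ_ (s.T-⊕ f g a) (t.T-⊕ f g a))
      (+ℚ-interchange (S f a) (S g a) (T f a) (T g a))
  ; T-· = λ c f a → trans (cong₂ _+ℚ_ (s.T-· c f a) (t.T-· c f a)) (sym (ℚₚ.*-distribˡ-+ c (S f a) (T f a))) }
  where
  module s = Linear s
  module t = Linear t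

restrict-linear : ∀ {A A′ : Set} (h : A′ → A) → Linear (_∘ h)
restrict-linear h = record { T-cong = λ e → e ∘ h ; T-⊕ = λ _ _ _ → refl ; T-· = λ _ _ _ → refl }

linear-Σ : ∀ {A A′ : Set} {T : (A → ℚ) → (A′ → ℚ)} → Linear T → ∀ n (f : ℕ → A → ℚ) a → T (λ b → Σℚ n (λ i → f i b)) a ≡ Σℚ n (λ i → T (f i) a)
linear-Σ l zero    f a = Linear.T-𝟘 l a
linear-Σ {T = T} l (suc n) f a = trans (Linear.T-⊕ l (λ b → Σℚ n (λ i → f i b)) (f n) a) (cong (_+ℚ T (f n) a) (linear-Σ l n f a))

span-bind : ∀ {A I J : Set} {b : I → A → ℚ} {b′ : J → A → ℚ} → (∀ i → Span b′ (b i)) → ∀ {f} → Span b f → Span b′ f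
span-bind = span-map id-linear

span-∘ : ∀ {A A′ I : Set} (h : A′ → A) {b : I → A → ℚ} {f : A → ℚ} → Span b f → Span (λ i → b i ∘ h) (f ∘ h)
span-∘ h (ts , e) = ts , e ∘ h

-- Independence of the truncation order

L-< : ∀ d i → i < d → L d i ≡ 0ℚ
L-< d zero    l = refl
L-< d (suc i) l with d ∣? suc i
... | yes d∣i = contradiction (∣⇒≤ d∣i) (ℕₚ.<⇒≱ l)
... | no  _   = refl

L-0 : L 0 ≗ 𝟘
L-0 zero    = refl
L-0 (suc i) with 0 ∣? suc i
... | yes (divides k e) = contradiction (trans e (ℕₚ.*-zeroʳ k)) (λ ())
... | no  _   = refl

*q-vanish : ∀ d f g M → (∀ i → i < d → f i ≡ 0ℚ) → M < d → (f *q g) M ≡ 0ℚ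
*q-vanish d f g M e l = trans (*q-cong≤ {g = g} M (λ i i≤M → e i (ℕₚ.≤-<-trans i≤M l)) (λ _ _ → refl)) (*q-zeroˡ g M)

∑>-≈ : ∀ B C a {f g : ℕ → ℚ⟦q⟧} M → M ≤ C → C ≤ B → (∀ d → f d M ≡ g d M) → (∀ d → M < d → g d M ≡ 0ℚ) →
       Words.∑> B a f M ≡ Words.∑> C a g M
∑>-≈ B C a {f} {g} M M≤C C≤B e v = trans (Σℚ-cong (B ∸ a) (λ k → e (suc (a + k))))
  (Σℚ-extend (C ∸ a) (B ∸ a) (λ k → g (suc (a + k)) M) (ℕₚ.∸-monoˡ-≤ a C≤B)
    (λ k l → v (suc (a + k)) (s≤s (ℕₚ.≤-trans M≤C (ℕₚ.≤-trans (ℕₚ.m≤n+m∸n C a) (ℕₚ.+-monoʳ-≤ a l))))))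

-- Each index d brings a factor `L d`, which is divisible by q^d; indices above `M` cannot reach the
-- coefficient of q^M.
K-bound : ∀ B C d i w M → M ≤ C → C ≤ B → Words.K B d i w M ≡ Words.K C d i w M
K-bound B C d i []      M M≤C C≤B = refl
K-bound B C d i (x ∷ w) M M≤C C≤B = cong₂ _+ℚ_
  (cong ((x d d *ℚ (1/1+ i)) *ℚ_) (rest d (suc i)))
  (∑>-≈ B C d {λ d′ → x d d′ · (L d′ *q Words.K B d′ 1 w)} {λ d′ → x d d′ · (L d′ *q Words.K C d′ 1 w)} M M≤C C≤B (λ d′ → cong (x d d′ *ℚ_) (rest d′ 1))
    (λ d′ l → trans (cong (x d d′ *ℚ_) (*q-vanish d′ (L d′) (Words.K C d′ 1 w) M (L-< d′) l)) (ℚₚ.*-zeroʳ (x d d′))))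
  where
  rest : ∀ d i → (L d *q Words.K B d i w) M ≡ (L d *q Words.K C d i w) M
  rest d i = *q-cong≤ {L d} M (λ _ _ → refl) (λ j l → K-bound B C d i w j (ℕₚ.≤-trans l M≤C) C≤B)

-- `L 0` vanishes, so no index can join the starting value 0.
K≗F : ∀ B w → Words.K B 0 0 w ≗ Words.F B 0 w
K≗F B []      M = refl
K≗F B (x ∷ w) M = trans (cong (_+ℚ Words.F B 0 (x ∷ w) M) (trans (cong ((x 0 0 *ℚ (1/1+ 0)) *ℚ_)
    (trans (*q-cong {g = Words.K B 0 1 w} L-0 (λ _ → refl) M) (*q-zeroˡ (Words.K B 0 1 w) M)))
  (ℚₚ.*-zeroʳ (x 0 0 *ℚ (1/1+ 0))))) (ℚₚ.+-identityˡ _)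

-- Words list the exponents of X_r, …, X₁, that is, the indices in reverse order.
wordOf : List ℕ → List ℕ
wordOf l = reverse (map pred l)

nth-reverse : ∀ l → applyDownFrom (nth (Vec.map pred (fromList l))) (length l) ≡ wordOf l
nth-reverse l = trans (sym (Listₚ.reverse-applyUpTo (nth (Vec.map pred (fromList l))) (length l))) (cong reverse (go l))
  where
  go : ∀ l → applyUpTo (nth (Vec.map pred (fromList l))) (length l) ≡ map pred l
  go []      = refl
  go (k ∷ l) = cong (pred k ∷_) (go l)

-- The family, indexed by the truncation order B, of the sums over gap words.
gapK : List ℕ → ℕ → ℚ⟦q⟧
gapK w B = Words.K B 0 0 (map gap w)

gsh≡K : ∀ l B i → i ≤ B → gsh l i ≡ gapK (wordOf l) B i
gsh≡K []        B i l = refl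
gsh≡K ks@(k ∷ l) B i i≤B = trans (generating-F (length l) (Vec.map pred (fromList ks)) i)
  (trans (cong (λ w → Words.F i 0 (map gap w) i) (nth-reverse ks))
    (trans (sym (K≗F i (map gap (wordOf ks)) i)) (sym (K-bound B i 0 0 (map gap (wordOf ks)) i ℕₚ.≤-refl i≤B))))

Point : Set
Point = ∃[ B ] ∃[ i ] i ≤ B

⌊_⌋ : (ℕ → ℚ⟦q⟧) → Point → ℚ
⌊ f ⌋ (B , i , _) = f B i

gapBasis : List ℕ → Point → ℚ
gapBasis w = ⌊ gapK w ⌋

InV : (ℕ → ℚ⟦q⟧) → Set
InV f = Span gapBasis ⌊ f ⌋

InV⇒IsCombination : ∀ {f} → InV (λ _ → f) → IsCombination f
InV⇒IsCombination {f} (ts , e) = map (λ (c , w) → c , indices w) ts , map⁺ (all-valid ts) , λ N →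
  -- The diagonal points already determine the series. `indices` undoes the reversal and the shift
  -- by one, so all entries are at least 1.
  trans (e (N , N , ℕₚ.≤-refl)) (sym (trans (∑-map (λ (c , w) → c , indices w) ts (λ (c , l) → c *ℚ gsh l N))
    (∑-cong ts (λ (c , w) → cong (c *ℚ_) (trans (gsh≡K (indices w) N N ℕₚ.≤-refl) (cong (λ w → gapK w N N) (wordOf-indices w)))))))
  where
  indices : List ℕ → List ℕ
  indices w = map suc (reverse w)
  wordOf-indices : ∀ w → wordOf (indices w) ≡ w
  wordOf-indices w = trans (cong reverse (trans (sym (Listₚ.map-∘ (reverse w))) (Listₚ.map-id (reverse w)))) (Listₚ.reverse-involutive w)
  valid : ∀ v → All (1 ≤_) (map suc v)
  valid []      = []
  valid (k ∷ v) = s≤s z≤n ∷ valid v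
  all-valid : ∀ ts → All (λ t → All (1 ≤_) (indices (proj₂ t))) ts
  all-valid []             = []
  all-valid ((c , w) ∷ ts) = valid (reverse w) ∷ all-valid ts

-- Gaps and absolute indices

abs : ℕ → Letter
abs m d′ d = pw m (fromℕ d)

-- `κ` is the binomial coefficient of `i + j` over `i`; what matters is that it does not depend on
-- `c`.
pw-* : ∀ i j → ∃[ κ ] (∀ c → pw i c *ℚ pw j c ≡ κ *ℚ pw (i + j) c)
pw-* zero    j = 1ℚ , λ c → refl
pw-* (suc i) j with κ , e ← pw-* i j = (1/1+ i) *ℚ κ *ℚ fromℕ (suc (i + j)) , λ c →
  trans (solve 4 (λ r c p q → r :* (c :* p) :* q := r :* (c :* (p :* q))) refl (1/1+ i) c (pw i c) (pw j c))
  (trans (cong (λ t → (1/1+ i) *ℚ (c *ℚ t)) (e c))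
  (trans (solve 4 (λ r c k p → r :* (c :* (k :* p)) := r :* k :* (c :* p)) refl (1/1+ i) c κ (pw (i + j) c))
  (trans (cong ((1/1+ i) *ℚ κ *ℚ_) (*ℚ-pw (i + j) c))
    (sym (ℚₚ.*-assoc ((1/1+ i) *ℚ κ) (fromℕ (suc (i + j))) (pw (suc (i + j)) c))))))

pw-neg : ∀ i → ∃[ κ ] (∀ c → pw i (-ℚ c) ≡ κ *ℚ pw i c)
pw-neg zero    = 1ℚ , λ c → refl
pw-neg (suc i) with κ , e ← pw-neg i = -ℚ κ , λ c → trans (cong (λ t → (1/1+ i) *ℚ ((-ℚ c) *ℚ t)) (e c))
  (solve 4 (λ r c k p → r :* ((:- c) :* (k :* p)) := (:- k) :* (r :* (c :* p))) refl (1/1+ i) c κ (pw i c))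

-- The arguments (B, d, i, M) of Words.K B d i w M.
State : Set
State = ℕ × ℕ × ℕ × ℕ

Kₛ : List Letter → State → ℚ
Kₛ w (B , d , i , M) = Words.K B d i w M

-- One step of `K` as an operator on the tail. It consults the tail at other indices and block
-- sizes, so spans of tails have to be taken over all states at once.
prepend : Letter → (State → ℚ) → (State → ℚ)
prepend x k (B , d , i , M) = (x d d *ℚ (1/1+ i)) *ℚ (L d *q (λ N → k (B , d , suc i , N))) M
  +ℚ Words.∑> B d (λ d′ → x d d′ · (L d′ *q (λ N → k (B , d′ , 1 , N)))) M

prepend-linear : ∀ x → Linear (prepend x)
prepend-linear x = record
  { T-cong = λ e (B , d , i , M) → Linear.T-cong (at B d i) e M
  ; T-⊕ = λ f g (B , d , i , M) → Linear.T-⊕ (at B d i) f g M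
  ; T-· = λ c f (B , d , i , M) → Linear.T-· (at B d i) c f M }
  where
  term : ∀ c d (h : ℕ → State) → Linear (λ k → c · (L d *q (k ∘ h)))
  term c d h = ∘-linear (·-linear c) (∘-linear (*q-linearʳ (L d)) (restrict-linear h))
  at : ∀ B d i → Linear (λ k M → prepend x k (B , d , i , M))
  at B d i = ⊕-linear (term (x d d *ℚ (1/1+ i)) d (λ N → B , d , suc i , N))
    (∑q-linear (B ∸ d) (λ l → term (x d (suc (d + l))) (suc (d + l)) (λ N → B , suc (d + l) , 1 , N)))

prepend-letter : ∀ n (c : ℕ → ℕ → ℚ) (y : ℕ → Letter) (x : Letter) → (∀ d′ d → x d′ d ≡ Σℚ n (λ j → c j d′ *ℚ y j d′ d)) →
  ∀ k B d i M → prepend x k (B , d , i , M) ≡ Σℚ n (λ j → c j d *ℚ prepend (y j) k (B , d , i , M))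
prepend-letter n c y x e k B d i M = begin
  (x d d *ℚ (1/1+ i)) *ℚ P +ℚ Σℚ (B ∸ d) (λ l → x d (suc (d + l)) *ℚ Q l)
    ≡⟨ cong₂ _+ℚ_
         (trans (cong (λ t → (t *ℚ (1/1+ i)) *ℚ P) (e d d))
           (trans (ℚₚ.*-assoc (Σℚ n (λ j → c j d *ℚ y j d d)) (1/1+ i) P)
           (trans (sym (Σℚ-*ʳ n ((1/1+ i) *ℚ P) (λ j → c j d *ℚ y j d d)))
             (Σℚ-cong n (λ j → solve 4 (λ c y r p → (c :* y) :* (r :* p) := c :* ((y :* r) :* p)) refl (c j d) (y j d d) (1/1+ i) P)))))
         (trans (Σℚ-cong (B ∸ d) (λ l → trans (cong (_*ℚ Q l) (e d (suc (d + l))))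
             (trans (sym (Σℚ-*ʳ n (Q l) (λ j → c j d *ℚ y j d (suc (d + l)))))
               (Σℚ-cong n (λ j → ℚₚ.*-assoc (c j d) (y j d (suc (d + l))) (Q l))))))
           (trans (Σℚ-swap (B ∸ d) n (λ l j → c j d *ℚ (y j d (suc (d + l)) *ℚ Q l)))
             (Σℚ-cong n (λ j → Σℚ-*ˡ (B ∸ d) (c j d) (λ l → y j d (suc (d + l)) *ℚ Q l))))) ⟩
  Σℚ n (λ j → c j d *ℚ ((y j d d *ℚ (1/1+ i)) *ℚ P)) +ℚ Σℚ n (λ j → c j d *ℚ Σℚ (B ∸ d) (λ l → y j d (suc (d + l)) *ℚ Q l))
    ≡⟨ Σℚ-+ n (λ j → c j d *ℚ ((y j d d *ℚ (1/1+ i)) *ℚ P)) (λ j → c j d *ℚ Σℚ (B ∸ d) (λ l → y j d (suc (d + l)) *ℚ Q l)) ⟨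
  Σℚ n (λ j → c j d *ℚ ((y j d d *ℚ (1/1+ i)) *ℚ P) +ℚ c j d *ℚ Σℚ (B ∸ d) (λ l → y j d (suc (d + l)) *ℚ Q l))
    ≡⟨ Σℚ-cong n (λ j → ℚₚ.*-distribˡ-+ (c j d) ((y j d d *ℚ (1/1+ i)) *ℚ P) (Σℚ (B ∸ d) (λ l → y j d (suc (d + l)) *ℚ Q l))) ⟨
  Σℚ n (λ j → c j d *ℚ prepend (y j) k (B , d , i , M)) ∎
  where
  open ≡-Reasoning
  P = (L d *q (λ N → k (B , d , suc i , N))) M
  Q : ℕ → ℚ
  Q l = (L (suc (d + l)) *q (λ N → k (B , suc (d + l) , 1 , N))) M

prepend-weight : ∀ (p : ℕ → ℚ) x k B d i M →
  prepend x (λ (B , d , i , M) → p d *ℚ k (B , d , i , M)) (B , d , i , M) ≡ prepend (λ d′ d → x d′ d *ℚ p d) k (B , d , i , M)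
prepend-weight p x k B d i M = cong₂ _+ℚ_ (trans (cong ((x d d *ℚ (1/1+ i)) *ℚ_) (*q-·ʳ (p d) (L d) (λ N → k (B , d , suc i , N)) M))
    (solve 4 (λ x r p y → (x :* r) :* (p :* y) := ((x :* p) :* r) :* y) refl (x d d) (1/1+ i) (p d) ((L d *q (λ N → k (B , d , suc i , N))) M)))
  (Σℚ-cong (B ∸ d) (λ l → trans (cong (x d (suc (d + l)) *ℚ_) (*q-·ʳ (p (suc (d + l))) (L (suc (d + l))) (λ N → k (B , suc (d + l) , 1 , N)) M))
    (sym (ℚₚ.*-assoc (x d (suc (d + l))) (p (suc (d + l))) _))))

-- x m d′ d times a polynomial in d is a combination of y's whose coefficients are
-- polynomials in d′, which are absorbed by the preceding letter.
Expansion : (x y : ℕ → Letter) → Set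
Expansion x y = ∀ m e → Σ (ℕ → ℚ) (λ κ → ∀ d′ d →
  x m d′ d *ℚ pw e (fromℕ d) ≡ Σℚ (suc (m + e)) (λ j → (κ j *ℚ pw j (fromℕ d′)) *ℚ y (m + e ∸ j) d′ d))

module Exchange (x y : ℕ → Letter) (expand : Expansion x y) where

  -- The power of `d` is what the expansion of the tail has pushed to the left so far; the next
  -- letter absorbs it.
  weighted : ℕ × List ℕ → State → ℚ
  weighted (e , w) (B , d , i , M) = pw e (fromℕ d) *ℚ Kₛ (map y w) (B , d , i , M)

  exchange : ∀ w → Span weighted (Kₛ (map x w))
  exchange []      = span-≗ (λ s → ℚₚ.*-identityˡ _) (span-basis (0 , []))
  exchange (m ∷ w) = span-map (prepend-linear (x m)) step (exchange w)
    where
    step : ∀ ew → Span weighted (prepend (x m) (weighted ew))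
    step (e , w) with κ , eq ← expand m e = span-≗
      (λ (B , d , i , M) → trans (Σℚ-cong (suc (m + e)) (λ j → sym (ℚₚ.*-assoc (κ j) (pw j (fromℕ d)) (prepend (y (m + e ∸ j)) (Kₛ (map y w)) (B , d , i , M)))))
        (trans (sym (prepend-letter (suc (m + e)) (λ j d′ → κ j *ℚ pw j (fromℕ d′)) (λ j → y (m + e ∸ j)) (λ d′ d → x m d′ d *ℚ pw e (fromℕ d)) eq (Kₛ (map y w)) B d i M))
          (sym (prepend-weight (λ d → pw e (fromℕ d)) (x m) (Kₛ (map y w)) B d i M))))
      (span-Σ (suc (m + e)) (λ j → span-· (κ j) (span-basis (j , m + e ∸ j ∷ w))))

  -- Nothing precedes the first letter: at the start `d = 0` the remaining power is a constant and
  -- joins the coefficients.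
  exchange₀ : ∀ w → Span (λ w → ⌊ (λ B → Words.K B 0 0 (map y w)) ⌋) ⌊ (λ B → Words.K B 0 0 (map x w)) ⌋
  exchange₀ w = span-bind (λ (e , w) → span-· (pw e (fromℕ 0)) (span-basis w)) (span-∘ (λ (B , i , _) → B , 0 , 0 , i) (exchange w))

absBasis : List ℕ → Point → ℚ
absBasis w = ⌊ (λ B → Words.K B 0 0 (map abs w)) ⌋

abs-in-gaps : ∀ w → Span gapBasis (absBasis w)
abs-in-gaps = Exchange.exchange₀ abs gap λ m e → let κ , eq = pw-* m e in (λ _ → κ) , λ d′ d →
  trans (eq (fromℕ d)) (trans (cong (λ t → κ *ℚ pw (m + e) t) (sym (solve 2 (λ a b → a :+ (b :- a) := b) refl (fromℕ d′) (fromℕ d))))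
    (trans (cong (κ *ℚ_) (pw-+ (m + e) (fromℕ d′) (fromℕ d -ℚ fromℕ d′)))
      (trans (sym (Σℚ-*ˡ (suc (m + e)) κ (λ j → pw j (fromℕ d′) *ℚ gap (m + e ∸ j) d′ d)))
        (Σℚ-cong (suc (m + e)) (λ j → sym (ℚₚ.*-assoc κ (pw j (fromℕ d′)) (gap (m + e ∸ j) d′ d)))))))

gaps-in-abs : ∀ w → Span absBasis (gapBasis w)
gaps-in-abs = Exchange.exchange₀ gap abs expand
  where
  expand : Expansion gap abs
  expand m e = κ , λ d′ d → begin
    pw m (fromℕ d -ℚ fromℕ d′) *ℚ pw e (fromℕ d)
      ≡⟨ cong (λ t → pw m t *ℚ pw e (fromℕ d)) (ℚₚ.+-comm (fromℕ d) (-ℚ fromℕ d′)) ⟩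
    pw m ((-ℚ fromℕ d′) +ℚ fromℕ d) *ℚ pw e (fromℕ d)
      ≡⟨ cong (_*ℚ pw e (fromℕ d)) (pw-+ m (-ℚ fromℕ d′) (fromℕ d)) ⟩
    Σℚ (suc m) (λ j → pw j (-ℚ fromℕ d′) *ℚ pw (m ∸ j) (fromℕ d)) *ℚ pw e (fromℕ d)
      ≡⟨ Σℚ-*ʳ (suc m) (pw e (fromℕ d)) (λ j → pw j (-ℚ fromℕ d′) *ℚ pw (m ∸ j) (fromℕ d)) ⟨
    Σℚ (suc m) (λ j → pw j (-ℚ fromℕ d′) *ℚ pw (m ∸ j) (fromℕ d) *ℚ pw e (fromℕ d))
      ≡⟨ Σℚ-cong< (suc m) (λ { j (s≤s j≤m) → term j j≤m d′ d }) ⟩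
    Σℚ (suc m) (summand d′ d)
      ≡⟨ Σℚ-extend (suc m) (suc (m + e)) (summand d′ d) (s≤s (ℕₚ.m≤m+n m e)) (λ j l → trans (cong (λ t → (t *ℚ pw j (fromℕ d′)) *ℚ abs (m + e ∸ j) d′ d) (κ-> j l))
           (trans (cong (_*ℚ abs (m + e ∸ j) d′ d) (ℚₚ.*-zeroˡ (pw j (fromℕ d′)))) (ℚₚ.*-zeroˡ (abs (m + e ∸ j) d′ d)))) ⟨
    Σℚ (suc (m + e)) (summand d′ d) ∎
    where
    open ≡-Reasoning
    κ : ℕ → ℚ
    -- The binomial theorem stops at `j = m`; zeros pad the sum to the length that `Expansion`
    -- prescribes.
    κ j = if j ≤ᵇ m then proj₁ (pw-neg j) *ℚ proj₁ (pw-* (m ∸ j) e) else 0ℚ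
    κ-≤ : ∀ j → j ≤ m → κ j ≡ proj₁ (pw-neg j) *ℚ proj₁ (pw-* (m ∸ j) e)
    κ-≤ j l with j ≤ᵇ m | ℕₚ.≤⇒≤ᵇ l
    ... | true | _ = refl
    κ-> : ∀ j → m < j → κ j ≡ 0ℚ
    κ-> j l with j ≤ᵇ m in eq
    ... | false = refl
    ... | true with () ← ℕₚ.<⇒≱ l (ℕₚ.≤ᵇ⇒≤ j m (subst Bool.T (sym eq) _))
    summand : ℕ → ℕ → ℕ → ℚ
    summand d′ d j = (κ j *ℚ pw j (fromℕ d′)) *ℚ abs (m + e ∸ j) d′ d
    term : ∀ j → j ≤ m → ∀ d′ d → pw j (-ℚ fromℕ d′) *ℚ pw (m ∸ j) (fromℕ d) *ℚ pw e (fromℕ d) ≡ summand d′ d j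
    term j l d′ d = trans (cong (λ t → t *ℚ pw (m ∸ j) (fromℕ d) *ℚ pw e (fromℕ d)) (proj₂ (pw-neg j) (fromℕ d′)))
      (trans (ℚₚ.*-assoc (proj₁ (pw-neg j) *ℚ pw j (fromℕ d′)) (pw (m ∸ j) (fromℕ d)) (pw e (fromℕ d)))
      (trans (cong ((proj₁ (pw-neg j) *ℚ pw j (fromℕ d′)) *ℚ_) (proj₂ (pw-* (m ∸ j) e) (fromℕ d)))
      (trans (solve 4 (λ n p k q → (n :* p) :* (k :* q) := ((n :* k) :* p) :* q) refl (proj₁ (pw-neg j)) (pw j (fromℕ d′)) (proj₁ (pw-* (m ∸ j) e)) (pw (m ∸ j + e) (fromℕ d)))
        (cong₂ (λ k r → (k *ℚ pw j (fromℕ d′)) *ℚ pw r (fromℕ d)) (sym (κ-≤ j l)) (sym (ℕₚ.+-∸-comm e l))))))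

-- The shuffle product

module _ {A : Set} where

  -- A functional in place of a list of words: `φ` summed over all shuffles, where the letters
  -- already placed are stored in `φ`. `split` treats deconcatenations in the same way.
  sh : (List A → ℚ) → List A → List A → ℚ
  sh φ []      v       = φ v
  sh φ (x ∷ u) []      = φ (x ∷ u)
  sh φ (x ∷ u) (y ∷ v) = sh (φ ∘ (x ∷_)) u (y ∷ v) +ℚ sh (φ ∘ (y ∷_)) (x ∷ u) v

  split : (List A → List A → ℚ) → List A → ℚ
  split k []      = k [] []
  split k (x ∷ w) = k [] (x ∷ w) +ℚ split (λ u → k (x ∷ u)) w

  sh-cong : ∀ {φ ψ} → φ ≗ ψ → ∀ u v → sh φ u v ≡ sh ψ u v
  sh-cong e []      v       = e v
  sh-cong e (x ∷ u) []      = e (x ∷ u)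
  sh-cong e (x ∷ u) (y ∷ v) = cong₂ _+ℚ_ (sh-cong (e ∘ (x ∷_)) u (y ∷ v)) (sh-cong (e ∘ (y ∷_)) (x ∷ u) v)

  sh-[] : ∀ φ u → sh φ u [] ≡ φ u
  sh-[] φ []      = refl
  sh-[] φ (x ∷ u) = refl

  sh-⊕ : ∀ φ ψ u v → sh (φ ⊕ ψ) u v ≡ sh φ u v +ℚ sh ψ u v
  sh-⊕ φ ψ []      v       = refl
  sh-⊕ φ ψ (x ∷ u) []      = refl
  sh-⊕ φ ψ (x ∷ u) (y ∷ v) = trans
    (cong₂ _+ℚ_ (sh-⊕ (φ ∘ (x ∷_)) (ψ ∘ (x ∷_)) u (y ∷ v)) (sh-⊕ (φ ∘ (y ∷_)) (ψ ∘ (y ∷_)) (x ∷ u) v))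
    (+ℚ-interchange
      (sh (φ ∘ (x ∷_)) u (y ∷ v)) (sh (ψ ∘ (x ∷_)) u (y ∷ v)) (sh (φ ∘ (y ∷_)) (x ∷ u) v) (sh (ψ ∘ (y ∷_)) (x ∷ u) v))

  split-cong : ∀ {k k′} → (∀ u v → k u v ≡ k′ u v) → ∀ w → split k w ≡ split k′ w
  split-cong e []      = e [] []
  split-cong e (x ∷ w) = cong₂ _+ℚ_ (e [] (x ∷ w)) (split-cong (λ u → e (x ∷ u)) w)

  split-⊕ : ∀ k k′ w → split (λ u v → k u v +ℚ k′ u v) w ≡ split k w +ℚ split k′ w
  split-⊕ k k′ []      = refl
  split-⊕ k k′ (x ∷ w) = trans (cong ((k [] (x ∷ w) +ℚ k′ [] (x ∷ w)) +ℚ_) (split-⊕ (λ u → k (x ∷ u)) (λ u → k′ (x ∷ u)) w))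
    (+ℚ-interchange
      (k [] (x ∷ w)) (k′ [] (x ∷ w)) (split (λ u → k (x ∷ u)) w) (split (λ u → k′ (x ∷ u)) w))

  -- Deconcatenation is a homomorphism for the shuffle product.
  sh-split : ∀ k u v → sh (split k) u v ≡
    split (λ u₁ u₂ → split (λ v₁ v₂ → sh (λ a → sh (k a) u₂ v₂) u₁ v₁) v) u
  sh-split k []      v       = refl
  sh-split k (x ∷ u) []      = sym (split-cong {k′ = k} (λ u₁ u₂ → trans (sh-[] (λ a → sh (k a) u₂ []) u₁) (sh-[] (k u₁) u₂)) (x ∷ u))
  sh-split k (x ∷ u) (y ∷ v) = begin
    sh (λ w → split k (x ∷ w)) u (y ∷ v) +ℚ sh (λ w → split k (y ∷ w)) (x ∷ u) v
      ≡⟨ cong₂ _+ℚ_ (sh-⊕ (λ w → k [] (x ∷ w)) (split kx) u (y ∷ v)) (sh-⊕ (λ w → k [] (y ∷ w)) (split ky) (x ∷ u) v) ⟩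
    (a +ℚ sh (split kx) u (y ∷ v)) +ℚ (b +ℚ sh (split ky) (x ∷ u) v)
      ≡⟨ cong₂ (λ s t → (a +ℚ s) +ℚ (b +ℚ t)) (trans (sh-split kx u (y ∷ v)) (split-⊕ P Q u)) (sh-split ky (x ∷ u) v) ⟩
    (a +ℚ (split P u +ℚ split Q u)) +ℚ (b +ℚ (c +ℚ split R u))
      ≡⟨ solve 6 (λ a p q b c r → (a :+ (p :+ q)) :+ (b :+ (c :+ r)) := ((a :+ b) :+ c) :+ (p :+ (q :+ r))) refl
           a (split P u) (split Q u) b c (split R u) ⟩
    ((a +ℚ b) +ℚ c) +ℚ (split P u +ℚ (split Q u +ℚ split R u))
      ≡⟨ cong (((a +ℚ b) +ℚ c) +ℚ_) (trans (split-cong (λ u₁ u₂ → cong (sh (kx u₁) u₂ (y ∷ v) +ℚ_)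
             (split-⊕ (λ v₁ v₂ → sh (λ a → sh (kx a) u₂ v₂) u₁ (y ∷ v₁)) (λ v₁ v₂ → sh (λ a → sh (ky a) u₂ v₂) (x ∷ u₁) v₁) v)) u)
           (trans (split-⊕ (λ u₁ u₂ → sh (kx u₁) u₂ (y ∷ v)) (λ u₁ u₂ → Q u₁ u₂ +ℚ R u₁ u₂) u)
             (cong₂ _+ℚ_ (split-cong (λ u₁ u₂ → sym (sh-[] (λ a → sh (kx a) u₂ (y ∷ v)) u₁)) u) (split-⊕ Q R u)))) ⟨
    split (λ u₁ u₂ → split (λ v₁ v₂ → sh (λ a → sh (k a) u₂ v₂) u₁ v₁) (y ∷ v)) (x ∷ u) ∎
    where
    open ≡-Reasoning
    kx ky : List A → List A → ℚ
    kx u = k (x ∷ u)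
    ky v = k (y ∷ v)
    a = sh (λ w → k [] (x ∷ w)) u (y ∷ v)
    b = sh (λ w → k [] (y ∷ w)) (x ∷ u) v
    c = split (λ v₁ v₂ → sh (ky v₁) (x ∷ u) v₂) v
    P Q R : List A → List A → ℚ
    P u₁ u₂ = sh (λ a → sh (kx a) u₂ (y ∷ v)) u₁ []
    Q u₁ u₂ = split (λ v₁ v₂ → sh (λ a → sh (kx a) u₂ v₂) u₁ (y ∷ v₁)) v
    R u₁ u₂ = split (λ v₁ v₂ → sh (λ a → sh (ky a) u₂ v₂) (x ∷ u₁) v₁) v

  sh-*q : ∀ f (g : List A → ℚ⟦q⟧) u v M → sh (λ w → (f *q g w) M) u v ≡ (f *q (λ N → sh (λ w → g w N) u v)) M
  sh-*q f g []      v       M = refl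
  sh-*q f g (x ∷ u) []      M = refl
  sh-*q f g (x ∷ u) (y ∷ v) M = trans (cong₂ _+ℚ_ (sh-*q f (g ∘ (x ∷_)) u (y ∷ v) M) (sh-*q f (g ∘ (y ∷_)) (x ∷ u) v M))
    (sym (*q-distribˡ f (λ N → sh (λ w → g (x ∷ w) N) u (y ∷ v)) (λ N → sh (λ w → g (y ∷ w) N) (x ∷ u) v) M))

  sh-*qˡ : ∀ f (g : List A → ℚ⟦q⟧) u v M → sh (λ w → (g w *q f) M) u v ≡ ((λ N → sh (λ w → g w N) u v) *q f) M
  sh-*qˡ f g u v M = trans (sh-cong (λ w → *q-comm (g w) f M) u v) (trans (sh-*q f g u v M) (*q-comm f (λ N → sh (λ w → g w N) u v) M))

  split-*q : ∀ (k : List A → List A → ℚ⟦q⟧) g w M → ((λ N → split (λ u v → k u v N) w) *q g) M ≡ split (λ u v → (k u v *q g) M) w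
  split-*q k g []      M = refl
  split-*q k g (x ∷ w) M = trans (*q-distribʳ (k [] (x ∷ w)) (λ N → split (λ u v → k (x ∷ u) v N) w) g M)
    (cong ((k [] (x ∷ w) *q g) M +ℚ_) (split-*q (λ u → k (x ∷ u)) g w M))

  split-*qʳ : ∀ (k : List A → List A → ℚ⟦q⟧) g w M → (g *q (λ N → split (λ u v → k u v N) w)) M ≡ split (λ u v → (g *q k u v) M) w
  split-*qʳ k g w M = trans (*q-comm g (λ N → split (λ u v → k u v N) w) M) (trans (split-*q k g w M) (split-cong (λ u v → *q-comm (k u v) g M) w))

  sh-vanish : ∀ φ → (∀ w → φ w ≡ 0ℚ) → ∀ u v → sh φ u v ≡ 0ℚ
  sh-vanish φ e []      v       = e v
  sh-vanish φ e (x ∷ u) []      = e (x ∷ u)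
  sh-vanish φ e (x ∷ u) (y ∷ v) = cong₂ _+ℚ_ (sh-vanish (φ ∘ (x ∷_)) (e ∘ (x ∷_)) u (y ∷ v)) (sh-vanish (φ ∘ (y ∷_)) (e ∘ (y ∷_)) (x ∷ u) v)

  span-sh : ∀ {I P : Set} {b : I → P → ℚ} {φ : List A → P → ℚ} → (∀ w → Span b (φ w)) → ∀ u v → Span b (λ p → sh (λ w → φ w p) u v)
  span-sh s []      v       = s v
  span-sh s (x ∷ u) []      = s (x ∷ u)
  span-sh s (x ∷ u) (y ∷ v) = span-⊕ (span-sh (s ∘ (x ∷_)) u (y ∷ v)) (span-sh (s ∘ (y ∷_)) (x ∷ u) v)

-- The number of shuffles of words of lengths p and q: Pascal's rule, with the recursion of `sh`.
shuffles : ℕ → ℕ → ℚ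
shuffles zero    q       = 1ℚ
shuffles (suc p) zero    = 1ℚ
shuffles (suc p) (suc q) = shuffles p (suc q) +ℚ shuffles (suc p) q

shuffles-! : ∀ p q → shuffles p q *ℚ 1/ (p + q) ! ≡ 1/ p ! *ℚ 1/ q !
shuffles-! zero    q       = refl
shuffles-! (suc p) zero    = trans (ℚₚ.*-identityˡ _) (trans (cong 1/_! (ℕₚ.+-identityʳ (suc p))) (sym (ℚₚ.*-identityʳ _)))
shuffles-! (suc p) (suc q) = begin
  (shuffles p (suc q) +ℚ shuffles (suc p) q) *ℚ 1/ suc (p + suc q) !
    ≡⟨ cong ((shuffles p (suc q) +ℚ shuffles (suc p) q) *ℚ_) (1/suc! (p + suc q)) ⟩
  (shuffles p (suc q) +ℚ shuffles (suc p) q) *ℚ (r *ℚ 1/ (p + suc q) !)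
    ≡⟨ solve 4 (λ a b r f → (a :+ b) :* (r :* f) := r :* (a :* f :+ b :* f)) refl (shuffles p (suc q)) (shuffles (suc p) q) r (1/ (p + suc q) !) ⟩
  r *ℚ (shuffles p (suc q) *ℚ 1/ (p + suc q) ! +ℚ shuffles (suc p) q *ℚ 1/ (p + suc q) !)
    ≡⟨ cong (r *ℚ_) (cong₂ _+ℚ_ (shuffles-! p (suc q)) (trans (cong (λ n → shuffles (suc p) q *ℚ 1/ n !) (ℕₚ.+-suc p q)) (shuffles-! (suc p) q))) ⟩
  r *ℚ (1/ p ! *ℚ 1/ suc q ! +ℚ 1/ suc p ! *ℚ 1/ q !)
    ≡⟨ cong (r *ℚ_) (cong₂ (λ s t → s *ℚ 1/ suc q ! +ℚ 1/ suc p ! *ℚ t) (unfold p) (unfold q)) ⟩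
  r *ℚ ((fromℕ (suc p) *ℚ 1/ suc p !) *ℚ 1/ suc q ! +ℚ 1/ suc p ! *ℚ (fromℕ (suc q) *ℚ 1/ suc q !))
    ≡⟨ solve 5 (λ r a x b y → r :* ((a :* x) :* y :+ x :* (b :* y)) := r :* ((a :+ b) :* (x :* y))) refl
         r (fromℕ (suc p)) (1/ suc p !) (fromℕ (suc q)) (1/ suc q !) ⟩
  r *ℚ ((fromℕ (suc p) +ℚ fromℕ (suc q)) *ℚ (1/ suc p ! *ℚ 1/ suc q !))
    ≡⟨ cong (λ t → r *ℚ (t *ℚ (1/ suc p ! *ℚ 1/ suc q !))) (fromℕ-+ (suc p) (suc q)) ⟨
  r *ℚ (fromℕ (suc (p + suc q)) *ℚ (1/ suc p ! *ℚ 1/ suc q !))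
    ≡⟨ 1/1+-cancel (p + suc q) _ ⟩
  1/ suc p ! *ℚ 1/ suc q ! ∎
  where
  open ≡-Reasoning
  r = 1/1+ (p + suc q)
  unfold : ∀ n → 1/ n ! ≡ fromℕ (suc n) *ℚ 1/ suc n !
  unfold n = sym (trans (cong (fromℕ (suc n) *ℚ_) (1/suc! n)) (trans (sym (ℚₚ.*-assoc (fromℕ (suc n)) (1/1+ n) (1/ n !)))
    (trans (cong (_*ℚ 1/ n !) (1/1+-inverse n)) (ℚₚ.*-identityˡ (1/ n !)))))

mono : ℕ → List ℕ → ℚ⟦q⟧
mono d []      = 1q
mono d (m ∷ w) = pw m (fromℕ d) · (L d *q mono d w)

block : ℕ → List ℕ → ℚ⟦q⟧
block d w = 1/ length w ! · mono d w

-- Within one block the order of the letters does not affect the monomial, so only the number of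
-- shuffles matters. Each placed letter moves into the factor `g` and shifts `c`, so both are kept
-- general.
sh-mono : ∀ d (c : ℕ → ℚ) g u v M → sh (λ w → c (length w) *ℚ (g *q mono d w) M) u v ≡
  (shuffles (length u) (length v) *ℚ c (length u + length v)) *ℚ (g *q (mono d u *q mono d v)) M
sh-mono d c g []      v       M = cong₂ _*ℚ_ (sym (ℚₚ.*-identityˡ (c (length v)))) (*q-congˡ {g} (λ N → sym (*q-identityˡ (mono d v) N)) M)
sh-mono d c g (x ∷ u) []      M = cong₂ _*ℚ_
  (sym (trans (ℚₚ.*-identityˡ _) (cong c (ℕₚ.+-identityʳ (suc (length u))))))
  (*q-congˡ {g} (λ N → sym (trans (*q-comm (mono d (x ∷ u)) 1q N) (*q-identityˡ (mono d (x ∷ u)) N))) M)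
sh-mono d c g (x ∷ u) (y ∷ v) M = begin
  sh (λ w → c (suc (length w)) *ℚ (g *q mono d (x ∷ w)) M) u (y ∷ v) +ℚ sh (λ w → c (suc (length w)) *ℚ (g *q mono d (y ∷ w)) M) (x ∷ u) v
    ≡⟨ cong₂ _+ℚ_
        (trans (sh-cong (λ w → cong (c (suc (length w)) *ℚ_) (absorb x w)) u (y ∷ v)) (sh-mono d (c ∘ suc) (factor x) u (y ∷ v) M))
        (trans (sh-cong (λ w → cong (c (suc (length w)) *ℚ_) (absorb y w)) (x ∷ u) v) (sh-mono d (c ∘ suc) (factor y) (x ∷ u) v M)) ⟩
  (s₁ *ℚ c (suc (length u + suc (length v)))) *ℚ (factor x *q (mono d u *q mono d (y ∷ v))) M
    +ℚ (s₂ *ℚ c (suc (suc (length u) + length v))) *ℚ (factor y *q (mono d (x ∷ u) *q mono d v)) M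
    ≡⟨ cong₂ (λ n t → (s₁ *ℚ c (suc (length u + suc (length v)))) *ℚ (factor x *q (mono d u *q mono d (y ∷ v))) M +ℚ (s₂ *ℚ c n) *ℚ t)
         (cong suc (sym (ℕₚ.+-suc (length u) (length v)))) right ⟩
  (s₁ *ℚ C) *ℚ (factor x *q (mono d u *q mono d (y ∷ v))) M +ℚ (s₂ *ℚ C) *ℚ (g *q (mono d (x ∷ u) *q mono d (y ∷ v))) M
    ≡⟨ cong (λ t → (s₁ *ℚ C) *ℚ t +ℚ (s₂ *ℚ C) *ℚ (g *q (mono d (x ∷ u) *q mono d (y ∷ v))) M) left ⟩
  (s₁ *ℚ C) *ℚ Z +ℚ (s₂ *ℚ C) *ℚ Z
    ≡⟨ solve 4 (λ a b c z → (a :* c) :* z :+ (b :* c) :* z := ((a :+ b) :* c) :* z) refl s₁ s₂ C Z ⟩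
  ((s₁ +ℚ s₂) *ℚ C) *ℚ Z ∎
  where
  open ≡-Reasoning
  s₁ = shuffles (length u) (suc (length v))
  s₂ = shuffles (suc (length u)) (length v)
  C = c (suc (length u + suc (length v)))
  Z = (g *q (mono d (x ∷ u) *q mono d (y ∷ v))) M
  factor : ℕ → ℚ⟦q⟧
  factor x = pw x (fromℕ d) · (g *q L d)
  absorb′ : ∀ x (h : ℚ⟦q⟧) → g *q (pw x (fromℕ d) · (L d *q h)) ≗ factor x *q h
  absorb′ x h M = trans (*q-·ʳ (pw x (fromℕ d)) g (L d *q h) M)
    (trans (cong (pw x (fromℕ d) *ℚ_) (sym (*q-assoc g (L d) h M))) (sym (*q-·ˡ (pw x (fromℕ d)) (g *q L d) h M)))
  absorb : ∀ x w → (g *q mono d (x ∷ w)) M ≡ (factor x *q mono d w) M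
  absorb x w = absorb′ x (mono d w) M
  pull : ∀ x (h k : ℚ⟦q⟧) → (factor x *q (h *q k)) M ≡ (g *q ((pw x (fromℕ d) · (L d *q h)) *q k)) M
  pull x h k = trans (sym (absorb′ x (h *q k) M)) (*q-congˡ {g}
    (λ N → trans (cong (pw x (fromℕ d) *ℚ_) (sym (*q-assoc (L d) h k N))) (sym (*q-·ˡ (pw x (fromℕ d)) (L d *q h) k N))) M)
  left : (factor x *q (mono d u *q mono d (y ∷ v))) M ≡ Z
  left = pull x (mono d u) (mono d (y ∷ v))
  right : (factor y *q (mono d (x ∷ u) *q mono d v)) M ≡ Z
  right = trans (*q-congˡ {factor y} (*q-comm (mono d (x ∷ u)) (mono d v)) M)
    (trans (pull y (mono d v) (mono d (x ∷ u))) (*q-congˡ {g} (*q-comm (mono d (y ∷ v)) (mono d (x ∷ u))) M))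

-- `block d` is a character of the shuffle algebra: the (p+q)!/(p! q!) shuffles turn the weight
-- 1/(p+q)! into 1/p! times 1/q!.
sh-block : ∀ d u v M → sh (λ w → block d w M) u v ≡ (block d u *q block d v) M
sh-block d u v M = begin
  sh (λ w → 1/ length w ! *ℚ mono d w M) u v
    ≡⟨ sh-cong (λ w → cong (1/ length w ! *ℚ_) (sym (*q-identityˡ (mono d w) M))) u v ⟩
  sh (λ w → 1/ length w ! *ℚ (1q *q mono d w) M) u v
    ≡⟨ sh-mono d 1/_! 1q u v M ⟩
  (shuffles (length u) (length v) *ℚ 1/ (length u + length v) !) *ℚ (1q *q (mono d u *q mono d v)) M
    ≡⟨ cong₂ _*ℚ_ (shuffles-! (length u) (length v)) (*q-identityˡ (mono d u *q mono d v) M) ⟩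
  (1/ length u ! *ℚ 1/ length v !) *ℚ (mono d u *q mono d v) M
    ≡⟨ ℚₚ.*-assoc (1/ length u !) (1/ length v !) ((mono d u *q mono d v) M) ⟩
  1/ length u ! *ℚ (1/ length v ! *ℚ (mono d u *q mono d v) M)
    ≡⟨ trans (*q-·ˡ (1/ length u !) (mono d u) (block d v) M) (cong (1/ length u ! *ℚ_) (*q-·ʳ (1/ length v !) (mono d u) (mono d v) M)) ⟨
  (block d u *q block d v) M ∎
  where open ≡-Reasoning

module _ (B : ℕ) where
  open Words B

  Kₐ : ℕ → ℕ → List ℕ → ℚ⟦q⟧
  Kₐ d i w = K d i (map abs w)

  Fₐ : ℕ → List ℕ → ℚ⟦q⟧
  Fₐ d w = F d (map abs w)

  K-split : ∀ d i w M → Kₐ d i w M ≡ split (λ u v → ((fall B i (length u) · mono d u) *q Fₐ d v) M) w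
  K-split d i []      M = sym (trans (*q-cong {g = 1q} (λ N → ℚₚ.*-identityˡ (1q N)) (λ _ → refl) M) (*q-identityˡ 1q M))
  K-split d i (m ∷ w) M = begin
    (p *ℚ (1/1+ i)) *ℚ (L d *q Kₐ d (suc i) w) M +ℚ Fₐ d (m ∷ w) M
      ≡⟨ ℚₚ.+-comm _ (Fₐ d (m ∷ w) M) ⟩
    Fₐ d (m ∷ w) M +ℚ (p *ℚ (1/1+ i)) *ℚ (L d *q Kₐ d (suc i) w) M
      ≡⟨ cong₂ _+ℚ_ (sym (trans (*q-cong {g = Fₐ d (m ∷ w)} (λ N → ℚₚ.*-identityˡ (1q N)) (λ _ → refl) M) (*q-identityˡ (Fₐ d (m ∷ w)) M)))
           (trans (sym (*q-·ˡ (p *ℚ (1/1+ i)) (L d) (Kₐ d (suc i) w) M))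
           (trans (*q-congˡ {(p *ℚ (1/1+ i)) · L d} (K-split d (suc i) w) M)
           (trans (split-*qʳ (λ u v → (fall B (suc i) (length u) · mono d u) *q Fₐ d v) ((p *ℚ (1/1+ i)) · L d) w M)
             (split-cong regroup w)))) ⟩
    split (λ u v → ((fall B i (length u) · mono d u) *q Fₐ d v) M) (m ∷ w) ∎
    where
    open ≡-Reasoning
    p = pw m (fromℕ d)
    regroup : ∀ u v → (((p *ℚ (1/1+ i)) · L d) *q ((fall B (suc i) (length u) · mono d u) *q Fₐ d v)) M ≡
      ((fall B i (suc (length u)) · mono d (m ∷ u)) *q Fₐ d v) M
    regroup u v = trans (sym (*q-assoc ((p *ℚ (1/1+ i)) · L d) (f · mono d u) (Fₐ d v) M))
      (*q-cong {g = Fₐ d v} (λ N → trans (*q-·ˡ (p *ℚ (1/1+ i)) (L d) (f · mono d u) N)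
          (trans (cong ((p *ℚ (1/1+ i)) *ℚ_) (*q-·ʳ f (L d) (mono d u) N))
            (solve 4 (λ p r f x → (p :* r) :* (f :* x) := (r :* f) :* (p :* x)) refl p (1/1+ i) f ((L d *q mono d u) N))))
        (λ _ → refl) M)
      where f = fall B (suc i) (length u)

  -- Presents the sum as a convolution of characters, one for each index value `d + 1`, ..., `B`:
  -- the prefix `u`, possibly empty, is the block of indices equal to `d + 1`.
  F-step : ∀ d w M → d < B → Fₐ d w M ≡ split (λ u v → (block (suc d) u *q Fₐ (suc d) v) M) w
  F-step d []      M d<B = sym (trans (*q-cong {g = 1q} (λ N → ℚₚ.*-identityˡ (1q N)) (λ _ → refl) M) (*q-identityˡ 1q M))
  F-step d (m ∷ w) M d<B = begin
    Σℚ (B ∸ d) (λ k → summand (suc (d + k)))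
      ≡⟨ cong (λ n → Σℚ n (λ k → summand (suc (d + k)))) (B∸d) ⟩
    Σℚ (suc (B ∸ suc d)) (λ k → summand (suc (d + k)))
      ≡⟨ Σℚ-head (B ∸ suc d) (λ k → summand (suc (d + k))) ⟩
    summand (suc (d + 0)) +ℚ Σℚ (B ∸ suc d) (λ k → summand (suc (d + suc k)))
      ≡⟨ cong₂ _+ℚ_ (cong (λ n → summand (suc n)) (ℕₚ.+-identityʳ d)) (Σℚ-cong (B ∸ suc d) (λ k → cong (λ n → summand (suc n)) (ℕₚ.+-suc d k))) ⟩
    summand (suc d) +ℚ Fₐ (suc d) (m ∷ w) M
      ≡⟨ ℚₚ.+-comm (summand (suc d)) (Fₐ (suc d) (m ∷ w) M) ⟩
    Fₐ (suc d) (m ∷ w) M +ℚ summand (suc d)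
      ≡⟨ cong₂ _+ℚ_ (sym (trans (*q-cong {g = Fₐ (suc d) (m ∷ w)} (λ N → ℚₚ.*-identityˡ (1q N)) (λ _ → refl) M) (*q-identityˡ (Fₐ (suc d) (m ∷ w)) M)))
           (trans (sym (*q-·ˡ p (L (suc d)) (Kₐ (suc d) 1 w) M))
           (trans (*q-congˡ {p · L (suc d)} (K-split (suc d) 1 w) M)
           (trans (split-*qʳ (λ u v → (fall B 1 (length u) · mono (suc d) u) *q Fₐ (suc d) v) (p · L (suc d)) w M)
             (split-cong regroup w)))) ⟩
    split (λ u v → (block (suc d) u *q Fₐ (suc d) v) M) (m ∷ w) ∎
    where
    open ≡-Reasoning
    p = pw m (fromℕ (suc d))
    summand : ℕ → ℚ
    summand d′ = pw m (fromℕ d′) *ℚ (L d′ *q Kₐ d′ 1 w) M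
    B∸d : B ∸ d ≡ suc (B ∸ suc d)
    B∸d = ℕₚ.+-∸-assoc 1 d<B
    regroup : ∀ u v → ((p · L (suc d)) *q ((fall B 1 (length u) · mono (suc d) u) *q Fₐ (suc d) v)) M ≡
      (block (suc d) (m ∷ u) *q Fₐ (suc d) v) M
    regroup u v = trans (sym (*q-assoc (p · L (suc d)) (f · mono (suc d) u) (Fₐ (suc d) v) M))
      (*q-cong {g = Fₐ (suc d) v} (λ N → trans (*q-·ˡ p (L (suc d)) (f · mono (suc d) u) N)
          (trans (cong (p *ℚ_) (*q-·ʳ f (L (suc d)) (mono (suc d) u) N))
            (trans (*ℚ-left-comm p f ((L (suc d) *q mono (suc d) u) N))
              (cong (_*ℚ (p *ℚ (L (suc d) *q mono (suc d) u) N)) (fall-1 B (length u))))))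
        (λ _ → refl) M)
      where f = fall B 1 (length u)

  -- A convolution of characters is again a character, because deconcatenation respects shuffles
  -- (`sh-split`); the induction removes the smallest index value.
  sh-F : ∀ n d u v → B ∸ d ≡ n → ∀ M → sh (λ w → Fₐ d w M) u v ≡ (Fₐ d u *q Fₐ d v) M
  sh-F zero    d []      v       e M = sym (*q-identityˡ (Fₐ d v) M)
  sh-F zero    d (x ∷ u) []      e M = sym (trans (*q-comm (Fₐ d (x ∷ u)) 1q M) (*q-identityˡ (Fₐ d (x ∷ u)) M))
  sh-F zero    d (x ∷ u) (y ∷ v) e M = trans
    (cong₂ _+ℚ_ (sh-vanish (λ w → Fₐ d (x ∷ w) M) (λ w → empty x w M) u (y ∷ v)) (sh-vanish (λ w → Fₐ d (y ∷ w) M) (λ w → empty y w M) (x ∷ u) v))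
    (sym (trans (*q-cong {g = Fₐ d (y ∷ v)} (empty x u) (λ _ → refl) M) (*q-zeroˡ (Fₐ d (y ∷ v)) M)))
    where
    empty : ∀ x w → Fₐ d (x ∷ w) ≗ 𝟘
    empty x w M = cong (λ n → Σℚ n (λ k → (abs x d (suc (d + k)) · (L (suc (d + k)) *q Kₐ (suc (d + k)) 1 w)) M)) e
  sh-F (suc n) d u v e M = begin
    sh (λ w → Fₐ d w M) u v
      ≡⟨ sh-cong (λ w → F-step d w M d<B) u v ⟩
    sh (split (λ a b → (block (suc d) a *q F′ b) M)) u v
      ≡⟨ sh-split (λ a b → (block (suc d) a *q F′ b) M) u v ⟩
    split (λ u₁ u₂ → split (λ v₁ v₂ → sh (λ a → sh (λ b → (block (suc d) a *q F′ b) M) u₂ v₂) u₁ v₁) v) u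
      ≡⟨ split-cong (λ u₁ u₂ → trans (split-cong (λ v₁ v₂ → characters u₁ u₂ v₁ v₂) v)
           (sym (split-*qʳ (λ v₁ v₂ → block (suc d) v₁ *q F′ v₂) (block (suc d) u₁ *q F′ u₂) v M))) u ⟩
    split (λ u₁ u₂ → ((block (suc d) u₁ *q F′ u₂) *q (λ N → split (λ v₁ v₂ → (block (suc d) v₁ *q F′ v₂) N) v)) M) u
      ≡⟨ split-*q (λ u₁ u₂ → block (suc d) u₁ *q F′ u₂) (λ N → split (λ v₁ v₂ → (block (suc d) v₁ *q F′ v₂) N) v) u M ⟨
    ((λ N → split (λ u₁ u₂ → (block (suc d) u₁ *q F′ u₂) N) u) *q (λ N → split (λ v₁ v₂ → (block (suc d) v₁ *q F′ v₂) N) v)) M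
      ≡⟨ *q-cong (λ N → F-step d u N d<B) (λ N → F-step d v N d<B) M ⟨
    (Fₐ d u *q Fₐ d v) M ∎
    where
    open ≡-Reasoning
    F′ = Fₐ (suc d)
    d<B : d < B
    d<B = ℕₚ.m∸n≢0⇒n<m (λ z → ℕₚ.0≢1+n (trans (sym z) e))
    e′ : B ∸ suc d ≡ n
    e′ = ℕₚ.suc-injective (trans (sym (ℕₚ.+-∸-assoc 1 d<B)) e)
    characters : ∀ u₁ u₂ v₁ v₂ → sh (λ a → sh (λ b → (block (suc d) a *q F′ b) M) u₂ v₂) u₁ v₁ ≡
      ((block (suc d) u₁ *q F′ u₂) *q (block (suc d) v₁ *q F′ v₂)) M
    characters u₁ u₂ v₁ v₂ = begin
      sh (λ a → sh (λ b → (block (suc d) a *q F′ b) M) u₂ v₂) u₁ v₁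
        ≡⟨ sh-cong (λ a → trans (sh-*q (block (suc d) a) F′ u₂ v₂ M) (*q-congˡ {block (suc d) a} (sh-F n (suc d) u₂ v₂ e′) M)) u₁ v₁ ⟩
      sh (λ a → (block (suc d) a *q (F′ u₂ *q F′ v₂)) M) u₁ v₁
        ≡⟨ sh-*qˡ (F′ u₂ *q F′ v₂) (block (suc d)) u₁ v₁ M ⟩
      ((λ N → sh (λ a → block (suc d) a N) u₁ v₁) *q (F′ u₂ *q F′ v₂)) M
        ≡⟨ *q-cong {g = F′ u₂ *q F′ v₂} (sh-block (suc d) u₁ v₁) (λ _ → refl) M ⟩
      ((block (suc d) u₁ *q block (suc d) v₁) *q (F′ u₂ *q F′ v₂)) M
        ≡⟨ *q-interchange (block (suc d) u₁) (block (suc d) v₁) (F′ u₂) (F′ v₂) M ⟩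
      ((block (suc d) u₁ *q F′ u₂) *q (block (suc d) v₁ *q F′ v₂)) M ∎
      where
      *q-interchange : ∀ a b c d → (a *q b) *q (c *q d) ≗ (a *q c) *q (b *q d)
      *q-interchange a b c d M = trans (*q-assoc a b (c *q d) M) (trans (*q-congˡ {a} (λ N → trans (sym (*q-assoc b c d N))
        (trans (*q-cong {g = d} (*q-comm b c) (λ _ → refl) N) (*q-assoc c b d N))) M) (sym (*q-assoc a c (b *q d) M)))

absBasis-* : ∀ u v B M → (Words.K B 0 0 (map abs u) *q Words.K B 0 0 (map abs v)) M ≡ sh (λ w → Words.K B 0 0 (map abs w) M) u v
absBasis-* u v B M = trans
  (*q-cong {Words.K B 0 0 (map abs u)} {Words.F B 0 (map abs u)} {Words.K B 0 0 (map abs v)} {Words.F B 0 (map abs v)} (K≗F B (map abs u)) (K≗F B (map abs v)) M)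
  (trans (sym (sh-F B B 0 u v refl M)) (sh-cong (λ w → sym (K≗F B (map abs w) M)) u v))

span-∑ : ∀ {I P T : Set} {b : I → P → ℚ} (ts : List T) {h : T → P → ℚ} → (∀ t → Span b (h t)) → Span b (λ p → ∑ ts (λ t → h t p))
span-∑ []       s = span-𝟘
span-∑ (t ∷ ts) s = span-⊕ (s t) (span-∑ ts s)

∑-*q-∑ : ∀ {I J : Set} (ts : List (ℚ × I)) (us : List (ℚ × J)) (f : I → ℚ⟦q⟧) (g : J → ℚ⟦q⟧) M →
  ((λ N → ∑ ts (λ t → proj₁ t *ℚ f (proj₂ t) N)) *q (λ N → ∑ us (λ u → proj₁ u *ℚ g (proj₂ u) N))) M ≡
  ∑ ts (λ t → ∑ us (λ u → (proj₁ t *ℚ proj₁ u) *ℚ (f (proj₂ t) *q g (proj₂ u)) M))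
∑-*q-∑ ts us f g M = begin
  (F *q G) M
    ≡⟨ *q-comm F G M ⟩
  (G *q F) M
    ≡⟨ *q-∑ʳ ts G (λ t → proj₁ t · f (proj₂ t)) M ⟩
  ∑ ts (λ t → (G *q (proj₁ t · f (proj₂ t))) M)
    ≡⟨ ∑-cong ts (λ t → trans (*q-comm G (proj₁ t · f (proj₂ t)) M) (trans (*q-∑ʳ us (proj₁ t · f (proj₂ t)) (λ u → proj₁ u · g (proj₂ u)) M)
         (∑-cong us (λ u → scalars (proj₁ t) (proj₁ u) (f (proj₂ t)) (g (proj₂ u)))))) ⟩
  ∑ ts (λ t → ∑ us (λ u → (proj₁ t *ℚ proj₁ u) *ℚ (f (proj₂ t) *q g (proj₂ u)) M)) ∎
  where
  open ≡-Reasoning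
  F G : ℚ⟦q⟧
  F N = ∑ ts (λ t → proj₁ t *ℚ f (proj₂ t) N)
  G N = ∑ us (λ u → proj₁ u *ℚ g (proj₂ u) N)
  scalars : ∀ c c′ f g → ((c · f) *q (c′ · g)) M ≡ (c *ℚ c′) *ℚ (f *q g) M
  scalars c c′ f g = trans (*q-·ˡ c f (c′ · g) M) (trans (cong (c *ℚ_) (*q-·ʳ c′ f g M)) (sym (ℚₚ.*-assoc c c′ ((f *q g) M))))

absK : List ℕ → ℕ → ℚ⟦q⟧
absK w B = Words.K B 0 0 (map abs w)

InV-* : ∀ {f g} → InV f → InV g → InV (λ B → f B *q g B)
InV-* {f} {g} p r = go (span-bind gaps-in-abs p) (span-bind gaps-in-abs r)
  where
  go : Span absBasis ⌊ f ⌋ → Span absBasis ⌊ g ⌋ → InV (λ B → f B *q g B)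
  go (ts , e) (us , e′) = span-bind abs-in-gaps (span-≗ (λ (B , M , l) → sym (expand B M l))
    (span-∑ ts (λ t → span-∑ us (λ u → span-· (proj₁ t *ℚ proj₁ u) (span-sh (λ w → span-basis {b = absBasis} w) (proj₂ t) (proj₂ u))))))
    where
    expand : ∀ B M → M ≤ B → (f B *q g B) M ≡
      ∑ ts (λ t → ∑ us (λ u → (proj₁ t *ℚ proj₁ u) *ℚ sh (λ w → absK w B M) (proj₂ t) (proj₂ u)))
    expand B M l = trans
      (*q-cong≤ {f B} {λ N → ∑ ts (λ t → proj₁ t *ℚ absK (proj₂ t) B N)} {g B} {λ N → ∑ us (λ u → proj₁ u *ℚ absK (proj₂ u) B N)} M
        (λ i i≤M → e (B , i , ℕₚ.≤-trans i≤M l)) (λ i i≤M → e′ (B , i , ℕₚ.≤-trans i≤M l)))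
      (trans (∑-*q-∑ ts us (λ w → absK w B) (λ w → absK w B) M)
        (∑-cong ts (λ t → ∑-cong us (λ u → cong ((proj₁ t *ℚ proj₁ u) *ℚ_) (absBasis-* (proj₂ t) (proj₂ u) B M)))))

-- Conjugation

q^_ : ℕ → ℚ⟦q⟧
(q^ a) M = [ M ≟ a ]

q^-< : ∀ a M → M < a → (q^ a) M ≡ 0ℚ
q^-< (suc a) zero    l       = refl
q^-< (suc a) (suc M) (s≤s l) = q^-< a M l

q^0 : q^ 0 ≗ 1q
q^0 zero    = refl
q^0 (suc M) = refl

q^-shift : ∀ a f M → (q^ a *q f) (a + M) ≡ f M
q^-shift zero    f M = trans (*q-cong {g = f} q^0 (λ _ → refl) M) (*q-identityˡ f M)
q^-shift (suc a) f M = trans (*q-suc (q^ suc a) f (a + M)) (trans (cong (_+ℚ (q^ a *q f) (a + M)) (ℚₚ.*-zeroˡ (f (suc (a + M)))))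
  (trans (ℚₚ.+-identityˡ _) (q^-shift a f M)))

q^-shift-< : ∀ a f M → M < a → (q^ a *q f) M ≡ 0ℚ
q^-shift-< a f M l = *q-vanish a (q^ a) f M (q^-< a) l

<-or-+ : ∀ a M {P : ℕ → Set} → (M < a → P M) → (∀ N → P (a + N)) → P M
<-or-+ a M {P} f g with M ℕₚ.<? a
... | yes l = f l
... | no  l = subst P (ℕₚ.m+[n∸m]≡n (ℕₚ.≮⇒≥ l)) (g (M ∸ a))

[+≟] : ∀ a M b → [ a + M ≟ a + b ] ≡ [ M ≟ b ]
[+≟] zero    M b = refl
[+≟] (suc a) M b = [+≟] a M b

q^-+ : ∀ a b → q^ (a + b) ≗ (q^ a) *q (q^ b)
q^-+ a b M = <-or-+ a M {λ M → (q^ (a + b)) M ≡ ((q^ a) *q (q^ b)) M}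
  (λ l → trans (q^-< (a + b) M (ℕₚ.<-≤-trans l (ℕₚ.m≤m+n a b))) (sym (q^-shift-< a (q^ b) M l)))
  (λ N → trans ([+≟] a N b) (sym (q^-shift a (q^ b) N)))

L-∣ : ∀ d N → d ∣ suc N → L d (suc N) ≡ 1ℚ
L-∣ d N d∣N with d ∣? suc N
... | yes _   = refl
... | no  d∤N = contradiction d∣N d∤N

L-∤ : ∀ d N → ¬ d ∣ suc N → L d (suc N) ≡ 0ℚ
L-∤ d N d∤N with d ∣? suc N
... | yes d∣N = contradiction d∣N d∤N
... | no  _   = refl

L-step : ∀ c → L (suc c) ≗ (q^ suc c) ⊕ ((q^ suc c) *q L (suc c))
L-step c M = <-or-+ (suc c) M {λ M → L (suc c) M ≡ (q^ suc c) M +ℚ ((q^ suc c) *q L (suc c)) M}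
  (λ l → trans (L-< (suc c) M l) (sym (cong₂ _+ℚ_ (q^-< (suc c) M l) (q^-shift-< (suc c) (L (suc c)) M l))))
  (λ N → trans (value N) (cong₂ _+ℚ_ (trans (sym ([+≟] (suc c) N 0)) (cong (λ t → [ suc (c + N) ≟ suc t ]) (ℕₚ.+-identityʳ c)))
     (sym (q^-shift (suc c) (L (suc c)) N))))
  where
  value : ∀ N → L (suc c) (suc c + N) ≡ [ N ≟ 0 ] +ℚ L (suc c) N
  value zero = L-∣ (suc c) (c + 0) (subst (suc c ∣_) (sym (ℕₚ.+-identityʳ (suc c))) ∣-refl)
  value (suc N) with suc c ∣? suc N
  ... | yes d = trans (L-∣ (suc c) (c + suc N) (∣m∣n⇒∣m+n ∣-refl d)) (sym (trans (ℚₚ.+-identityˡ _) (L-∣ (suc c) N d)))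
  ... | no ¬d = trans (L-∤ (suc c) (c + suc N) (λ d → ¬d (∣m+n∣m⇒∣n d ∣-refl))) (sym (trans (ℚₚ.+-identityˡ _) (L-∤ (suc c) N ¬d)))

-- x(q^N) up to the truncation order B, for N ≥ 1.
ev : ℕ → ℚ⟦q⟧ → ℕ → ℚ⟦q⟧
ev B x N = ∑q (suc B) (λ u → x u · (q^ (u * N)))

-- ∑ x₁(q^{N₁}) ⋯ x_m(q^{N_m}) over n ≥ N₁ > … > N_m > 0.
P : ℕ → ℕ → List ℚ⟦q⟧ → ℚ⟦q⟧
P B n []      = 1q
P B n (x ∷ w) = ∑q n (λ j → ev B x (suc j) *q P B j w)

-- ∑ x₁(d₁ - d) x₂(d₂ - d₁) ⋯ L_{d₁} L_{d₂} ⋯ over d ≤ d₁ ≤ d₂ ≤ … ≤ B.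
C : ℕ → ℕ → List ℚ⟦q⟧ → ℚ⟦q⟧
C B d []      = 1q
C B d (x ∷ w) = (x 0 · (L d *q C B d w)) ⊕ Words.∑> B d (λ d′ → x (d′ ∸ d) · (L d′ *q C B d′ w))

module Conjugation (B : ℕ) where
  open Truncated B
  open CommutativeRing ring using (setoid; +-cong; +-congˡ; +-congʳ; *-cong; *-congˡ; *-congʳ)
    renaming (refl to ≈-refl; sym to ≈-sym; trans to ≈-trans)
  open import Relation.Binary.Reasoning.Setoid setoid

  ∑q-cong : ∀ n {f g : ℕ → ℚ⟦q⟧} → (∀ i → f i ≈ g i) → ∑q n f ≈ ∑q n g
  ∑q-cong n e = mod λ M l → Σℚ-cong n (λ i → at (e i) M l)

  ·-cong : ∀ c {f g} → f ≈ g → c · f ≈ c · g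
  ·-cong c e = mod λ M l → cong (c *ℚ_) (at e M l)

  ∑q-*ˡ : ∀ n f g → g *q ∑q n f ≈ ∑q n (λ i → g *q f i)
  ∑q-*ˡ n f g = ≗⇒≈ (*q-Σʳ n g f)

  ∑q-*ʳ : ∀ n f g → ∑q n f *q g ≈ ∑q n (λ i → f i *q g)
  ∑q-*ʳ n f g = ≗⇒≈ (*q-Σˡ n f g)

  q^-*-L : ∀ c n → (q^ (suc c * n)) *q L (suc c) ≈ (q^ (suc c * suc n)) ⊕ ((q^ (suc c * suc n)) *q L (suc c))
  q^-*-L c n = ≈-trans (*-congˡ {q^ (suc c * n)} (≗⇒≈ (L-step c))) (≈-trans (≗⇒≈ (*q-distribˡ (q^ (suc c * n)) (q^ suc c) ((q^ suc c) *q L (suc c))))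
    (+-cong (≗⇒≈ power) (≈-trans (≈-sym (≗⇒≈ (*q-assoc (q^ (suc c * n)) (q^ suc c) (L (suc c))))) (*-congʳ {L (suc c)} (≗⇒≈ power)))))
    where
    power : (q^ (suc c * n)) *q (q^ suc c) ≗ (q^ (suc c * suc n))
    power M = trans (sym (q^-+ (suc c * n) (suc c) M))
      (cong (λ t → (q^ t) M) (trans (ℕₚ.+-comm (suc c * n) (suc c)) (sym (ℕₚ.*-suc (suc c) n))))

  -- Abel summation: with D = `suc c`, the geometric series `L D` turns q^(DN) into the sum of all
  -- q^(DN′) with N′ > N, so the terms of `X` below N′ accumulate to a partial sum. The last summand
  -- is the boundary term at `n`.
  telescope : ∀ c (X : ℕ → ℚ⟦q⟧) n → L (suc c) *q ∑q n (λ j → (q^ (suc c * suc j)) *q X j) ≈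
    ∑q n (λ i → (q^ (suc c * suc i)) *q ∑q i X) ⊕ (((q^ (suc c * n)) *q L (suc c)) *q ∑q n X)
  telescope c X zero = ≗⇒≈ λ M → trans (*q-comm (L (suc c)) 𝟘 M) (trans (*q-zeroˡ (L (suc c)) M) (sym (trans (ℚₚ.+-identityˡ _)
    (trans (*q-comm ((q^ (suc c * 0)) *q L (suc c)) 𝟘 M) (*q-zeroˡ ((q^ (suc c * 0)) *q L (suc c)) M)))))
  telescope c X (suc n) = begin
    Λ *q (S ⊕ (Q′ *q x))
      ≈⟨ distribˡ Λ S (Q′ *q x) ⟩
    (Λ *q S) ⊕ (Λ *q (Q′ *q x))
      ≈⟨ +-congʳ (≈-trans (telescope c X n) (+-congˡ {R} (*-congʳ {A} (q^-*-L c n)))) ⟩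
    (R ⊕ ((Q′ ⊕ (Q′ *q Λ)) *q A)) ⊕ (Λ *q (Q′ *q x))
      ≈⟨ rearrange R Q′ Λ A x ⟩
    (R ⊕ (Q′ *q A)) ⊕ ((Q′ *q Λ) *q (A ⊕ x)) ∎
    where
    open CommutativeRing ring using (distribˡ; commutativeSemiring)
    open import Algebra.Solver.Ring.NaturalCoefficients.Default commutativeSemiring
      using () renaming (solve to solveᵣ; _:+_ to _⊞_; _:*_ to _⊠_; _:=_ to _≣_)
    Λ = L (suc c)
    S = ∑q n (λ j → (q^ (suc c * suc j)) *q X j)
    R = ∑q n (λ i → (q^ (suc c * suc i)) *q ∑q i X)
    Q′ = q^ (suc c * suc n)
    A = ∑q n X
    x = X n
    rearrange : ∀ R Q Λ A x → (R ⊕ ((Q ⊕ (Q *q Λ)) *q A)) ⊕ (Λ *q (Q *q x)) ≈ (R ⊕ (Q *q A)) ⊕ ((Q *q Λ) *q (A ⊕ x))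
    rearrange = solveᵣ 5 (λ R Q Λ A x → (R ⊞ ((Q ⊞ (Q ⊠ Λ)) ⊠ A)) ⊞ (Λ ⊠ (Q ⊠ x)) ≣ (R ⊞ (Q ⊠ A)) ⊞ ((Q ⊠ Λ) ⊠ (A ⊞ x))) ≈-refl

  -- For `c = 0` the power alone has order `B`, which is one short; `L` has no constant term and
  -- supplies the missing power.
  tail-vanishes : ∀ c f → ((q^ (suc c * B)) *q L (suc c)) *q f ≈ 𝟘
  tail-vanishes c f = mod λ M l → *q-vanish (suc B) ((q^ (suc c * B)) *q L (suc c)) f M (λ i i<B → vanish i (ℕₚ.≤-pred i<B)) (s≤s l)
    where
    vanish : ∀ i → i ≤ B → ((q^ (suc c * B)) *q L (suc c)) i ≡ 0ℚ
    vanish i l = <-or-+ (suc c * B) i {λ i → i ≤ B → ((q^ (suc c * B)) *q L (suc c)) i ≡ 0ℚ}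
      (λ i< _ → q^-shift-< (suc c * B) (L (suc c)) i i<)
      (λ N N≤ → trans (q^-shift (suc c * B) (L (suc c)) N) (L-0-at N (ℕₚ.≤-trans (ℕₚ.+-monoˡ-≤ N (ℕₚ.m≤m+n B (c * B))) N≤))) l
      where
      L-0-at : ∀ N → B + N ≤ B → L (suc c) N ≡ 0ℚ
      L-0-at zero    l = refl
      L-0-at (suc N) l = contradiction (subst (_≤ B) (ℕₚ.+-suc B N) l) (ℕₚ.<⇒≱ (s≤s (ℕₚ.m≤m+n B N)))

  telescope-B : ∀ c X → L (suc c) *q ∑q B (λ j → (q^ (suc c * suc j)) *q X j) ≈ ∑q B (λ i → (q^ (suc c * suc i)) *q ∑q i X)
  telescope-B c X = ≈-trans (telescope c X B) (≈-trans (+-congˡ {∑q B (λ i → (q^ (suc c * suc i)) *q ∑q i X)} (tail-vanishes c (∑q B X))) (≗⇒≈ λ M → ℚₚ.+-identityʳ _))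

  geometric : ∀ c n → L (suc c) ≈ ∑q n (λ j → q^ (suc c * suc j)) ⊕ ((q^ (suc c * n)) *q L (suc c))
  geometric c zero    = ≗⇒≈ λ M → sym (trans (ℚₚ.+-identityˡ _) (trans (*q-cong {q^ (suc c * 0)} {1q} {L (suc c)}
    (λ N → trans (cong (λ t → (q^ t) N) (ℕₚ.*-zeroʳ (suc c))) (q^0 N)) (λ _ → refl) M) (*q-identityˡ (L (suc c)) M)))
  geometric c (suc n) = ≈-trans (geometric c n) (≈-trans (+-congˡ {∑q n (λ j → q^ (suc c * suc j))} (q^-*-L c n)) (≗⇒≈ λ M → sym (ℚₚ.+-assoc (∑q n (λ j → q^ (suc c * suc j)) M) (Q′ M) ((Q′ *q L (suc c)) M))))
    where
    Q′ = q^ (suc c * suc n)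

  -- The sum over d′ = d + u only has terms with u ≤ B mod q^{B+1}.
  C-shift : ∀ d x w → C B d (x ∷ w) ≈ ∑q (suc B) (λ u → x u · (L (d + u) *q C B (d + u) w))
  C-shift d x w = mod λ M l → sym (trans (Σℚ-head B (λ u → x u *ℚ term (d + u) M)) (cong₂ _+ℚ_
      (cong (λ t → x 0 *ℚ term t M) (ℕₚ.+-identityʳ d))
      (trans (Σℚ-extend (B ∸ d) B (λ u → x (suc u) *ℚ term (d + suc u) M) (ℕₚ.m∸n≤m B d) (λ u u≥ →
          trans (cong (x (suc u) *ℚ_) (*q-vanish (d + suc u) (L (d + suc u)) (C B (d + suc u) w) M (L-< (d + suc u))
              (ℕₚ.≤-<-trans l (subst (B <_) (sym (ℕₚ.+-suc d u)) (s≤s (ℕₚ.≤-trans (ℕₚ.m≤n+m∸n B d) (ℕₚ.+-monoʳ-≤ d u≥)))))))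
            (ℚₚ.*-zeroʳ (x (suc u)))))
        (Σℚ-cong (B ∸ d) (λ u → cong₂ (λ s t → x s *ℚ term t M)
          (sym (trans (ℕₚ.+-∸-assoc 1 (ℕₚ.m≤m+n d u)) (cong suc (ℕₚ.m+n∸m≡n d u)))) (ℕₚ.+-suc d u))))))
    where
    term : ℕ → ℚ⟦q⟧
    term t = L t *q C B t w

  q^-*-ev : ∀ c j x (f : ℚ⟦q⟧) → ∑q (suc B) (λ u → x u · ((q^ ((suc c + u) * suc j)) *q f)) ≈ (q^ (suc c * suc j)) *q (ev B x (suc j) *q f)
  q^-*-ev c j x f = ≈-sym (begin
    Q *q (ev B x (suc j) *q f)
      ≈⟨ *-congˡ {Q} (∑q-*ʳ (suc B) (λ u → x u · (q^ (u * suc j))) f) ⟩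
    Q *q ∑q (suc B) (λ u → (x u · (q^ (u * suc j))) *q f)
      ≈⟨ ∑q-*ˡ (suc B) (λ u → (x u · (q^ (u * suc j))) *q f) Q ⟩
    ∑q (suc B) (λ u → Q *q ((x u · (q^ (u * suc j))) *q f))
      ≈⟨ ∑q-cong (suc B) (λ u → ≗⇒≈ λ M → trans (*q-congˡ {Q} (*q-·ˡ (x u) (q^ (u * suc j)) f) M)
           (trans (*q-·ʳ (x u) Q ((q^ (u * suc j)) *q f) M) (cong (x u *ℚ_) (trans (sym (*q-assoc Q (q^ (u * suc j)) f M))
             (*q-cong {Q *q (q^ (u * suc j))} {q^ ((suc c + u) * suc j)} {f} (λ N → trans (sym (q^-+ (suc c * suc j) (u * suc j) N))
               (cong (λ t → (q^ t) N) (sym (ℕₚ.*-distribʳ-+ (suc j) (suc c) u)))) (λ _ → refl) M))))) ⟩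
    ∑q (suc B) (λ u → x u · ((q^ ((suc c + u) * suc j)) *q f)) ∎)
    where Q = q^ (suc c * suc j)

  -- The geometric series of the first index d is kept open as ∑ q^(dN). With d + u as the next
  -- index, q^((d+u)N) = q^(dN) q^(uN): the second factor sums up to x(q^N), and Abel summation
  -- turns the remaining `L d` into a new, larger N.
  conjugate : ∀ c w → L (suc c) *q C B (suc c) w ≈ ∑q B (λ j → (q^ (suc c * suc j)) *q P B j w)
  conjugate c [] = begin
    L (suc c) *q 1q
      ≈⟨ *-identityʳ (L (suc c)) ⟩
    L (suc c)
      ≈⟨ geometric c B ⟩
    ∑q B (λ j → q^ (suc c * suc j)) ⊕ ((q^ (suc c * B)) *q L (suc c))
      ≈⟨ +-congˡ {∑q B (λ j → q^ (suc c * suc j))} (≈-trans (≈-sym (*-identityʳ ((q^ (suc c * B)) *q L (suc c)))) (tail-vanishes c 1q)) ⟩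
    ∑q B (λ j → q^ (suc c * suc j)) ⊕ 𝟘
      ≈⟨ ≗⇒≈ (λ M → ℚₚ.+-identityʳ _) ⟩
    ∑q B (λ j → q^ (suc c * suc j))
      ≈⟨ ∑q-cong B (λ j → *-identityʳ (q^ (suc c * suc j))) ⟨
    ∑q B (λ j → (q^ (suc c * suc j)) *q 1q) ∎
    where open CommutativeRing ring using (*-identityʳ)
  conjugate c (x ∷ w) = begin
    L (suc c) *q C B (suc c) (x ∷ w)
      ≈⟨ *-congˡ {L (suc c)} (C-shift (suc c) x w) ⟩
    L (suc c) *q ∑q (suc B) (λ u → x u · (L (suc c + u) *q C B (suc c + u) w))
      ≈⟨ *-congˡ {L (suc c)} (∑q-cong (suc B) (λ u → ·-cong (x u) (conjugate (c + u) w))) ⟩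
    L (suc c) *q ∑q (suc B) (λ u → x u · ∑q B (λ j → (q^ ((suc c + u) * suc j)) *q P B j w))
      ≈⟨ *-congˡ {L (suc c)} (≗⇒≈ λ M → trans (Σℚ-cong (suc B) (λ u → sym (Σℚ-*ˡ B (x u) (λ j → ((q^ ((suc c + u) * suc j)) *q P B j w) M))))
           (Σℚ-swap (suc B) B (λ u j → x u *ℚ ((q^ ((suc c + u) * suc j)) *q P B j w) M))) ⟩
    L (suc c) *q ∑q B (λ j → ∑q (suc B) (λ u → x u · ((q^ ((suc c + u) * suc j)) *q P B j w)))
      ≈⟨ *-congˡ {L (suc c)} (∑q-cong B (λ j → q^-*-ev c j x (P B j w))) ⟩
    L (suc c) *q ∑q B (λ j → (q^ (suc c * suc j)) *q (ev B x (suc j) *q P B j w))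
      ≈⟨ telescope-B c (λ j → ev B x (suc j) *q P B j w) ⟩
    ∑q B (λ j → (q^ (suc c * suc j)) *q P B j (x ∷ w)) ∎

  -- The first index is positive, whereas x(q^N) includes the term u = 0; hence the condition on
  -- `x 0`.
  conjugate₀ : ∀ x w → x 0 ≡ 0ℚ → Words.∑> B 0 (λ d → x d · (L d *q C B d w)) ≈ P B B (x ∷ w)
  conjugate₀ x w x0 = begin
    ∑q B (λ k → x (suc k) · (L (suc k) *q C B (suc k) w))
      ≈⟨ ∑q-cong B (λ k → ·-cong (x (suc k)) (conjugate k w)) ⟩
    ∑q B (λ k → x (suc k) · ∑q B (λ j → (q^ (suc k * suc j)) *q P B j w))
      ≈⟨ ≗⇒≈ (λ M → trans (Σℚ-cong B (λ k → sym (Σℚ-*ˡ B (x (suc k)) (λ j → ((q^ (suc k * suc j)) *q P B j w) M))))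
           (Σℚ-swap B B (λ k j → x (suc k) *ℚ ((q^ (suc k * suc j)) *q P B j w) M))) ⟩
    ∑q B (λ j → ∑q B (λ k → x (suc k) · ((q^ (suc k * suc j)) *q P B j w)))
      ≈⟨ ∑q-cong B (λ j → ≗⇒≈ λ M → trans (Σℚ-cong B (λ k → sym (*q-·ˡ (x (suc k)) (q^ (suc k * suc j)) (P B j w) M)))
           (trans (sym (*q-Σˡ B (λ k → x (suc k) · (q^ (suc k * suc j))) (P B j w) M))
             (*q-cong {∑q B (λ k → x (suc k) · (q^ (suc k * suc j)))} {ev B x (suc j)} {P B j w} (λ N → sym (drop-0 j N)) (λ _ → refl) M))) ⟩
    P B B (x ∷ w) ∎
    where
    drop-0 : ∀ j → ev B x (suc j) ≗ ∑q B (λ k → x (suc k) · (q^ (suc k * suc j)))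
    drop-0 j N = trans (Σℚ-head B (λ u → x u *ℚ (q^ (u * suc j)) N))
      (trans (cong (_+ℚ ∑q B (λ k → x (suc k) · (q^ (suc k * suc j))) N) (trans (cong (_*ℚ (q^ 0) N) x0) (ℚₚ.*-zeroˡ ((q^ 0) N)))) (ℚₚ.+-identityˡ _))

-- The quasi-shuffle product and the derivation

-- A letter x(u) is stored as the series ∑ x(u) q^u, so that the product of two letters at the same
-- N is `*q`.
X̂ : ℕ → ℚ⟦q⟧
X̂ k u = pw k (fromℕ u)

-- Letters for the exponent 0, at the head of a word and further down.
ẑ ζ : ℚ⟦q⟧
ẑ zero    = 0ℚ
ẑ (suc u) = 1ℚ
ζ zero    = 1/1+ 1
ζ (suc u) = 1ℚ

gap≡X̂ : ∀ k d l → gap k d (suc (d + l)) ≡ X̂ k (suc (d + l) ∸ d)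
gap≡X̂ k d l = cong (pw k) (trans (cong (_-ℚ fromℕ d) (trans (cong fromℕ (sym (ℕₚ.+-suc d l))) (fromℕ-+ d (suc l))))
  (trans (solve 2 (λ a b → (a :+ b) :- a := b) refl (fromℕ d) (fromℕ (suc l)))
    (cong fromℕ (sym (trans (cong (_∸ d) (sym (ℕₚ.+-suc d l))) (ℕₚ.m+n∸m≡n d (suc l)))))))

suc∸ : ∀ d l → suc (d + l) ∸ d ≡ suc l
suc∸ d l = trans (cong (_∸ d) (sym (ℕₚ.+-suc d l))) (ℕₚ.m+n∸m≡n d (suc l))

module _ (B : ℕ) where
  open Words B

  Matches : ℕ → List ℕ → List ℚ⟦q⟧ → Set
  Matches i w w′ = ∀ d → K d i (map gap w) ≗ C B d w′

  tail-matches : ∀ k (y : ℚ⟦q⟧) → (∀ u → y (suc u) ≡ X̂ k (suc u)) → ∀ {w w′} → Matches 1 w w′ → ∀ d →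
    ∑> d (λ d′ → gap k d d′ · (L d′ *q K d′ 1 (map gap w))) ≗ ∑> d (λ d′ → y (d′ ∸ d) · (L d′ *q C B d′ w′))
  tail-matches k y e {w} {w′} m d M = Σℚ-cong (B ∸ d) (λ l → cong₂ _*ℚ_
    (trans (gap≡X̂ k d l) (trans (cong (X̂ k) (suc∸ d l)) (trans (sym (e l)) (cong y (sym (suc∸ d l))))))
    (*q-congˡ {L (suc (d + l))} (m (suc (d + l))) M))

  -- A positive exponent gives the gap 0 the weight 0, so this index never joins the previous block,
  -- whatever its size `i`.
  matches-positive : ∀ k i {w w′} → Matches 1 w w′ → Matches i (suc k ∷ w) (X̂ (suc k) ∷ w′)
  matches-positive k i {w} {w′} m d M = cong₂ _+ℚ_
    (trans (trans (cong (λ t → (t *ℚ (1/1+ i)) *ℚ (L d *q K d (suc i) (map gap w)) M) (trans (gap-self B (suc k) d) (pw-suc-0 k)))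
        (trans (cong (_*ℚ (L d *q K d (suc i) (map gap w)) M) (ℚₚ.*-zeroˡ (1/1+ i))) (ℚₚ.*-zeroˡ ((L d *q K d (suc i) (map gap w)) M))))
      (sym (trans (cong (_*ℚ (L d *q C B d w′) M) (pw-suc-0 k)) (ℚₚ.*-zeroˡ ((L d *q C B d w′) M)))))
    (tail-matches (suc k) (X̂ (suc k)) (λ _ → refl) {w} {w′} m d M)

  matches-all-positive : ∀ i js → Matches i (map suc js) (map (X̂ ∘ suc) js)
  matches-all-positive i []       d M = refl
  matches-all-positive i (j ∷ js) = matches-positive j i {map suc js} {map (X̂ ∘ suc) js} (matches-all-positive 1 js)

  -- A gap 0 makes a block of size 2, whose weight 1/2 is the constant term of `ζ`. The exponents
  -- that follow are positive, so the block cannot grow further.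
  matches-zero : ∀ js → Matches 1 (0 ∷ map suc js) (ζ ∷ map (X̂ ∘ suc) js)
  matches-zero js d M = cong₂ _+ℚ_
    (cong₂ _*ℚ_ (ℚₚ.*-identityˡ (1/1+ 1)) (*q-congˡ {L d} (matches-all-positive 2 js d) M))
    (tail-matches 0 ζ (λ _ → refl) {map suc js} {map (X̂ ∘ suc) js} (matches-all-positive 1 js) d M)

  open Truncated B

  -- The first gap is at least 1, so the value of the letter at 0 is free; it is set to 0, as
  -- conjugation requires.
  gapK-head : ∀ k y → (∀ u → y (suc u) ≡ X̂ k (suc u)) → y 0 ≡ 0ℚ → ∀ {w w′} → Matches 1 w w′ → gapK (k ∷ w) B ≈ P B B (y ∷ w′)
  gapK-head k y e y0 {w} {w′} m = mod λ M l → trans (K≗F B (map gap (k ∷ w)) M)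
    (trans (tail-matches k y e {w} {w′} m 0 M) (at (Conjugation.conjugate₀ B y w′ y0) M l))

module _ {A : Set} where

  -- Functional form as for `sh`; in the third summand the two leading indices coincide and their
  -- letters multiply.
  qsh : (List ℚ⟦q⟧ → A → ℚ) → List ℚ⟦q⟧ → List ℚ⟦q⟧ → A → ℚ
  qsh φ []      v       = φ v
  qsh φ (x ∷ u) []      = φ (x ∷ u)
  qsh φ (x ∷ u) (y ∷ v) = (qsh (φ ∘ (x ∷_)) u (y ∷ v) ⊕ qsh (φ ∘ (y ∷_)) (x ∷ u) v) ⊕ qsh (φ ∘ (x *q y ∷_)) u v

  -- The derivation 𝕕 on words; x(q^N) becomes N (𝕕 x)(q^N), and N - 1 counts
  -- the summation indices below N, that is, the quasi-shuffles with the letter 1.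
  deriv : (List ℚ⟦q⟧ → A → ℚ) → List ℚ⟦q⟧ → A → ℚ
  deriv φ []      = 𝟘
  deriv φ (x ∷ w) = (φ (𝕕 x ∷ w) ⊕ qsh (φ ∘ (𝕕 x ∷_)) (1q ∷ []) w) ⊕ deriv (φ ∘ (x ∷_)) w

private
  shuffle-sum : ∀ a b c d e f → ((a +ℚ b) +ℚ (c +ℚ d)) +ℚ (e +ℚ f) ≡ ((a +ℚ c) +ℚ e) +ℚ ((b +ℚ d) +ℚ f)
  shuffle-sum = solve 6 (λ a b c d e f → ((a :+ b) :+ (c :+ d)) :+ (e :+ f) := ((a :+ c) :+ e) :+ ((b :+ d) :+ f)) refl

qsh-⊕ : ∀ {A : Set} (φ ψ : List ℚ⟦q⟧ → A → ℚ) u v → qsh (λ w → φ w ⊕ ψ w) u v ≗ qsh φ u v ⊕ qsh ψ u v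
qsh-⊕ φ ψ []      v       a = refl
qsh-⊕ φ ψ (x ∷ u) []      a = refl
qsh-⊕ φ ψ (x ∷ u) (y ∷ v) a = trans
  (cong₂ _+ℚ_ (cong₂ _+ℚ_ (qsh-⊕ (φ ∘ (x ∷_)) (ψ ∘ (x ∷_)) u (y ∷ v) a) (qsh-⊕ (φ ∘ (y ∷_)) (ψ ∘ (y ∷_)) (x ∷ u) v a))
    (qsh-⊕ (φ ∘ (x *q y ∷_)) (ψ ∘ (x *q y ∷_)) u v a))
  (shuffle-sum (qsh (φ ∘ (x ∷_)) u (y ∷ v) a) (qsh (ψ ∘ (x ∷_)) u (y ∷ v) a) (qsh (φ ∘ (y ∷_)) (x ∷ u) v a)
    (qsh (ψ ∘ (y ∷_)) (x ∷ u) v a) (qsh (φ ∘ (x *q y ∷_)) u v a) (qsh (ψ ∘ (x *q y ∷_)) u v a))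

qsh-*q : ∀ f (φ : List ℚ⟦q⟧ → ℚ⟦q⟧) u v → qsh (λ w → f *q φ w) u v ≗ f *q qsh φ u v
qsh-*q f φ []      v       M = refl
qsh-*q f φ (x ∷ u) []      M = refl
qsh-*q f φ (x ∷ u) (y ∷ v) M = trans
  (cong₂ _+ℚ_ (cong₂ _+ℚ_ (qsh-*q f (φ ∘ (x ∷_)) u (y ∷ v) M) (qsh-*q f (φ ∘ (y ∷_)) (x ∷ u) v M)) (qsh-*q f (φ ∘ (x *q y ∷_)) u v M))
  (sym (trans (*q-distribˡ f (qsh (φ ∘ (x ∷_)) u (y ∷ v) ⊕ qsh (φ ∘ (y ∷_)) (x ∷ u) v) (qsh (φ ∘ (x *q y ∷_)) u v) M)
    (cong (_+ℚ (f *q qsh (φ ∘ (x *q y ∷_)) u v) M) (*q-distribˡ f (qsh (φ ∘ (x ∷_)) u (y ∷ v)) (qsh (φ ∘ (y ∷_)) (x ∷ u) v) M))))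

qsh-𝟘 : ∀ {A : Set} u v → qsh {A} (λ _ → 𝟘) u v ≗ 𝟘
qsh-𝟘 []      v       a = refl
qsh-𝟘 (x ∷ u) []      a = refl
qsh-𝟘 (x ∷ u) (y ∷ v) a = cong₂ _+ℚ_ (cong₂ _+ℚ_ (qsh-𝟘 u (y ∷ v) a) (qsh-𝟘 (x ∷ u) v a)) (qsh-𝟘 u v a)

deriv-⊕ : ∀ {A : Set} (φ ψ : List ℚ⟦q⟧ → A → ℚ) w → deriv (λ w → φ w ⊕ ψ w) w ≗ deriv φ w ⊕ deriv ψ w
deriv-⊕ φ ψ []      a = refl
deriv-⊕ φ ψ (x ∷ w) a = trans (cong₂ _+ℚ_ (cong ((φ (𝕕 x ∷ w) a +ℚ ψ (𝕕 x ∷ w) a) +ℚ_) (qsh-⊕ (φ ∘ (𝕕 x ∷_)) (ψ ∘ (𝕕 x ∷_)) (1q ∷ []) w a))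
    (deriv-⊕ (φ ∘ (x ∷_)) (ψ ∘ (x ∷_)) w a))
  (shuffle-sum (φ (𝕕 x ∷ w) a) (ψ (𝕕 x ∷ w) a) (qsh (φ ∘ (𝕕 x ∷_)) (1q ∷ []) w a) (qsh (ψ ∘ (𝕕 x ∷_)) (1q ∷ []) w a)
    (deriv (φ ∘ (x ∷_)) w a) (deriv (ψ ∘ (x ∷_)) w a))

deriv-*q : ∀ f (φ : List ℚ⟦q⟧ → ℚ⟦q⟧) w → deriv (λ w → f *q φ w) w ≗ f *q deriv φ w
deriv-*q f φ []      M = sym (trans (*q-comm f 𝟘 M) (*q-zeroˡ f M))
deriv-*q f φ (x ∷ w) M = trans
  (cong₂ _+ℚ_ (cong ((f *q φ (𝕕 x ∷ w)) M +ℚ_) (qsh-*q f (φ ∘ (𝕕 x ∷_)) (1q ∷ []) w M)) (deriv-*q f (φ ∘ (x ∷_)) w M))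
  (sym (trans (*q-distribˡ f (φ (𝕕 x ∷ w) ⊕ qsh (φ ∘ (𝕕 x ∷_)) (1q ∷ []) w) (deriv (φ ∘ (x ∷_)) w) M)
    (cong (_+ℚ (f *q deriv (φ ∘ (x ∷_)) w) M) (*q-distribˡ f (φ (𝕕 x ∷ w)) (qsh (φ ∘ (𝕕 x ∷_)) (1q ∷ []) w) M))))

deriv-𝟘 : ∀ {A : Set} w → deriv {A} (λ _ → 𝟘) w ≗ 𝟘
deriv-𝟘 []      a = refl
deriv-𝟘 (x ∷ w) a = cong₂ _+ℚ_ (trans (ℚₚ.+-identityˡ _) (qsh-𝟘 (1q ∷ []) w a)) (deriv-𝟘 w a)

Σℚ-triangle : ∀ n (g : ℕ → ℕ → ℚ) → Σℚ (suc n) (λ U → Σℚ (suc U) (λ u → g u (U ∸ u))) ≡ Σℚ (suc n) (λ u → Σℚ (suc (n ∸ u)) (g u))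
Σℚ-triangle zero    g = refl
Σℚ-triangle (suc n) g = begin
  Σℚ (suc n) (λ U → Σℚ (suc U) (λ u → g u (U ∸ u))) +ℚ (Σℚ (suc n) (λ u → g u (suc n ∸ u)) +ℚ g (suc n) (suc n ∸ suc n))
    ≡⟨ cong (_+ℚ (Σℚ (suc n) (λ u → g u (suc n ∸ u)) +ℚ g (suc n) (n ∸ n))) (Σℚ-triangle n g) ⟩
  Σℚ (suc n) (λ u → Σℚ (suc (n ∸ u)) (g u)) +ℚ (Σℚ (suc n) (λ u → g u (suc n ∸ u)) +ℚ g (suc n) (n ∸ n))
    ≡⟨ ℚₚ.+-assoc (Σℚ (suc n) (λ u → Σℚ (suc (n ∸ u)) (g u))) (Σℚ (suc n) (λ u → g u (suc n ∸ u))) (g (suc n) (n ∸ n)) ⟨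
  (Σℚ (suc n) (λ u → Σℚ (suc (n ∸ u)) (g u)) +ℚ Σℚ (suc n) (λ u → g u (suc n ∸ u))) +ℚ g (suc n) (n ∸ n)
    ≡⟨ cong₂ _+ℚ_ (trans (sym (Σℚ-+ (suc n) (λ u → Σℚ (suc (n ∸ u)) (g u)) (λ u → g u (suc n ∸ u))))
           (Σℚ-cong< (suc n) (λ { u (s≤s l) → trans (cong (λ t → Σℚ (suc (n ∸ u)) (g u) +ℚ g u t) (ℕₚ.+-∸-assoc 1 l))
             (cong (λ t → Σℚ (suc t) (g u)) (sym (ℕₚ.+-∸-assoc 1 l))) })))
         (trans (cong (g (suc n)) (ℕₚ.n∸n≡0 n)) (sym (trans (cong (λ t → Σℚ (suc t) (g (suc n))) (ℕₚ.n∸n≡0 n)) (ℚₚ.+-identityˡ (g (suc n) 0))))) ⟩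
  Σℚ (suc (suc n)) (λ u → Σℚ (suc (suc n ∸ u)) (g u)) ∎
  where open ≡-Reasoning

module _ (B : ℕ) where
  open Truncated B

  -- The product of the truncated sums has additional terms with u + v > B; their order (u + v)N
  -- exceeds B because N ≥ 1.
  ev-* : ∀ x y j → ev B (x *q y) (suc j) ≈ ev B x (suc j) *q ev B y (suc j)
  ev-* x y j = mod λ M l → begin
    Σℚ (suc B) (λ U → (x *q y) U *ℚ (q^ (U * suc j)) M)
      ≡⟨ Σℚ-cong (suc B) (λ U → trans (cong (_*ℚ (q^ (U * suc j)) M) (*q-Σℚ x y U))
           (trans (sym (Σℚ-*ʳ (suc U) ((q^ (U * suc j)) M) (λ u → x u *ℚ y (U ∸ u))))
             (Σℚ-cong< (suc U) (λ { u (s≤s u≤U) → cong (λ t → (x u *ℚ y (U ∸ u)) *ℚ (q^ (t * suc j)) M) (sym (ℕₚ.m+[n∸m]≡n u≤U)) })))) ⟩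
    Σℚ (suc B) (λ U → Σℚ (suc U) (λ u → g M u (U ∸ u)))
      ≡⟨ Σℚ-triangle B (g M) ⟩
    Σℚ (suc B) (λ u → Σℚ (suc (B ∸ u)) (g M u))
      ≡⟨ Σℚ-cong< (suc B) (λ { u (s≤s u≤B) → sym (Σℚ-extend (suc (B ∸ u)) (suc B) (g M u) (s≤s (ℕₚ.m∸n≤m B u)) (λ v v≥ → vanish M l u v
           (ℕₚ.≤-trans (s≤s (ℕₚ.m≤n+m∸n B u)) (subst (_≤ u + v) (ℕₚ.+-suc u (B ∸ u)) (ℕₚ.+-monoʳ-≤ u v≥))))) }) ⟩
    Σℚ (suc B) (λ u → Σℚ (suc B) (g M u))
      ≡⟨ Σℚ-cong (suc B) (λ u → trans (Σℚ-cong (suc B) (λ v → product M u v))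
           (sym (*q-Σʳ (suc B) (x u · (q^ (u * suc j))) (λ v → y v · (q^ (v * suc j))) M))) ⟩
    Σℚ (suc B) (λ u → ((x u · (q^ (u * suc j))) *q ev B y (suc j)) M)
      ≡⟨ *q-Σˡ (suc B) (λ u → x u · (q^ (u * suc j))) (ev B y (suc j)) M ⟨
    (ev B x (suc j) *q ev B y (suc j)) M ∎
    where
    open ≡-Reasoning
    g : ℕ → ℕ → ℕ → ℚ
    g M u v = (x u *ℚ y v) *ℚ (q^ ((u + v) * suc j)) M
    vanish : ∀ M → M ≤ B → ∀ u v → B < u + v → g M u v ≡ 0ℚ
    vanish M l u v B<u+v = trans (cong ((x u *ℚ y v) *ℚ_) (q^-< ((u + v) * suc j) M
      (ℕₚ.≤-<-trans l (ℕₚ.<-≤-trans B<u+v (ℕₚ.m≤m*n (u + v) (suc j)))))) (ℚₚ.*-zeroʳ (x u *ℚ y v))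
    product : ∀ M u v → g M u v ≡ ((x u · (q^ (u * suc j))) *q (y v · (q^ (v * suc j)))) M
    product M u v = sym (trans (*q-·ˡ (x u) (q^ (u * suc j)) (y v · (q^ (v * suc j))) M)
      (trans (cong (x u *ℚ_) (trans (*q-·ʳ (y v) (q^ (u * suc j)) (q^ (v * suc j)) M)
          (cong (y v *ℚ_) (trans (sym (q^-+ (u * suc j) (v * suc j) M)) (cong (λ t → (q^ t) M) (sym (ℕₚ.*-distribʳ-+ (suc j) u v)))))))
        (sym (ℚₚ.*-assoc (x u) (y v) ((q^ ((u + v) * suc j)) M)))))

  open CommutativeRing ring using (setoid; +-cong; *-cong; commutativeSemiring)
    renaming (refl to ≈-refl; sym to ≈-sym; trans to ≈-trans)
  open import Algebra.Solver.Ring.NaturalCoefficients.Default commutativeSemiring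
    using () renaming (solve to solveᵣ; _:+_ to _⊞_; _:*_ to _⊠_; _:=_ to _≣_)

  private
    expand-product : ∀ p x u r y v → (p ⊕ (x *q u)) *q (r ⊕ (y *q v)) ≈ (((p *q r) ⊕ (x *q (u *q r))) ⊕ (y *q (p *q v))) ⊕ ((x *q y) *q (u *q v))
    expand-product = solveᵣ 6 (λ p x u r y v → (p ⊞ (x ⊠ u)) ⊠ (r ⊞ (y ⊠ v)) ≣ (((p ⊠ r) ⊞ (x ⊠ (u ⊠ r))) ⊞ (y ⊠ (p ⊠ v))) ⊞ ((x ⊠ y) ⊠ (u ⊠ v))) ≈-refl
    regroup : ∀ a a′ b b′ c c′ → ((a ⊕ a′) ⊕ (b ⊕ b′)) ⊕ (c ⊕ c′) ≈ (((((a ⊕ b) ⊕ c) ⊕ a′) ⊕ b′) ⊕ c′)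
    regroup = solveᵣ 6 (λ a a′ b b′ c c′ → ((a ⊞ a′) ⊞ (b ⊞ b′)) ⊞ (c ⊞ c′) ≣ (((((a ⊞ b) ⊞ c) ⊞ a′) ⊞ b′) ⊞ c′)) ≈-refl

  -- Induction on the bound: the largest admissible N is taken by neither word, by one of them, or
  -- by both, which gives the four products of the expansion.
  P-qsh : ∀ n u v → P B n u *q P B n v ≈ qsh (P B n) u v
  P-qsh n       []      v       = ≗⇒≈ (*q-identityˡ (P B n v))
  P-qsh n       (x ∷ u) []      = ≗⇒≈ λ M → trans (*q-comm (P B n (x ∷ u)) 1q M) (*q-identityˡ (P B n (x ∷ u)) M)
  P-qsh zero    (x ∷ u) (y ∷ v) = ≗⇒≈ λ M → trans (*q-zeroˡ 𝟘 M)
    (sym (cong₂ _+ℚ_ (cong₂ _+ℚ_ (qsh-𝟘 u (y ∷ v) M) (qsh-𝟘 (x ∷ u) v M)) (qsh-𝟘 u v M)))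
  P-qsh (suc n) (x ∷ u) (y ∷ v) = begin
    (P B n (x ∷ u) ⊕ (ex *q P B n u)) *q (P B n (y ∷ v) ⊕ (ey *q P B n v))
      ≈⟨ expand-product (P B n (x ∷ u)) ex (P B n u) (P B n (y ∷ v)) ey (P B n v) ⟩
    (((P B n (x ∷ u) *q P B n (y ∷ v)) ⊕ (ex *q (P B n u *q P B n (y ∷ v)))) ⊕ (ey *q (P B n (x ∷ u) *q P B n v))) ⊕ ((ex *q ey) *q (P B n u *q P B n v))
      ≈⟨ +-cong (+-cong (+-cong (P-qsh n (x ∷ u) (y ∷ v)) (step x u (y ∷ v))) (step y (x ∷ u) v))
           (≈-trans (*-cong (≈-sym (ev-* x y n)) (≈-refl {P B n u *q P B n v})) (step (x *q y) u v)) ⟩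
    ((qsh (P B n) (x ∷ u) (y ∷ v) ⊕ qsh (λ w → ex *q P B n w) u (y ∷ v)) ⊕ qsh (λ w → ey *q P B n w) (x ∷ u) v) ⊕ qsh (λ w → ev B (x *q y) (suc n) *q P B n w) u v
      ≈⟨ regroup (qsh (P B n ∘ (x ∷_)) u (y ∷ v)) (qsh (λ w → ex *q P B n w) u (y ∷ v)) (qsh (P B n ∘ (y ∷_)) (x ∷ u) v)
           (qsh (λ w → ey *q P B n w) (x ∷ u) v) (qsh (P B n ∘ (x *q y ∷_)) u v) (qsh (λ w → ev B (x *q y) (suc n) *q P B n w) u v) ⟨
    ((qsh (P B n ∘ (x ∷_)) u (y ∷ v) ⊕ qsh (λ w → ex *q P B n w) u (y ∷ v)) ⊕ (qsh (P B n ∘ (y ∷_)) (x ∷ u) v ⊕ qsh (λ w → ey *q P B n w) (x ∷ u) v))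
      ⊕ (qsh (P B n ∘ (x *q y ∷_)) u v ⊕ qsh (λ w → ev B (x *q y) (suc n) *q P B n w) u v)
      ≈⟨ ≗⇒≈ (λ M → cong₂ _+ℚ_ (cong₂ _+ℚ_ (qsh-⊕ (P B n ∘ (x ∷_)) (λ w → ex *q P B n w) u (y ∷ v) M)
             (qsh-⊕ (P B n ∘ (y ∷_)) (λ w → ey *q P B n w) (x ∷ u) v M)) (qsh-⊕ (P B n ∘ (x *q y ∷_)) (λ w → ev B (x *q y) (suc n) *q P B n w) u v M)) ⟨
    qsh (P B (suc n)) (x ∷ u) (y ∷ v) ∎
    where
    open import Relation.Binary.Reasoning.Setoid setoid
    ex = ev B x (suc n)
    ey = ev B y (suc n)
    step : ∀ x u v → ev B x (suc n) *q (P B n u *q P B n v) ≈ qsh (λ w → ev B x (suc n) *q P B n w) u v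
    step x u v = ≈-trans (*-cong (≈-refl {ev B x (suc n)}) (P-qsh n u v)) (≈-sym (≗⇒≈ (qsh-*q (ev B x (suc n)) (P B n) u v)))

  ev-1q : ∀ j → ev B 1q (suc j) ≗ 1q
  ev-1q j M = trans (Σℚ-head B (λ u → 1q u *ℚ (q^ (u * suc j)) M)) (trans (cong₂ _+ℚ_ (trans (ℚₚ.*-identityˡ _) (q^0 M))
    (Σℚ-vanish B _ (λ u _ → ℚₚ.*-zeroˡ ((q^ (suc u * suc j)) M)))) (ℚₚ.+-identityʳ (1q M)))

  P-1q : ∀ n → P B n (1q ∷ []) ≗ fromℕ n · 1q
  P-1q zero    M = sym (ℚₚ.*-zeroˡ (1q M))
  P-1q (suc n) M = trans (cong₂ _+ℚ_ (P-1q n M) (trans (*q-cong {ev B 1q (suc n)} {1q} {1q} (ev-1q n) (λ _ → refl) M) (*q-identityˡ 1q M)))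
    (trans (solve 2 (λ a b → a :* b :+ b := (con 1ℚ :+ a) :* b) refl (fromℕ n) (1q M)) (cong (_*ℚ 1q M) (sym (fromℕ-suc n))))

  𝕕-ev : ∀ x N → 𝕕 (ev B x N) ≗ fromℕ N · ev B (𝕕 x) N
  𝕕-ev x N M = trans (sym (Σℚ-*ˡ (suc B) (fromℕ M) (λ u → x u *ℚ (q^ (u * N)) M))) (trans (Σℚ-cong (suc B) (λ u →
      trans (*ℚ-left-comm (fromℕ M) (x u) ((q^ (u * N)) M))
      (trans (cong (x u *ℚ_) (trans (cong (fromℕ M *ℚ_) (sym (ℚₚ.*-identityʳ ((q^ (u * N)) M))))
          (trans ([≟]-cancel M (u * N) 1ℚ) (cong₂ _*ℚ_ (fromℕ-* u N) (ℚₚ.*-identityʳ ((q^ (u * N)) M))))))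
        (solve 4 (λ x u n q → x :* ((u :* n) :* q) := n :* ((u :* x) :* q)) refl (x u) (fromℕ u) (fromℕ N) ((q^ (u * N)) M)))))
    (Σℚ-*ˡ (suc B) (fromℕ N) (λ u → 𝕕 x u *ℚ (q^ (u * N)) M)))

  -- n P_n(w) = P_n(1) P_n(w).
  suc·P : ∀ n w → fromℕ (suc n) · P B n w ≈ P B n w ⊕ qsh (P B n) (1q ∷ []) w
  suc·P n w = ≈-trans (≗⇒≈ λ M → trans (cong (_*ℚ P B n w M) (fromℕ-suc n)) (trans (ℚₚ.*-distribʳ-+ (P B n w M) 1ℚ (fromℕ n))
      (cong₂ _+ℚ_ (ℚₚ.*-identityˡ (P B n w M)) (sym (trans (*q-cong {P B n (1q ∷ [])} {fromℕ n · 1q} {P B n w} (P-1q n) (λ _ → refl) M)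
        (trans (*q-·ˡ (fromℕ n) 1q (P B n w) M) (cong (fromℕ n *ℚ_) (*q-identityˡ (P B n w) M))))))))
    (+-cong (≈-refl {P B n w}) (P-qsh n (1q ∷ []) w))

  𝕕-P : ∀ n w → 𝕕 (P B n w) ≈ deriv (P B n) w
  𝕕-P n [] = ≗⇒≈ λ { zero → ℚₚ.*-zeroˡ 1ℚ ; (suc M) → ℚₚ.*-zeroʳ (fromℕ (suc M)) }
  𝕕-P zero (x ∷ w) = ≗⇒≈ λ M → trans (ℚₚ.*-zeroʳ (fromℕ M))
    (sym (cong₂ _+ℚ_ (trans (ℚₚ.+-identityˡ _) (qsh-𝟘 (1q ∷ []) w M)) (deriv-𝟘 w M)))
  𝕕-P (suc n) (x ∷ w) = begin
    𝕕 (P B n (x ∷ w) ⊕ (ex *q P B n w))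
      ≈⟨ ≗⇒≈ (λ M → trans (ℚₚ.*-distribˡ-+ (fromℕ M) (P B n (x ∷ w) M) ((ex *q P B n w) M)) (cong (𝕕 (P B n (x ∷ w)) M +ℚ_) (𝕕-*q ex (P B n w) M))) ⟩
    𝕕 (P B n (x ∷ w)) ⊕ ((𝕕 ex *q P B n w) ⊕ (ex *q 𝕕 (P B n w)))
      ≈⟨ +-cong (𝕕-P n (x ∷ w)) (+-cong derivative-of-letter
           (≈-trans (*-cong (≈-refl {ex}) (𝕕-P n w)) (≈-sym (≗⇒≈ (deriv-*q ex (P B n) w))))) ⟩
    ((P B n (𝕕 x ∷ w) ⊕ qsh (P B n ∘ (𝕕 x ∷_)) (1q ∷ []) w) ⊕ deriv (P B n ∘ (x ∷_)) w)
      ⊕ (((e′ *q P B n w) ⊕ qsh (λ v → e′ *q P B n v) (1q ∷ []) w) ⊕ deriv (λ v → ex *q P B n v) w)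
      ≈⟨ interleave (P B n (𝕕 x ∷ w)) (e′ *q P B n w) (qsh (P B n ∘ (𝕕 x ∷_)) (1q ∷ []) w) (qsh (λ v → e′ *q P B n v) (1q ∷ []) w)
           (deriv (P B n ∘ (x ∷_)) w) (deriv (λ v → ex *q P B n v) w) ⟨
    ((P B n (𝕕 x ∷ w) ⊕ (e′ *q P B n w)) ⊕ (qsh (P B n ∘ (𝕕 x ∷_)) (1q ∷ []) w ⊕ qsh (λ v → e′ *q P B n v) (1q ∷ []) w))
      ⊕ (deriv (P B n ∘ (x ∷_)) w ⊕ deriv (λ v → ex *q P B n v) w)
      ≈⟨ ≗⇒≈ (λ M → cong₂ _+ℚ_ (cong (P B (suc n) (𝕕 x ∷ w) M +ℚ_) (qsh-⊕ (P B n ∘ (𝕕 x ∷_)) (λ v → e′ *q P B n v) (1q ∷ []) w M))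
           (deriv-⊕ (P B n ∘ (x ∷_)) (λ v → ex *q P B n v) w M)) ⟨
    deriv (P B (suc n)) (x ∷ w) ∎
    where
    open import Relation.Binary.Reasoning.Setoid setoid
    ex = ev B x (suc n)
    e′ = ev B (𝕕 x) (suc n)
    interleave : ∀ a b c d e f → ((a ⊕ b) ⊕ (c ⊕ d)) ⊕ (e ⊕ f) ≈ ((a ⊕ c) ⊕ e) ⊕ ((b ⊕ d) ⊕ f)
    interleave a b c d e f = ≗⇒≈ λ M → shuffle-sum (a M) (b M) (c M) (d M) (e M) (f M)
    derivative-of-letter : 𝕕 ex *q P B n w ≈ (e′ *q P B n w) ⊕ qsh (λ v → e′ *q P B n v) (1q ∷ []) w
    derivative-of-letter = begin
      𝕕 ex *q P B n w
        ≈⟨ ≗⇒≈ (λ M → trans (*q-cong {𝕕 ex} {fromℕ (suc n) · e′} {P B n w} (𝕕-ev x (suc n)) (λ _ → refl) M)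
             (trans (*q-·ˡ (fromℕ (suc n)) e′ (P B n w) M) (sym (*q-·ʳ (fromℕ (suc n)) e′ (P B n w) M)))) ⟩
      e′ *q (fromℕ (suc n) · P B n w)
        ≈⟨ *-cong (≈-refl {e′}) (suc·P n w) ⟩
      e′ *q (P B n w ⊕ qsh (P B n) (1q ∷ []) w)
        ≈⟨ ≗⇒≈ (*q-distribˡ e′ (P B n w) (qsh (P B n) (1q ∷ []) w)) ⟩
      (e′ *q P B n w) ⊕ (e′ *q qsh (P B n) (1q ∷ []) w)
        ≈⟨ +-cong (≈-refl {e′ *q P B n w}) (≗⇒≈ (qsh-*q e′ (P B n) (1q ∷ []) w)) ⟨
      (e′ *q P B n w) ⊕ qsh (λ v → e′ *q P B n v) (1q ∷ []) w ∎

-- Derivatives in depths two and three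

𝕕-linear : Linear 𝕕
𝕕-linear = record
  { T-cong = λ e N → cong (fromℕ N *ℚ_) (e N)
  ; T-⊕ = λ f g N → ℚₚ.*-distribˡ-+ (fromℕ N) (f N) (g N)
  ; T-· = λ c f N → *ℚ-left-comm (fromℕ N) c (f N) }

-- The powers (1 - q)^{-k-1} span the same space as the X̂ k, and are closed under products.
geo : ℕ → ℚ⟦q⟧
geo zero    = X̂ 0
geo (suc k) = X̂ 0 *q geo k

geo-* : ∀ i j → geo i *q geo j ≗ geo (suc (i + j))
geo-* zero    j N = refl
geo-* (suc i) j N = trans (*q-assoc (X̂ 0) (geo i) (geo j) N) (*q-congˡ {X̂ 0} (geo-* i j) N)

geo-1 : ∀ N → geo 1 N ≡ fromℕ (suc N)
geo-1 N = trans (*q-Σℚ (X̂ 0) (X̂ 0) N) (go (suc N))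
  where
  go : ∀ n → Σℚ n (λ _ → 1ℚ) ≡ fromℕ n
  go zero    = refl
  go (suc n) = trans (cong (_+ℚ 1ℚ) (go n)) (trans (ℚₚ.+-comm (fromℕ n) 1ℚ) (sym (fromℕ-suc n)))

-- The series y = 1/(1-q) satisfies 𝕕 y = y² - y, and the Leibniz rule extends this to its powers.
𝕕-geo : ∀ k → 𝕕 (geo k) ≗ fromℕ (suc k) · (geo (suc k) ⊖ geo k)
𝕕-geo zero    N = trans (ℚₚ.*-identityʳ (fromℕ N)) (sym (trans (ℚₚ.*-identityˡ _) (trans (cong (_-ℚ 1ℚ) (trans (geo-1 N) (fromℕ-suc N)))
  (solve 1 (λ n → (con 1ℚ :+ n) :- con 1ℚ := n) refl (fromℕ N)))))
𝕕-geo (suc k) N = begin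
  𝕕 (X̂ 0 *q geo k) N
    ≡⟨ 𝕕-*q (X̂ 0) (geo k) N ⟩
  (𝕕 (X̂ 0) *q geo k) N +ℚ (X̂ 0 *q 𝕕 (geo k)) N
    ≡⟨ cong₂ _+ℚ_
         (trans (*q-cong {𝕕 (geo 0)} {geo 1 ⊖ geo 0} {geo k} (λ M → trans (𝕕-geo 0 M) (ℚₚ.*-identityˡ (geo 1 M -ℚ geo 0 M))) (λ _ → refl) N)
           (trans (sub-*q (geo 1) (geo 0) (geo k) N) (cong (_-ℚ geo (suc k) N) (*q-assoc (X̂ 0) (X̂ 0) (geo k) N))))
         (trans (*q-congˡ {X̂ 0} (𝕕-geo k) N) (trans (*q-·ʳ (fromℕ (suc k)) (X̂ 0) (geo (suc k) ⊖ geo k) N)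
           (cong (fromℕ (suc k) *ℚ_) (trans (*q-comm (X̂ 0) (geo (suc k) ⊖ geo k) N) (trans (sub-*q (geo (suc k)) (geo k) (X̂ 0) N)
             (cong₂ _-ℚ_ (*q-comm (geo (suc k)) (X̂ 0) N) (*q-comm (geo k) (X̂ 0) N))))))) ⟩
  (geo (suc (suc k)) N -ℚ geo (suc k) N) +ℚ fromℕ (suc k) *ℚ (geo (suc (suc k)) N -ℚ geo (suc k) N)
    ≡⟨ solve 2 (λ d k → d :+ k :* d := (con 1ℚ :+ k) :* d) refl (geo (suc (suc k)) N -ℚ geo (suc k) N) (fromℕ (suc k)) ⟩
  (1ℚ +ℚ fromℕ (suc k)) *ℚ (geo (suc (suc k)) N -ℚ geo (suc k) N)
    ≡⟨ cong (_*ℚ (geo (suc (suc k)) N -ℚ geo (suc k) N)) (fromℕ-suc (suc k)) ⟨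
  fromℕ (suc (suc k)) *ℚ (geo (suc (suc k)) N -ℚ geo (suc k) N) ∎
  where
  open ≡-Reasoning
  sub-*q : ∀ f g h → (f ⊖ g) *q h ≗ (f *q h) ⊖ (g *q h)
  sub-*q f g h N = trans (*q-cong {f ⊖ g} {f ⊕ ((-ℚ 1ℚ) · g)} {h} (λ M → solve 2 (λ x y → x :- y := x :+ con (-ℚ 1ℚ) :* y) refl (f M) (g M)) (λ _ → refl) N)
    (trans (*q-distribʳ f ((-ℚ 1ℚ) · g) h N) (trans (cong ((f *q h) N +ℚ_) (*q-·ˡ (-ℚ 1ℚ) g h N))
      (solve 2 (λ x y → x :+ con (-ℚ 1ℚ) :* y := x :- y) refl ((f *q h) N) ((g *q h) N))))

𝕕-X̂ : ∀ k → 𝕕 (X̂ k) ≗ fromℕ (suc k) · X̂ (suc k)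
𝕕-X̂ k u = *ℚ-pw k (fromℕ u)

-- Both families start at `X̂ 0`, and `𝕕` leads from one member to the next up to lower terms and
-- nonzero factors.
X̂-in-geo : ∀ k → Span geo (X̂ k)
X̂-in-geo zero    = span-basis 0
X̂-in-geo (suc k) = span-· (1/1+ k) (span-map 𝕕-linear (λ i → span-≗ (λ N → sym (𝕕-geo i N))
  (span-· (fromℕ (suc i)) (span-⊖ (span-basis {b = geo} (suc i)) (span-basis {b = geo} i)))) (X̂-in-geo k))

geo-in-X̂ : ∀ k → Span X̂ (geo k)
geo-in-X̂ zero    = span-basis 0
geo-in-X̂ (suc k) = span-≗ (λ N → trans (cong (λ t → (1/1+ k) *ℚ t +ℚ geo k N) (𝕕-geo k N))
    (trans (cong (_+ℚ geo k N) (1/1+-cancel k (geo (suc k) N -ℚ geo k N)))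
      (solve 2 (λ x y → (x :- y) :+ y := x) refl (geo (suc k) N) (geo k N))))
  (span-⊕ (span-· (1/1+ k) (span-map 𝕕-linear (λ i → span-≗ (λ N → sym (𝕕-X̂ i N)) (span-· (fromℕ (suc i)) (span-basis {b = X̂} (suc i)))) (geo-in-X̂ k)))
    (geo-in-X̂ k))

polynomial-* : ∀ {f g} → Span X̂ f → Span X̂ g → Span X̂ (f *q g)
polynomial-* {f} {g} p r = span-bind geo-in-X̂ (span-map (*q-linearˡ g) {b′ = geo} (λ i → span-map (*q-linearʳ (geo i)) {b′ = geo}
  (λ j → span-≗ (λ N → sym (geo-* i j N)) (span-basis {b = geo} (suc (i + j)))) (span-bind X̂-in-geo r)) (span-bind X̂-in-geo p))

-- Polynomials without constant term.
Pos : ℚ⟦q⟧ → Set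
Pos = Span (X̂ ∘ suc)

pos-polynomial : ∀ {x} → Pos x → Span X̂ x
pos-polynomial = span-bind (λ j → span-basis {b = X̂} (suc j))

pos-0 : ∀ {x} → Pos x → x 0 ≡ 0ℚ
pos-0 (ts , e) = trans (e 0) (trans (∑-cong ts (λ t → trans (cong (proj₁ t *ℚ_) (pw-suc-0 (proj₂ t))) (ℚₚ.*-zeroʳ (proj₁ t)))) (∑-0 ts))

-- All `X̂ k` with k > 0 vanish at 0, so the value at 0 is the coefficient of `X̂ 0`.
polynomial-pos : ∀ {f} → Span X̂ f → f 0 ≡ 0ℚ → Pos f
polynomial-pos {f} (ts , e) f0 = span-≗ (λ N → sym (trans (f≗ N) (trans (cong (λ t → t *ℚ 1ℚ +ℚ p N) c≡0)
    (ℚₚ.+-identityˡ (p N))))) (proj₁ (proj₂ (proj₂ (decompose ts))))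
  where
  decompose : ∀ ts → Σ ℚ (λ c → Σ ℚ⟦q⟧ (λ p → Pos p × ∑ₛ {ℚ × ℕ} ts (λ (c , i) → c · X̂ i) ≗ (c · X̂ 0) ⊕ p))
  decompose [] = 0ℚ , 𝟘 , span-𝟘 , λ _ → refl
  decompose ((a , zero) ∷ ts)  with c , p , pos-p , e ← decompose ts = a +ℚ c , p , pos-p , λ N →
    trans (cong ((a *ℚ 1ℚ) +ℚ_) (e N)) (solve 3 (λ a c p → a :* con 1ℚ :+ (c :* con 1ℚ :+ p) := (a :+ c) :* con 1ℚ :+ p) refl a c (p N))
  decompose ((a , suc j) ∷ ts) with c , p , pos-p , e ← decompose ts = c , (a · X̂ (suc j)) ⊕ p , span-⊕ (span-· a (span-basis j)) pos-p , λ N →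
    trans (cong ((a *ℚ X̂ (suc j) N) +ℚ_) (e N)) (solve 3 (λ x c p → x :+ (c :* con 1ℚ :+ p) := c :* con 1ℚ :+ (x :+ p)) refl (a *ℚ X̂ (suc j) N) c (p N))
  c = proj₁ (decompose ts)
  p = proj₁ (proj₂ (decompose ts))
  f≗ : f ≗ (c · X̂ 0) ⊕ p
  f≗ N = trans (e N) (proj₂ (proj₂ (proj₂ (decompose ts))) N)
  c≡0 : c ≡ 0ℚ
  c≡0 = trans (sym (trans (cong (c *ℚ 1ℚ +ℚ_) (pos-0 (proj₁ (proj₂ (proj₂ (decompose ts)))))) (trans (ℚₚ.+-identityʳ _) (ℚₚ.*-identityʳ c))))
    (trans (sym (f≗ 0)) f0)

pos-* : ∀ {x y} → Pos x → Pos y → Pos (x *q y)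
pos-* {x} {y} p r = polynomial-pos (polynomial-* (pos-polynomial p) (pos-polynomial r))
  (trans (*q-0 x y) (trans (cong (_*ℚ y 0) (pos-0 p)) (ℚₚ.*-zeroˡ (y 0))))

ẑ≗ : ẑ ≗ X̂ 0 ⊖ 1q
ẑ≗ zero    = refl
ẑ≗ (suc u) = refl

-- `ẑ` itself is no polynomial in u, but `ẑ = X̂ 0 - 1q` and `1q` is the unit, so the product with a
-- polynomial stays polynomial.
pos-*ẑ : ∀ {x} → Pos x → Pos (x *q ẑ)
pos-*ẑ {x} p = polynomial-pos (span-≗ (λ N → sym (trans (*q-congˡ {x} (λ M → trans (ẑ≗ M) (minus (X̂ 0 M) (1q M))) N)
    (trans (*q-distribˡ x (X̂ 0) ((-ℚ 1ℚ) · 1q) N) (trans (cong ((x *q X̂ 0) N +ℚ_) (trans (*q-·ʳ (-ℚ 1ℚ) x 1q N)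
      (cong ((-ℚ 1ℚ) *ℚ_) (trans (*q-comm x 1q N) (*q-identityˡ x N))))) (sym (minus ((x *q X̂ 0) N) (x N)))))))
    (span-⊖ (polynomial-* (pos-polynomial p) (span-basis {b = X̂} 0)) (pos-polynomial p)))
  (trans (*q-0 x ẑ) (ℚₚ.*-zeroʳ (x 0)))
  where
  minus : ∀ a b → a -ℚ b ≡ a +ℚ (-ℚ 1ℚ) *ℚ b
  minus = solve 2 (λ a b → a :- b := a :+ con (-ℚ 1ℚ) :* b) refl

pos-1q* : ∀ {x} → Pos x → Pos (1q *q x)
pos-1q* {x} = span-≗ (λ N → sym (*q-identityˡ x N))

pos-𝕕 : ∀ {x} → Pos x → Pos (𝕕 x)
pos-𝕕 = span-map 𝕕-linear (λ j → span-≗ (λ N → sym (𝕕-X̂ (suc j) N)) (span-· (fromℕ (suc (suc j))) (span-basis (suc j))))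

-- Words whose sums lie in V

Pw : List ℚ⟦q⟧ → Point → ℚ
Pw w = ⌊ (λ B → P B B w) ⌋

Multilinear : (List ℚ⟦q⟧ → Point → ℚ) → Set
Multilinear φ = ∀ u v → Linear (λ x → φ (u ++ x ∷ v))

ev-linear : ∀ B N → Linear (λ x → ev B x N)
ev-linear B N = record
  { T-cong = λ e M → Σℚ-cong (suc B) (λ u → cong (_*ℚ (q^ (u * N)) M) (e u))
  ; T-⊕ = λ x y M → trans (Σℚ-cong (suc B) (λ u → ℚₚ.*-distribʳ-+ ((q^ (u * N)) M) (x u) (y u)))
      (Σℚ-+ (suc B) (λ u → x u *ℚ (q^ (u * N)) M) (λ u → y u *ℚ (q^ (u * N)) M))
  ; T-· = λ c x M → trans (Σℚ-cong (suc B) (λ u → ℚₚ.*-assoc c (x u) ((q^ (u * N)) M))) (Σℚ-*ˡ (suc B) c (λ u → x u *ℚ (q^ (u * N)) M)) }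

P-linear : ∀ B n u v → Linear (λ x → P B n (u ++ x ∷ v))
P-linear B n []      v = ∑q-linear n (λ j → ∘-linear (*q-linearˡ (P B j v)) (ev-linear B (suc j)))
P-linear B n (y ∷ u) v = ∑q-linear n (λ j → ∘-linear (*q-linearʳ (ev B y (suc j))) (P-linear B j u v))

Pw-multilinear : Multilinear Pw
Pw-multilinear u v = record
  { T-cong = λ e (B , M , _) → Linear.T-cong (P-linear B B u v) e M
  ; T-⊕ = λ x y (B , M , _) → Linear.T-⊕ (P-linear B B u v) x y M
  ; T-· = λ c x (B , M , _) → Linear.T-· (P-linear B B u v) c x M }

V : (Point → ℚ) → Set
V = Span gapBasis

-- Quantified over all positive tails, since quasi-shuffling positive letters into a tail produces
-- further positive tails.
Good : (List ℚ⟦q⟧ → Point → ℚ) → Set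
Good φ = ∀ w → All Pos w → V (φ w)

good-by-basis : ∀ {φ} → Multilinear φ → (∀ js → V (φ (map (X̂ ∘ suc) js))) → Good φ
good-by-basis {φ} ml p []      []        = p []
good-by-basis {φ} ml p (x ∷ w) (px ∷ pw) = span-map (ml [] w) (λ j →
  good-by-basis {φ ∘ (X̂ (suc j) ∷_)} (λ u v → ml (X̂ (suc j) ∷ u) v) (λ js → p (j ∷ js)) w pw) px

good-qsh : ∀ {φ} → Good φ → ∀ u v → All Pos u → All Pos v → V (qsh φ u v)
good-qsh g []      v       pu        pv        = g v pv
good-qsh g (x ∷ u) []      pu        pv        = g (x ∷ u) pu
good-qsh g (x ∷ u) (y ∷ v) (px ∷ pu) (py ∷ pv) = span-⊕ (span-⊕
  (good-qsh (λ w pw → g (x ∷ w) (px ∷ pw)) u (y ∷ v) pu (py ∷ pv))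
  (good-qsh (λ w pw → g (y ∷ w) (py ∷ pw)) (x ∷ u) v (px ∷ pu) pv))
  (good-qsh (λ w pw → g (x *q y ∷ w) (pos-* px py ∷ pw)) u v pu pv)

span-cancelʳ : ∀ {I A : Set} {b : I → A → ℚ} {f g} → Span b (f ⊕ g) → Span b g → Span b f
span-cancelʳ {f = f} {g} p r = span-≗ (λ a → solve 2 (λ x y → (x :+ y) :- y := x) refl (f a) (g a)) (span-⊖ p r)

qsh-⌊⌋ : ∀ (φ : List ℚ⟦q⟧ → ℕ → ℚ⟦q⟧) u v (p : Point) → qsh (λ w → φ w (proj₁ p)) u v (proj₁ (proj₂ p)) ≡ qsh (λ w → ⌊ φ w ⌋) u v p
qsh-⌊⌋ φ []      v       p = refl
qsh-⌊⌋ φ (x ∷ u) []      p = refl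
qsh-⌊⌋ φ (x ∷ u) (y ∷ v) p = cong₂ _+ℚ_ (cong₂ _+ℚ_ (qsh-⌊⌋ (φ ∘ (x ∷_)) u (y ∷ v) p) (qsh-⌊⌋ (φ ∘ (y ∷_)) (x ∷ u) v p)) (qsh-⌊⌋ (φ ∘ (x *q y ∷_)) u v p)

deriv-⌊⌋ : ∀ (φ : List ℚ⟦q⟧ → ℕ → ℚ⟦q⟧) w (p : Point) → deriv (λ w → φ w (proj₁ p)) w (proj₁ (proj₂ p)) ≡ deriv (λ w → ⌊ φ w ⌋) w p
deriv-⌊⌋ φ []      p = refl
deriv-⌊⌋ φ (x ∷ w) p = cong₂ _+ℚ_ (cong (⌊ φ (𝕕 x ∷ w) ⌋ p +ℚ_) (qsh-⌊⌋ (φ ∘ (𝕕 x ∷_)) (1q ∷ []) w p)) (deriv-⌊⌋ (φ ∘ (x ∷_)) w p)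

product-in-V : ∀ u v → V (Pw u) → V (Pw v) → V (qsh Pw u v)
product-in-V u v p r = span-≗ (λ pt@(B , M , l) → trans (Truncated.at (P-qsh B B u v) M l) (qsh-⌊⌋ (λ w B → P B B w) u v pt))
  (InV-* {λ B → P B B u} {λ B → P B B v} p r)

head-in-V : ∀ k y → (∀ u → y (suc u) ≡ X̂ k (suc u)) → y 0 ≡ 0ℚ → ∀ {w w′} → (∀ B → Matches B 1 w w′) → V (Pw (y ∷ w′))
head-in-V k y e y0 {w} {w′} m = span-≗ (λ (B , M , l) → Truncated.at (gapK-head B k y e y0 {w} {w′} (m B)) M l) (span-basis (k ∷ w))

good-P : Good Pw
good-P = good-by-basis Pw-multilinear λ
  { []       → span-basis []
  ; (j ∷ js) → head-in-V (suc j) (X̂ (suc j)) (λ _ → refl) (pw-suc-0 j) {map suc js} {map (X̂ ∘ suc) js} (λ B → matches-all-positive B 1 js) }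

good-ẑ : Good (Pw ∘ (ẑ ∷_))
good-ẑ = good-by-basis (λ u v → Pw-multilinear (ẑ ∷ u) v)
  (λ js → head-in-V 0 ẑ (λ _ → refl) refl {map suc js} {map (X̂ ∘ suc) js} (λ B → matches-all-positive B 1 js))

module _ (j : ℕ) where

  head-ζ : ∀ js → V (Pw (X̂ (suc j) ∷ ζ ∷ map (X̂ ∘ suc) js))
  head-ζ js = head-in-V (suc j) (X̂ (suc j)) (λ _ → refl) (pw-suc-0 j) {0 ∷ map suc js} {ζ ∷ map (X̂ ∘ suc) js} (λ B → matches-zero B js)

  head-ζ₂ : ∀ i js → V (Pw (X̂ (suc j) ∷ X̂ (suc i) ∷ ζ ∷ map (X̂ ∘ suc) js))
  head-ζ₂ i js = head-in-V (suc j) (X̂ (suc j)) (λ _ → refl) (pw-suc-0 j) {suc i ∷ 0 ∷ map suc js} {X̂ (suc i) ∷ ζ ∷ map (X̂ ∘ suc) js}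
    (λ B → matches-positive B i 1 {0 ∷ map suc js} {ζ ∷ map (X̂ ∘ suc) js} (matches-zero B js))

  head-ζ₃ : ∀ i h js → V (Pw (X̂ (suc j) ∷ X̂ (suc i) ∷ X̂ (suc h) ∷ ζ ∷ map (X̂ ∘ suc) js))
  head-ζ₃ i h js = head-in-V (suc j) (X̂ (suc j)) (λ _ → refl) (pw-suc-0 j)
    {suc i ∷ suc h ∷ 0 ∷ map suc js} {X̂ (suc i) ∷ X̂ (suc h) ∷ ζ ∷ map (X̂ ∘ suc) js}
    (λ B → matches-positive B i 1 {suc h ∷ 0 ∷ map suc js} {X̂ (suc h) ∷ ζ ∷ map (X̂ ∘ suc) js}
      (matches-positive B h 1 {0 ∷ map suc js} {ζ ∷ map (X̂ ∘ suc) js} (matches-zero B js)))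

good-ζ₁ : ∀ {x} → Pos x → Good (λ w → Pw (x ∷ ζ ∷ w))
good-ζ₁ {x} px = good-by-basis (λ u v → Pw-multilinear (x ∷ ζ ∷ u) v) (λ js →
  span-map (Pw-multilinear [] (ζ ∷ map (X̂ ∘ suc) js)) (λ j → head-ζ j js) px)

good-ζ₂ : ∀ {x y} → Pos x → Pos y → Good (λ w → Pw (x ∷ y ∷ ζ ∷ w))
good-ζ₂ {x} {y} px py = good-by-basis (λ u v → Pw-multilinear (x ∷ y ∷ ζ ∷ u) v) (λ js →
  span-map (Pw-multilinear [] (y ∷ ζ ∷ map (X̂ ∘ suc) js)) (λ j →
    span-map (Pw-multilinear (X̂ (suc j) ∷ []) (ζ ∷ map (X̂ ∘ suc) js)) (λ i → head-ζ₂ j i js) py) px)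

good-ζ₃ : ∀ {x y c} → Pos x → Pos y → Pos c → Good (λ w → Pw (x ∷ y ∷ c ∷ ζ ∷ w))
good-ζ₃ {x} {y} {c} px py pc = good-by-basis (λ u v → Pw-multilinear (x ∷ y ∷ c ∷ ζ ∷ u) v) (λ js →
  span-map (Pw-multilinear [] (y ∷ c ∷ ζ ∷ map (X̂ ∘ suc) js)) (λ j →
    span-map (Pw-multilinear (X̂ (suc j) ∷ []) (c ∷ ζ ∷ map (X̂ ∘ suc) js)) (λ i →
      span-map (Pw-multilinear (X̂ (suc j) ∷ X̂ (suc i) ∷ []) (ζ ∷ map (X̂ ∘ suc) js)) (λ h → head-ζ₃ j i h js) pc) py) px)

-- The word with ẑ moved past positive letters is isolated in the product of the
-- prefix with the word that starts with ẑ.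
good-ẑ₁ : ∀ {x} → Pos x → Good (λ w → Pw (x ∷ ẑ ∷ w))
good-ẑ₁ {x} px w pw = span-cancelʳ (span-cancelʳ
  (product-in-V (x ∷ []) (ẑ ∷ w) (good-P (x ∷ []) (px ∷ [])) (good-ẑ w pw))
  (good-P (x *q ẑ ∷ w) (pos-*ẑ px ∷ pw)))
  (good-qsh good-ẑ (x ∷ []) w (px ∷ []) pw)

good-ẑ₂ : ∀ {x y} → Pos x → Pos y → Good (λ w → Pw (x ∷ y ∷ ẑ ∷ w))
good-ẑ₂ {x} {y} px py w pw = span-cancelʳ (span-cancelʳ (span-cancelʳ (span-cancelʳ
  (product-in-V (x ∷ y ∷ []) (ẑ ∷ w) (good-P (x ∷ y ∷ []) (px ∷ py ∷ [])) (good-ẑ w pw))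
  (good-qsh (λ v pv → good-P (x *q ẑ ∷ v) (pos-*ẑ px ∷ pv)) (y ∷ []) w (py ∷ []) pw))
  (good-qsh good-ẑ (x ∷ y ∷ []) w (px ∷ py ∷ []) pw))
  (good-P (x ∷ y *q ẑ ∷ w) (px ∷ pos-*ẑ py ∷ pw)))
  (good-qsh (good-ẑ₁ px) (y ∷ []) w (py ∷ []) pw)

good-ẑ₃ : ∀ {x y c} → Pos x → Pos y → Pos c → Good (λ w → Pw (x ∷ y ∷ c ∷ ẑ ∷ w))
-- Two terms are removed for each letter of the prefix: `ẑ` merging with it, and `ẑ` standing
-- directly before it. What remains is `ẑ` behind the whole prefix.
good-ẑ₃ {x} {y} {c} px py pc w pw = span-cancelʳ (span-cancelʳ (span-cancelʳ (span-cancelʳ (span-cancelʳ (span-cancelʳ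
  (product-in-V (x ∷ y ∷ c ∷ []) (ẑ ∷ w) (good-P (x ∷ y ∷ c ∷ []) (px ∷ py ∷ pc ∷ [])) (good-ẑ w pw))
  (good-qsh (λ v pv → good-P (x *q ẑ ∷ v) (pos-*ẑ px ∷ pv)) (y ∷ c ∷ []) w (py ∷ pc ∷ []) pw))
  (good-qsh good-ẑ (x ∷ y ∷ c ∷ []) w (px ∷ py ∷ pc ∷ []) pw))
  (good-qsh (λ v pv → good-P (x ∷ y *q ẑ ∷ v) (px ∷ pos-*ẑ py ∷ pv)) (c ∷ []) w (pc ∷ []) pw))
  (good-qsh (good-ẑ₁ px) (y ∷ c ∷ []) w (py ∷ pc ∷ []) pw))
  (good-P (x ∷ y ∷ c *q ẑ ∷ w) (px ∷ py ∷ pos-*ẑ pc ∷ pw)))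
  (good-qsh (good-ẑ₂ px py) (c ∷ []) w (pc ∷ []) pw)

-- `ζ` and `ẑ` differ only by the constant term 1/2, so `1q` is twice their difference.
1q-from-ζ-ẑ : ∀ u v → V (Pw (u ++ ζ ∷ v)) → V (Pw (u ++ ẑ ∷ v)) → V (Pw (u ++ 1q ∷ v))
1q-from-ζ-ẑ u v p r = span-≗ (λ a → trans (sym (trans (T-· (fromℕ 2) (ζ ⊕ ((-ℚ 1ℚ) · ẑ)) a) (cong (fromℕ 2 *ℚ_)
      (trans (T-⊕ ζ ((-ℚ 1ℚ) · ẑ) a) (cong (Pw (u ++ ζ ∷ v) a +ℚ_) (T-· (-ℚ 1ℚ) ẑ a)))))) (T-cong letter a))
    (span-· (fromℕ 2) (span-⊕ p (span-· (-ℚ 1ℚ) r)))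
  where
  open Linear (Pw-multilinear u v)
  letter : fromℕ 2 · (ζ ⊕ ((-ℚ 1ℚ) · ẑ)) ≗ 1q
  letter zero    = refl
  letter (suc n) = refl

good-1₁ : ∀ {x} → Pos x → Good (λ w → Pw (x ∷ 1q ∷ w))
good-1₁ {x} px w pw = 1q-from-ζ-ẑ (x ∷ []) w (good-ζ₁ px w pw) (good-ẑ₁ px w pw)

good-1₂ : ∀ {x y} → Pos x → Pos y → Good (λ w → Pw (x ∷ y ∷ 1q ∷ w))
good-1₂ {x} {y} px py w pw = 1q-from-ζ-ẑ (x ∷ y ∷ []) w (good-ζ₂ px py w pw) (good-ẑ₂ px py w pw)

good-1₃ : ∀ {x y c} → Pos x → Pos y → Pos c → Good (λ w → Pw (x ∷ y ∷ c ∷ 1q ∷ w))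
good-1₃ {x} {y} {c} px py pc w pw = 1q-from-ζ-ẑ (x ∷ y ∷ c ∷ []) w (good-ζ₃ px py pc w pw) (good-ẑ₃ px py pc w pw)

-- Every word of `deriv` has a positive head. The letter 1 either merges with a positive letter,
-- which it leaves unchanged, or stands behind one or more of them, as treated by `good-1₁` and its
-- companions.
deriv₂ : ∀ {x y} → Pos x → Pos y → V (deriv Pw (x ∷ y ∷ []))
deriv₂ {x} {y} px py = span-⊕
  (span-⊕ (good-P (𝕕 x ∷ y ∷ []) (pos-𝕕 px ∷ py ∷ []))
    (span-⊕ (span-⊕ (good-1₁ (pos-𝕕 px) (y ∷ []) (py ∷ [])) (good-1₂ (pos-𝕕 px) py [] [])) (good-P (𝕕 x ∷ 1q *q y ∷ []) (pos-𝕕 px ∷ pos-1q* py ∷ []))))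
  (span-⊕ (span-⊕ (good-P (x ∷ 𝕕 y ∷ []) (px ∷ pos-𝕕 py ∷ [])) (good-1₂ px (pos-𝕕 py) [] [])) span-𝟘)

deriv₃ : ∀ {x y c} → Pos x → Pos y → Pos c → V (deriv Pw (x ∷ y ∷ c ∷ []))
deriv₃ {x} {y} {c} px py pc = span-⊕
  (span-⊕ (good-P (𝕕 x ∷ y ∷ c ∷ []) (px′ ∷ py ∷ pc ∷ []))
    (span-⊕ (span-⊕ (good-1₁ px′ (y ∷ c ∷ []) (py ∷ pc ∷ []))
      (span-⊕ (span-⊕ (good-1₂ px′ py (c ∷ []) (pc ∷ [])) (good-1₃ px′ py pc [] [])) (good-P (𝕕 x ∷ y ∷ 1q *q c ∷ []) (px′ ∷ py ∷ pos-1q* pc ∷ []))))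
      (good-P (𝕕 x ∷ 1q *q y ∷ c ∷ []) (px′ ∷ pos-1q* py ∷ pc ∷ []))))
  (span-⊕
    (span-⊕ (good-P (x ∷ 𝕕 y ∷ c ∷ []) (px ∷ py′ ∷ pc ∷ []))
      (span-⊕ (span-⊕ (good-1₂ px py′ (c ∷ []) (pc ∷ [])) (good-1₃ px py′ pc [] [])) (good-P (x ∷ 𝕕 y ∷ 1q *q c ∷ []) (px ∷ py′ ∷ pos-1q* pc ∷ []))))
    (span-⊕ (span-⊕ (good-P (x ∷ y ∷ 𝕕 c ∷ []) (px ∷ py ∷ pos-𝕕 pc ∷ [])) (good-1₃ px py (pos-𝕕 pc) [] [])) span-𝟘))
  where
  px′ = pos-𝕕 px
  py′ = pos-𝕕 py

-- For indices ≥ 2 the blocks of size > 1 do not contribute.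
gsh≡P : ∀ l j js → wordOf l ≡ map suc (j ∷ js) → ∀ B M → M ≤ B → gsh l M ≡ P B B (map (X̂ ∘ suc) (j ∷ js)) M
gsh≡P l j js e B M M≤B = trans (gsh≡K l B M M≤B) (trans (cong (λ w → gapK w B M) e)
  (Truncated.at (gapK-head B (suc j) (X̂ (suc j)) (λ _ → refl) (pw-suc-0 j) {map suc js} {map (X̂ ∘ suc) js} (matches-all-positive B 1 js)) M M≤B))

𝕕-gsh : ∀ l j js → wordOf l ≡ map suc (j ∷ js) → V (deriv Pw (map (X̂ ∘ suc) (j ∷ js))) → IsCombination (𝕕 (gsh l))
𝕕-gsh l j js e p = InV⇒IsCombination (span-≗ (λ pt@(B , M , M≤B) → sym (trans (cong (fromℕ M *ℚ_) (gsh≡P l j js e B M M≤B))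
  (trans (Truncated.at (𝕕-P B B w) M M≤B) (deriv-⌊⌋ (λ w B → P B B w) w pt)))) p)
  where w = map (X̂ ∘ suc) (j ∷ js)

pos-X̂ : ∀ j → Pos (X̂ (suc j))
pos-X̂ j = span-basis j

combination₂ : ∀ k₁ k₂ → IsCombination (𝕕 (gsh (suc (suc k₁) ∷ suc (suc k₂) ∷ [])))
combination₂ k₁ k₂ = 𝕕-gsh (suc (suc k₁) ∷ suc (suc k₂) ∷ []) k₂ (k₁ ∷ []) refl (deriv₂ (pos-X̂ k₂) (pos-X̂ k₁))

combination₃ : ∀ k₁ k₂ k₃ → IsCombination (𝕕 (gsh (suc (suc k₁) ∷ suc (suc k₂) ∷ suc (suc k₃) ∷ [])))
combination₃ k₁ k₂ k₃ = 𝕕-gsh (suc (suc k₁) ∷ suc (suc k₂) ∷ suc (suc k₃) ∷ []) k₃ (k₂ ∷ k₁ ∷ []) refl (deriv₃ (pos-X̂ k₃) (pos-X̂ k₂) (pos-X̂ k₁))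

-- The derivative in depth one

pw-2* : ∀ c t → fromℕ (2 ^ c) *ℚ pw c t ≡ pw c (t +ℚ t)
pw-2* zero    t = refl
pw-2* (suc c) t = trans (cong (_*ℚ pw (suc c) t) (fromℕ-* 2 (2 ^ c)))
  (trans (solve 5 (λ two p r t x → (two :* p) :* (r :* (t :* x)) := r :* ((two :* t) :* (p :* x))) refl (fromℕ 2) (fromℕ (2 ^ c)) (1/1+ c) t (pw c t))
    (cong ((1/1+ c) *ℚ_) (cong₂ _*ℚ_ (solve 1 (λ t → con (fromℕ 2) :* t := t :+ t) refl t) (pw-2* c t))))

Σℚ-reverse : ∀ n (f : ℕ → ℚ) → Σℚ (suc n) (λ c → f (n ∸ c)) ≡ Σℚ (suc n) f
Σℚ-reverse zero    f = refl
Σℚ-reverse (suc n) f = trans (Σℚ-head (suc n) (λ c → f (suc n ∸ c))) (trans (ℚₚ.+-comm (f (suc n)) _) (cong (_+ℚ f (suc n)) (Σℚ-reverse n f)))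

Σℚ-antidiagonal : ∀ n (f : ℕ → ℕ → ℚ) → Σℚ (suc n) (λ c → f (n ∸ c) c) ≡ Σℚ (suc n) (λ c → f c (n ∸ c))
Σℚ-antidiagonal n f = trans (Σℚ-cong< (suc n) (λ { c (s≤s l) → cong (f (n ∸ c)) (sym (ℕₚ.m∸[m∸n]≡n l)) })) (Σℚ-reverse n (λ c → f c (n ∸ c)))

-- The letter for the exponent c at the head of a word.
x̂ : ℕ → ℚ⟦q⟧
x̂ zero    = ẑ
x̂ (suc c) = X̂ (suc c)

x̂-0 : ∀ c → x̂ c 0 ≡ 0ℚ
x̂-0 zero    = refl
x̂-0 (suc c) = pw-suc-0 c

x̂-suc : ∀ c u → x̂ c (suc u) ≡ X̂ c (suc u)
x̂-suc zero    u = refl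
x̂-suc (suc c) u = refl

𝕕-x̂ : ∀ c → 𝕕 (x̂ c) ≗ fromℕ (suc c) · X̂ (suc c)
𝕕-x̂ zero    zero    = refl
𝕕-x̂ zero    (suc u) = 𝕕-X̂ 0 (suc u)
𝕕-x̂ (suc c) u       = 𝕕-X̂ (suc c) u

-- The binomial theorem, applied to each of the U - 1 compositions U = u + v.
x̂-convolution : ∀ k → (λ U → Σℚ (suc (suc k)) (λ c → (x̂ c *q x̂ (suc k ∸ c)) U)) ≗
  (fromℕ (suc (suc k)) · X̂ (suc (suc k))) ⊖ X̂ (suc k)
x̂-convolution κ U = trans (trans (Σℚ-cong (suc k) (λ c → *q-Σℚ (x̂ c) (x̂ (k ∸ c)) U)) (Σℚ-swap (suc k) (suc U) (λ c u → x̂ c u *ℚ x̂ (k ∸ c) (U ∸ u)))) (go U)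
  where
  k = suc κ
  inside : ℕ → ℕ → ℚ
  inside U u = Σℚ (suc k) (λ c → x̂ c u *ℚ x̂ (k ∸ c) (U ∸ u))
  left-0 : ∀ U → inside U 0 ≡ 0ℚ
  left-0 U = Σℚ-vanish (suc k) _ (λ c _ → trans (cong (_*ℚ x̂ (k ∸ c) U) (x̂-0 c)) (ℚₚ.*-zeroˡ (x̂ (k ∸ c) U)))
  right-0 : ∀ U → inside U U ≡ 0ℚ
  right-0 U = Σℚ-vanish (suc k) _ (λ c _ → trans (cong (λ t → x̂ c U *ℚ x̂ (k ∸ c) t) (ℕₚ.n∸n≡0 U))
    (trans (cong (x̂ c U *ℚ_) (x̂-0 (k ∸ c))) (ℚₚ.*-zeroʳ (x̂ c U))))
  middle : ∀ u v → inside (suc u + suc v) (suc u) ≡ X̂ k (suc u + suc v)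
  middle u v = trans (Σℚ-cong (suc k) (λ c → cong₂ _*ℚ_ (x̂-suc c u) (trans (cong (x̂ (k ∸ c)) (ℕₚ.m+n∸m≡n (suc u) (suc v))) (x̂-suc (k ∸ c) v))))
    (trans (sym (pw-+ k (fromℕ (suc u)) (fromℕ (suc v)))) (cong (pw k) (sym (fromℕ-+ (suc u) (suc v)))))
  Σ-const : ∀ n c → Σℚ n (λ _ → c) ≡ fromℕ n *ℚ c
  Σ-const zero    c = sym (ℚₚ.*-zeroˡ c)
  Σ-const (suc n) c = trans (cong (_+ℚ c) (Σ-const n c)) (trans (solve 2 (λ n c → n :* c :+ c := (con 1ℚ :+ n) :* c) refl (fromℕ n) c)
    (cong (_*ℚ c) (sym (fromℕ-suc n))))
  go : ∀ U → Σℚ (suc U) (inside U) ≡ ((fromℕ (suc k) · X̂ (suc k)) ⊖ X̂ k) U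
  go zero    = trans (ℚₚ.+-identityˡ (inside 0 0)) (trans (left-0 0) (sym (cong₂ _-ℚ_ (trans (cong (fromℕ (suc k) *ℚ_) (pw-suc-0 k)) (ℚₚ.*-zeroʳ (fromℕ (suc k)))) (pw-suc-0 κ))))
  go (suc U) = begin
    Σℚ (suc U) (inside (suc U)) +ℚ inside (suc U) (suc U)
      ≡⟨ trans (cong₂ _+ℚ_ (trans (Σℚ-head U (inside (suc U))) (cong (_+ℚ Σℚ U (inside (suc U) ∘ suc)) (left-0 (suc U)))) (right-0 (suc U)))
           (trans (ℚₚ.+-identityʳ _) (ℚₚ.+-identityˡ _)) ⟩
    Σℚ U (inside (suc U) ∘ suc)
      ≡⟨ Σℚ-cong< U (λ u l → subst (λ W → inside W (suc u) ≡ X̂ k W) (cong suc (trans (sym (cong (λ t → u + t) (ℕₚ.+-∸-assoc 1 l))) (ℕₚ.m+[n∸m]≡n (ℕₚ.<⇒≤ l)))) (middle u (U ∸ suc u))) ⟩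
    Σℚ U (λ _ → X̂ k (suc U))
      ≡⟨ Σ-const U (X̂ k (suc U)) ⟩
    fromℕ U *ℚ X̂ k (suc U)
      ≡⟨ solve 2 (λ u x → u :* x := (con 1ℚ :+ u) :* x :- x) refl (fromℕ U) (X̂ k (suc U)) ⟩
    (1ℚ +ℚ fromℕ U) *ℚ X̂ k (suc U) -ℚ X̂ k (suc U)
      ≡⟨ cong (_-ℚ X̂ k (suc U)) (trans (cong (_*ℚ X̂ k (suc U)) (sym (fromℕ-suc U))) (𝕕-X̂ k (suc U))) ⟩
    ((fromℕ (suc k) · X̂ (suc k)) ⊖ X̂ k) (suc U) ∎
    where open ≡-Reasoning

module DepthTwo (N : ℕ) where

  p : List ℚ⟦q⟧ → ℚ
  p w = P N N w N

  g : List ℕ → ℚ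
  g w = gapK w N N

  g₁ : ∀ c M → M ≤ N → gapK (c ∷ []) N M ≡ P N N (x̂ c ∷ []) M
  g₁ c M l = Truncated.at (gapK-head N c (x̂ c) (x̂-suc c) (x̂-0 c) {[]} {[]} (λ _ _ → refl)) M l

  g₂ : ∀ c a → g (c ∷ suc a ∷ []) ≡ p (x̂ c ∷ x̂ (suc a) ∷ [])
  g₂ c a = Truncated.at (gapK-head N c (x̂ c) (x̂-suc c) (x̂-0 c) {suc a ∷ []} {X̂ (suc a) ∷ []} (matches-all-positive N 1 (a ∷ []))) N ℕₚ.≤-refl

  -- The half count of the indices below the head, which stems from ties, is the source of the
  -- derivative in depth one.
  g₂-0 : ∀ c → g (c ∷ 0 ∷ []) ≡ p (x̂ c ∷ ẑ ∷ []) +ℚ (1/1+ 1) *ℚ p (x̂ c ∷ 1q ∷ [])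
  g₂-0 c = trans (Truncated.at (gapK-head N c (x̂ c) (x̂-suc c) (x̂-0 c) {0 ∷ []} {ζ ∷ []} (matches-zero N [])) N ℕₚ.≤-refl)
    (trans (T-cong ζ≗ N) (trans (T-⊕ ẑ ((1/1+ 1) · 1q) N) (cong (p (x̂ c ∷ ẑ ∷ []) +ℚ_) (T-· (1/1+ 1) 1q N))))
    where
    open Linear (P-linear N N (x̂ c ∷ []) [])
    ζ≗ : ζ ≗ ẑ ⊕ ((1/1+ 1) · 1q)
    ζ≗ zero    = refl
    ζ≗ (suc u) = refl

  A : ℕ → ℕ → ℚ
  A d d′ = (L d *q (L d′ *q 1q)) N

  -- The two letters of a word only enter through x 0 d * y d d′.
  from : (ℕ → ℕ → ℚ) → ℕ → ℚ
  from Z d = Z d d *ℚ ((1/1+ 1) *ℚ A d d) +ℚ Σℚ (N ∸ d) (λ l → Z d (suc (d + l)) *ℚ A d (suc (d + l)))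

  pair : (ℕ → ℕ → ℚ) → ℚ
  pair Z = Σℚ N (λ i → from Z (suc i))

  pair-cong : ∀ {Z Z′ : ℕ → ℕ → ℚ} → (∀ d d′ → Z d d′ ≡ Z′ d d′) → pair Z ≡ pair Z′
  pair-cong e = Σℚ-cong N (λ i → cong₂ _+ℚ_ (cong (_*ℚ ((1/1+ 1) *ℚ A (suc i) (suc i))) (e (suc i) (suc i)))
    (Σℚ-cong (N ∸ suc i) (λ l → cong (_*ℚ A (suc i) (suc (suc i + l))) (e (suc i) (suc (suc i + l))))))

  pair-Σ : ∀ n (Z : ℕ → ℕ → ℕ → ℚ) → Σℚ n (λ c → pair (Z c)) ≡ pair (λ d d′ → Σℚ n (λ c → Z c d d′))
  pair-Σ n Z = trans (Σℚ-swap n N (λ c i → from (Z c) (suc i))) (Σℚ-cong N (λ i → at-d (suc i)))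
    where
    at-d : ∀ d → Σℚ n (λ c → from (Z c) d) ≡ from (λ d d′ → Σℚ n (λ c → Z c d d′)) d
    at-d d = trans (Σℚ-+ n (λ c → Z c d d *ℚ ((1/1+ 1) *ℚ A d d)) (λ c → Σℚ (N ∸ d) (λ l → Z c d (suc (d + l)) *ℚ A d (suc (d + l)))))
      (cong₂ _+ℚ_ (Σℚ-*ʳ n ((1/1+ 1) *ℚ A d d) (λ c → Z c d d))
        (trans (Σℚ-swap n (N ∸ d) (λ c l → Z c d (suc (d + l)) *ℚ A d (suc (d + l))))
          (Σℚ-cong (N ∸ d) (λ l → Σℚ-*ʳ n (A d (suc (d + l))) (λ c → Z c d (suc (d + l)))))))

  pair-· : ∀ κ (Z : ℕ → ℕ → ℚ) → κ *ℚ pair Z ≡ pair (λ d d′ → κ *ℚ Z d d′)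
  pair-· κ Z = trans (sym (Σℚ-*ˡ N κ (λ i → from Z (suc i)))) (Σℚ-cong N (λ i → at-d (suc i)))
    where
    at-d : ∀ d → κ *ℚ from Z d ≡ from (λ d d′ → κ *ℚ Z d d′) d
    at-d d = trans (ℚₚ.*-distribˡ-+ κ (Z d d *ℚ ((1/1+ 1) *ℚ A d d)) (Σℚ (N ∸ d) (λ l → Z d (suc (d + l)) *ℚ A d (suc (d + l)))))
      (cong₂ _+ℚ_ (sym (ℚₚ.*-assoc κ (Z d d) ((1/1+ 1) *ℚ A d d)))
        (trans (sym (Σℚ-*ˡ (N ∸ d) κ (λ l → Z d (suc (d + l)) *ℚ A d (suc (d + l)))))
          (Σℚ-cong (N ∸ d) (λ l → sym (ℚₚ.*-assoc κ (Z d (suc (d + l))) (A d (suc (d + l))))))))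

  K-pair : ∀ x y → Words.K N 0 0 (x ∷ y ∷ []) N ≡ pair (λ d d′ → x 0 d *ℚ y d d′)
  K-pair x y = trans (K≗F N (x ∷ y ∷ []) N) (Σℚ-cong N (λ i → at-d (suc i)))
    where
    at-d : ∀ d → x 0 d *ℚ (L d *q Words.K N d 1 (y ∷ [])) N ≡ from (λ d d′ → x 0 d *ℚ y d d′) d
    at-d d = begin
      x 0 d *ℚ (L d *q (((y d d *ℚ (1/1+ 1)) · (L d *q 1q)) ⊕ tail)) N
        ≡⟨ cong (x 0 d *ℚ_) (trans (*q-distribˡ (L d) ((y d d *ℚ (1/1+ 1)) · (L d *q 1q)) tail N)
             (cong₂ _+ℚ_ (*q-·ʳ (y d d *ℚ (1/1+ 1)) (L d) (L d *q 1q) N)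
               (trans (*q-Σʳ (N ∸ d) (L d) (λ l → y d (suc (d + l)) · (L (suc (d + l)) *q 1q)) N)
                 (Σℚ-cong (N ∸ d) (λ l → *q-·ʳ (y d (suc (d + l))) (L d) (L (suc (d + l)) *q 1q) N))))) ⟩
      x 0 d *ℚ ((y d d *ℚ (1/1+ 1)) *ℚ A d d +ℚ Σℚ (N ∸ d) (λ l → y d (suc (d + l)) *ℚ A d (suc (d + l))))
        ≡⟨ ℚₚ.*-distribˡ-+ (x 0 d) ((y d d *ℚ (1/1+ 1)) *ℚ A d d) (Σℚ (N ∸ d) (λ l → y d (suc (d + l)) *ℚ A d (suc (d + l)))) ⟩
      x 0 d *ℚ ((y d d *ℚ (1/1+ 1)) *ℚ A d d) +ℚ x 0 d *ℚ Σℚ (N ∸ d) (λ l → y d (suc (d + l)) *ℚ A d (suc (d + l)))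
        ≡⟨ cong₂ _+ℚ_ (solve 4 (λ x y r a → x :* ((y :* r) :* a) := (x :* y) :* (r :* a)) refl (x 0 d) (y d d) (1/1+ 1) (A d d))
             (trans (sym (Σℚ-*ˡ (N ∸ d) (x 0 d) (λ l → y d (suc (d + l)) *ℚ A d (suc (d + l)))))
               (Σℚ-cong (N ∸ d) (λ l → sym (ℚₚ.*-assoc (x 0 d) (y d (suc (d + l))) (A d (suc (d + l))))))) ⟩
      from (λ d d′ → x 0 d *ℚ y d d′) d ∎
      where
      open ≡-Reasoning
      tail : ℚ⟦q⟧
      tail = Words.∑> N d (λ d′ → y d d′ · (L d′ *q 1q))

  -- Both sides are the coefficients of X^k in G(X, 2X) = H(1;X)²/2.
  gap-abs : ∀ k → Σℚ (suc k) (λ c → fromℕ (2 ^ c) *ℚ g (c ∷ k ∸ c ∷ [])) ≡ Σℚ (suc k) (λ c → absK (c ∷ k ∸ c ∷ []) N N)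
  gap-abs k = begin
    Σℚ (suc k) (λ c → fromℕ (2 ^ c) *ℚ g (c ∷ k ∸ c ∷ []))
      ≡⟨ Σℚ-cong (suc k) (λ c → trans (cong (fromℕ (2 ^ c) *ℚ_) (K-pair (gap c) (gap (k ∸ c)))) (pair-· (fromℕ (2 ^ c)) (λ d d′ → gap c 0 d *ℚ gap (k ∸ c) d d′))) ⟩
    Σℚ (suc k) (λ c → pair (λ d d′ → fromℕ (2 ^ c) *ℚ (gap c 0 d *ℚ gap (k ∸ c) d d′)))
      ≡⟨ pair-Σ (suc k) (λ c d d′ → fromℕ (2 ^ c) *ℚ (gap c 0 d *ℚ gap (k ∸ c) d d′)) ⟩
    pair (λ d d′ → Σℚ (suc k) (λ c → fromℕ (2 ^ c) *ℚ (gap c 0 d *ℚ gap (k ∸ c) d d′)))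
      ≡⟨ pair-cong binomials ⟩
    pair (λ d d′ → Σℚ (suc k) (λ c → abs c 0 d *ℚ abs (k ∸ c) d d′))
      ≡⟨ pair-Σ (suc k) (λ c d d′ → abs c 0 d *ℚ abs (k ∸ c) d d′) ⟨
    Σℚ (suc k) (λ c → pair (λ d d′ → abs c 0 d *ℚ abs (k ∸ c) d d′))
      ≡⟨ Σℚ-cong (suc k) (λ c → K-pair (abs c) (abs (k ∸ c))) ⟨
    Σℚ (suc k) (λ c → absK (c ∷ k ∸ c ∷ []) N N) ∎
    where
    open ≡-Reasoning
    binomials : ∀ d d′ → Σℚ (suc k) (λ c → fromℕ (2 ^ c) *ℚ (gap c 0 d *ℚ gap (k ∸ c) d d′)) ≡ Σℚ (suc k) (λ c → abs c 0 d *ℚ abs (k ∸ c) d d′)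
    binomials d d′ = begin
      Σℚ (suc k) (λ c → fromℕ (2 ^ c) *ℚ (gap c 0 d *ℚ gap (k ∸ c) d d′))
        ≡⟨ Σℚ-cong (suc k) (λ c → trans (sym (ℚₚ.*-assoc (fromℕ (2 ^ c)) (gap c 0 d) (gap (k ∸ c) d d′)))
             (cong (_*ℚ gap (k ∸ c) d d′) (trans (cong (λ t → fromℕ (2 ^ c) *ℚ pw c t) (ℚₚ.+-identityʳ (fromℕ d))) (pw-2* c (fromℕ d))))) ⟩
      Σℚ (suc k) (λ c → pw c (fromℕ d +ℚ fromℕ d) *ℚ pw (k ∸ c) (fromℕ d′ -ℚ fromℕ d))
        ≡⟨ pw-+ k (fromℕ d +ℚ fromℕ d) (fromℕ d′ -ℚ fromℕ d) ⟨
      pw k ((fromℕ d +ℚ fromℕ d) +ℚ (fromℕ d′ -ℚ fromℕ d))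
        ≡⟨ cong (pw k) (solve 2 (λ a b → (a :+ a) :+ (b :- a) := a :+ b) refl (fromℕ d) (fromℕ d′)) ⟩
      pw k (fromℕ d +ℚ fromℕ d′)
        ≡⟨ pw-+ k (fromℕ d) (fromℕ d′) ⟩
      Σℚ (suc k) (λ c → abs c 0 d *ℚ abs (k ∸ c) d d′) ∎

  gapK₁≗absK₁ : ∀ c → gapK (c ∷ []) N ≗ absK (c ∷ []) N
  gapK₁≗absK₁ c M = trans (K≗F N (gap c ∷ []) M) (trans (Σℚ-cong N (λ i → cong (λ t → pw c t *ℚ (L (suc i) *q 1q) M) (ℚₚ.+-identityʳ (fromℕ (suc i)))))
    (sym (K≗F N (abs c ∷ []) M)))

  -- The coefficient of X^k in H(1;X)².
  square : ℕ → ℚ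
  square k = Σℚ (suc k) (λ c → (P N N (x̂ c ∷ []) *q P N N (x̂ (k ∸ c) ∷ [])) N)

  sum-2^ : ∀ k → Σℚ (suc k) (λ c → fromℕ (2 ^ suc c) *ℚ g (c ∷ k ∸ c ∷ [])) ≡ square k
  sum-2^ k = begin
    Σℚ (suc k) (λ c → fromℕ (2 ^ suc c) *ℚ g (c ∷ k ∸ c ∷ []))
      ≡⟨ Σℚ-cong (suc k) (λ c → trans (cong (_*ℚ g (c ∷ k ∸ c ∷ [])) (fromℕ-* 2 (2 ^ c))) (ℚₚ.*-assoc (fromℕ 2) (fromℕ (2 ^ c)) (g (c ∷ k ∸ c ∷ [])))) ⟩
    Σℚ (suc k) (λ c → fromℕ 2 *ℚ (fromℕ (2 ^ c) *ℚ g (c ∷ k ∸ c ∷ [])))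
      ≡⟨ Σℚ-*ˡ (suc k) (fromℕ 2) (λ c → fromℕ (2 ^ c) *ℚ g (c ∷ k ∸ c ∷ [])) ⟩
    fromℕ 2 *ℚ Σℚ (suc k) (λ c → fromℕ (2 ^ c) *ℚ g (c ∷ k ∸ c ∷ []))
      ≡⟨ cong (fromℕ 2 *ℚ_) (gap-abs k) ⟩
    fromℕ 2 *ℚ S
      ≡⟨ solve 1 (λ s → con (fromℕ 2) :* s := s :+ s) refl S ⟩
    S +ℚ S
      -- Reversing one of the two copies exhibits both shuffles of two one-letter words.
      ≡⟨ cong (S +ℚ_) (Σℚ-antidiagonal k (λ a b → absK (a ∷ b ∷ []) N N)) ⟨
    S +ℚ Σℚ (suc k) (λ c → absK (k ∸ c ∷ c ∷ []) N N)
      ≡⟨ Σℚ-+ (suc k) (λ c → absK (c ∷ k ∸ c ∷ []) N N) (λ c → absK (k ∸ c ∷ c ∷ []) N N) ⟨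
    Σℚ (suc k) (λ c → absK (c ∷ k ∸ c ∷ []) N N +ℚ absK (k ∸ c ∷ c ∷ []) N N)
      ≡⟨ Σℚ-cong (suc k) (λ c → sym (absBasis-* (c ∷ []) (k ∸ c ∷ []) N N)) ⟩
    Σℚ (suc k) (λ c → (absK (c ∷ []) N *q absK (k ∸ c ∷ []) N) N)
      ≡⟨ Σℚ-cong (suc k) (λ c → *q-cong≤ {absK (c ∷ []) N} {P N N (x̂ c ∷ [])} {absK (k ∸ c ∷ []) N} {P N N (x̂ (k ∸ c) ∷ [])} N
           (λ M l → trans (sym (gapK₁≗absK₁ c M)) (g₁ c M l)) (λ M l → trans (sym (gapK₁≗absK₁ (k ∸ c) M)) (g₁ (k ∸ c) M l))) ⟩
    square k ∎
    where
    open ≡-Reasoning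
    S = Σℚ (suc k) (λ c → absK (c ∷ k ∸ c ∷ []) N N)

  -- Coinciding indices of the two factors give the depth one terms, which `x̂-convolution` sums
  -- over all c.
  square-qsh : ∀ κ → let k = suc κ in square k ≡ fromℕ 2 *ℚ Σℚ (suc k) (λ c → p (x̂ c ∷ x̂ (k ∸ c) ∷ []))
    +ℚ (fromℕ (suc k) *ℚ p (X̂ (suc k) ∷ []) -ℚ p (X̂ k ∷ []))
  square-qsh κ = begin
    square k
      ≡⟨ Σℚ-cong (suc k) (λ c → Truncated.at (P-qsh N N (x̂ c ∷ []) (x̂ (k ∸ c) ∷ [])) N ℕₚ.≤-refl) ⟩
    Σℚ (suc k) (λ c → (p (x̂ c ∷ x̂ (k ∸ c) ∷ []) +ℚ p (x̂ (k ∸ c) ∷ x̂ c ∷ [])) +ℚ p (x̂ c *q x̂ (k ∸ c) ∷ []))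
      ≡⟨ trans (Σℚ-+ (suc k) (λ c → p (x̂ c ∷ x̂ (k ∸ c) ∷ []) +ℚ p (x̂ (k ∸ c) ∷ x̂ c ∷ [])) (λ c → p (x̂ c *q x̂ (k ∸ c) ∷ [])))
           (cong₂ _+ℚ_ (trans (Σℚ-+ (suc k) (λ c → p (x̂ c ∷ x̂ (k ∸ c) ∷ [])) (λ c → p (x̂ (k ∸ c) ∷ x̂ c ∷ [])))
             (cong (S +ℚ_) (Σℚ-antidiagonal k (λ a b → p (x̂ a ∷ x̂ b ∷ []))))) merged) ⟩
    (S +ℚ S) +ℚ (fromℕ (suc k) *ℚ p (X̂ (suc k) ∷ []) -ℚ p (X̂ k ∷ []))
      ≡⟨ cong (_+ℚ (fromℕ (suc k) *ℚ p (X̂ (suc k) ∷ []) -ℚ p (X̂ k ∷ []))) (solve 1 (λ s → con (fromℕ 2) :* s := s :+ s) refl S) ⟨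
    fromℕ 2 *ℚ S +ℚ (fromℕ (suc k) *ℚ p (X̂ (suc k) ∷ []) -ℚ p (X̂ k ∷ [])) ∎
    where
    open ≡-Reasoning
    k = suc κ
    S = Σℚ (suc k) (λ c → p (x̂ c ∷ x̂ (k ∸ c) ∷ []))
    open Linear (P-linear N N [] [])
    merged : Σℚ (suc k) (λ c → p (x̂ c *q x̂ (k ∸ c) ∷ [])) ≡ fromℕ (suc k) *ℚ p (X̂ (suc k) ∷ []) -ℚ p (X̂ k ∷ [])
    merged = begin
      Σℚ (suc k) (λ c → p (x̂ c *q x̂ (k ∸ c) ∷ []))
        ≡⟨ linear-Σ (P-linear N N [] []) (suc k) (λ c → x̂ c *q x̂ (k ∸ c)) N ⟨
      p ((λ U → Σℚ (suc k) (λ c → (x̂ c *q x̂ (k ∸ c)) U)) ∷ [])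
        ≡⟨ T-cong (λ U → trans (x̂-convolution κ U) (solve 2 (λ a b → a :- b := a :+ con (-ℚ 1ℚ) :* b) refl (fromℕ (suc k) *ℚ X̂ (suc k) U) (X̂ k U))) N ⟩
      p (((fromℕ (suc k) · X̂ (suc k)) ⊕ ((-ℚ 1ℚ) · X̂ k)) ∷ [])
        ≡⟨ trans (T-⊕ (fromℕ (suc k) · X̂ (suc k)) ((-ℚ 1ℚ) · X̂ k) N) (cong₂ _+ℚ_ (T-· (fromℕ (suc k)) (X̂ (suc k)) N) (T-· (-ℚ 1ℚ) (X̂ k) N)) ⟩
      fromℕ (suc k) *ℚ p (X̂ (suc k) ∷ []) +ℚ (-ℚ 1ℚ) *ℚ p (X̂ k ∷ [])
        ≡⟨ solve 2 (λ a b → a :+ con (-ℚ 1ℚ) :* b := a :- b) refl (fromℕ (suc k) *ℚ p (X̂ (suc k) ∷ [])) (p (X̂ k ∷ [])) ⟩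
      fromℕ (suc k) *ℚ p (X̂ (suc k) ∷ []) -ℚ p (X̂ k ∷ []) ∎

  sum-g : ∀ κ → let k = suc κ in Σℚ (suc k) (λ c → g (c ∷ k ∸ c ∷ [])) ≡
    Σℚ (suc k) (λ c → p (x̂ c ∷ x̂ (k ∸ c) ∷ [])) +ℚ (1/1+ 1) *ℚ p (X̂ k ∷ 1q ∷ [])
  sum-g κ = trans (cong₂ _+ℚ_
      (Σℚ-cong< k (λ { c (s≤s l) → subst (λ a → g (c ∷ a ∷ []) ≡ p (x̂ c ∷ x̂ a ∷ [])) (sym (ℕₚ.+-∸-assoc 1 l)) (g₂ c (κ ∸ c)) }))
      -- Only the last summand has the exponent 0 in second place; it alone carries the additional
      -- half count.
      (subst (λ a → g (k ∷ a ∷ []) ≡ p (x̂ k ∷ x̂ a ∷ []) +ℚ (1/1+ 1) *ℚ p (X̂ k ∷ 1q ∷ [])) (sym (ℕₚ.n∸n≡0 k)) (g₂-0 k)))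
    (sym (ℚₚ.+-assoc (Σℚ k (λ c → p (x̂ c ∷ x̂ (k ∸ c) ∷ []))) (p (x̂ k ∷ x̂ (k ∸ k) ∷ [])) ((1/1+ 1) *ℚ p (X̂ k ∷ 1q ∷ []))))
    where k = suc κ

  𝕕-g₁ : ∀ κ → 𝕕 (gapK (κ ∷ []) N) N ≡ fromℕ (suc κ) *ℚ (p (X̂ (suc κ) ∷ []) +ℚ p (X̂ (suc κ) ∷ 1q ∷ []))
  𝕕-g₁ κ = begin
    fromℕ N *ℚ gapK (κ ∷ []) N N
      ≡⟨ cong (fromℕ N *ℚ_) (g₁ κ N ℕₚ.≤-refl) ⟩
    𝕕 (P N N (x̂ κ ∷ [])) N
      ≡⟨ Truncated.at (𝕕-P N N (x̂ κ ∷ [])) N ℕₚ.≤-refl ⟩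
    (p (𝕕 (x̂ κ) ∷ []) +ℚ p (𝕕 (x̂ κ) ∷ 1q ∷ [])) +ℚ 0ℚ
      ≡⟨ ℚₚ.+-identityʳ (p (𝕕 (x̂ κ) ∷ []) +ℚ p (𝕕 (x̂ κ) ∷ 1q ∷ [])) ⟩
    p (𝕕 (x̂ κ) ∷ []) +ℚ p (𝕕 (x̂ κ) ∷ 1q ∷ [])
      ≡⟨ cong₂ _+ℚ_ (scale []) (scale (1q ∷ [])) ⟩
    fromℕ (suc κ) *ℚ p (X̂ (suc κ) ∷ []) +ℚ fromℕ (suc κ) *ℚ p (X̂ (suc κ) ∷ 1q ∷ [])
      ≡⟨ ℚₚ.*-distribˡ-+ (fromℕ (suc κ)) (p (X̂ (suc κ) ∷ [])) (p (X̂ (suc κ) ∷ 1q ∷ [])) ⟨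
    fromℕ (suc κ) *ℚ (p (X̂ (suc κ) ∷ []) +ℚ p (X̂ (suc κ) ∷ 1q ∷ [])) ∎
    where
    open ≡-Reasoning
    scale : ∀ w → p (𝕕 (x̂ κ) ∷ w) ≡ fromℕ (suc κ) *ℚ p (X̂ (suc κ) ∷ w)
    scale w = trans (Linear.T-cong (P-linear N N [] w) (𝕕-x̂ κ) N) (Linear.T-· (P-linear N N [] w) (fromℕ (suc κ)) (X̂ (suc κ)) N)

derivative-depth-one : ∀ κ → let k = suc κ in
  (1/1+ κ) · 𝕕 (gsh (k ∷ [])) ≗
    (fromℕ (k + 1) · gsh ((k + 2) ∷ []) ⊖ ∑ₛ [ 2 ⋯ k + 1 ] (λ n → (fromℕ (2 ^ n) -ℚ fromℕ 2) · gsh ((k + 2 ∸ n) ∷ n ∷ [])))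
derivative-depth-one κ N = begin
  (1/1+ κ) *ℚ 𝕕 (gsh (k ∷ [])) N
    ≡⟨ cong (λ t → (1/1+ κ) *ℚ t) (trans (cong (fromℕ N *ℚ_) (gsh≡K (k ∷ []) N N ℕₚ.≤-refl)) (𝕕-g₁ κ)) ⟩
  (1/1+ κ) *ℚ (fromℕ k *ℚ (p₁ +ℚ p₂))
    ≡⟨ 1/1+-cancel κ (p₁ +ℚ p₂) ⟩
  p₁ +ℚ p₂
    -- The inner bracket is the coefficient of H(1;X)² in quasi-shuffle form. Subtracting twice the
    -- sum of all words cancels `S`, and the doubled half count becomes `p₂`.
    ≡⟨ solve 5 (λ a b s m h → a :+ b := m :- ((con (fromℕ 2) :* s :+ (m :- a)) :- con (fromℕ 2) :* (s :+ con (1/1+ 1) :* b))) refl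
         p₁ p₂ S (fromℕ (suc k) *ℚ p (X̂ (suc k) ∷ [])) (1/1+ 1) ⟩
  fromℕ (suc k) *ℚ p (X̂ (suc k) ∷ []) -ℚ ((fromℕ 2 *ℚ S +ℚ (fromℕ (suc k) *ℚ p (X̂ (suc k) ∷ []) -ℚ p₁)) -ℚ fromℕ 2 *ℚ (S +ℚ (1/1+ 1) *ℚ p₂))
    ≡⟨ cong₂ _-ℚ_ first (cong₂ (λ s t → s -ℚ fromℕ 2 *ℚ t) (trans (sum-2^ k) (square-qsh κ)) (sum-g κ)) ⟨
  fromℕ (k + 1) *ℚ gsh ((k + 2) ∷ []) N -ℚ (Σℚ (suc k) (λ c → fromℕ (2 ^ suc c) *ℚ G c) -ℚ fromℕ 2 *ℚ Σℚ (suc k) G)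
    ≡⟨ cong (λ t → fromℕ (k + 1) *ℚ gsh ((k + 2) ∷ []) N -ℚ t) right ⟨
  fromℕ (k + 1) *ℚ gsh ((k + 2) ∷ []) N -ℚ ∑ [ 2 ⋯ k + 1 ] term ∎
  where
  open ≡-Reasoning
  open DepthTwo N
  k = suc κ
  p₁ p₂ S : ℚ
  p₁ = p (X̂ k ∷ [])
  p₂ = p (X̂ k ∷ 1q ∷ [])
  S = Σℚ (suc k) (λ c → p (x̂ c ∷ x̂ (k ∸ c) ∷ []))
  G : ℕ → ℚ
  G c = g (c ∷ k ∸ c ∷ [])
  term : ℕ → ℚ
  term n = (fromℕ (2 ^ n) -ℚ fromℕ 2) *ℚ gsh ((k + 2 ∸ n) ∷ n ∷ []) N
  first : fromℕ (k + 1) *ℚ gsh ((k + 2) ∷ []) N ≡ fromℕ (suc k) *ℚ p (X̂ (suc k) ∷ [])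
  first = trans (cong₂ (λ a b → fromℕ a *ℚ gsh (b ∷ []) N) (ℕₚ.+-comm k 1) (ℕₚ.+-comm k 2))
    (cong (fromℕ (suc k) *ℚ_) (trans (gsh≡K (suc (suc k) ∷ []) N N ℕₚ.≤-refl) (g₁ (suc k) N ℕₚ.≤-refl)))
  -- Reversal puts the second index n = c + 1 at the head of the word, so the power of 2 goes with
  -- the exponent of the head.
  term-suc : ∀ c → c ≤ k → term (suc c) ≡ (fromℕ (2 ^ suc c) -ℚ fromℕ 2) *ℚ G c
  term-suc c l = cong ((fromℕ (2 ^ suc c) -ℚ fromℕ 2) *ℚ_) (trans (cong (λ a → gsh (a ∷ suc c ∷ []) N)
      (trans (cong (_∸ suc c) (ℕₚ.+-comm k 2)) (ℕₚ.+-∸-assoc 1 l)))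
    (gsh≡K (suc (k ∸ c) ∷ suc c ∷ []) N N ℕₚ.≤-refl))
  right : ∑ [ 2 ⋯ k + 1 ] term ≡ Σℚ (suc k) (λ c → fromℕ (2 ^ suc c) *ℚ G c) -ℚ fromℕ 2 *ℚ Σℚ (suc k) G
  right = begin
    ∑ [ 2 ⋯ k + 1 ] term
      ≡⟨ ∑-applyUpTo (λ i → 2 + i) (κ + 1) term ⟩
    Σℚ (κ + 1) (λ i → term (2 + i))
      ≡⟨ cong (λ n → Σℚ n (λ i → term (2 + i))) (ℕₚ.+-comm κ 1) ⟩
    Σℚ k (λ i → term (2 + i))
      -- The summand n = 1 may be added because 2^1 - 2 = 0; the sum then runs over all c = n - 1
      -- from 0 to k.
      ≡⟨ trans (cong (_+ℚ Σℚ k (λ i → term (2 + i))) (ℚₚ.*-zeroˡ (gsh ((k + 2 ∸ 1) ∷ 1 ∷ []) N))) (ℚₚ.+-identityˡ _) ⟨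
    term 1 +ℚ Σℚ k (λ i → term (2 + i))
      ≡⟨ Σℚ-head k (λ c → term (suc c)) ⟨
    Σℚ (suc k) (λ c → term (suc c))
      ≡⟨ Σℚ-cong< (suc k) (λ { c (s≤s l) → trans (term-suc c l)
           (solve 3 (λ a b x → (a :- b) :* x := a :* x :+ (:- b) :* x) refl (fromℕ (2 ^ suc c)) (fromℕ 2) (G c)) }) ⟩
    Σℚ (suc k) (λ c → fromℕ (2 ^ suc c) *ℚ G c +ℚ (-ℚ fromℕ 2) *ℚ G c)
      ≡⟨ trans (Σℚ-+ (suc k) (λ c → fromℕ (2 ^ suc c) *ℚ G c) (λ c → (-ℚ fromℕ 2) *ℚ G c))
           (cong (Σℚ (suc k) (λ c → fromℕ (2 ^ suc c) *ℚ G c) +ℚ_) (Σℚ-*ˡ (suc k) (-ℚ fromℕ 2) G)) ⟩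
    Σℚ (suc k) (λ c → fromℕ (2 ^ suc c) *ℚ G c) +ℚ (-ℚ fromℕ 2) *ℚ Σℚ (suc k) G
      ≡⟨ solve 3 (λ a b x → a :+ (:- b) :* x := a :- b :* x) refl (Σℚ (suc k) (λ c → fromℕ (2 ^ suc c) *ℚ G c)) (fromℕ 2) (Σℚ (suc k) G) ⟩
    Σℚ (suc k) (λ c → fromℕ (2 ^ suc c) *ℚ G c) -ℚ fromℕ 2 *ℚ Σℚ (suc k) G ∎

theorem1p1 : ((k : ℕ) .{{_ : NonZero k}} →
    (+ 1 / k) · 𝕕 (gsh (k ∷ []))
    ≗ (fromℕ (k + 1) · gsh ((k + 2) ∷ [])
    ⊖ ∑ₛ [ 2 ⋯ k + 1 ] (λ n → (fromℕ (2 ^ n) - fromℕ 2) · gsh ((k + 2 ∸ n) ∷ n ∷ []))))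
    × ((k₁ k₂ k₃ : ℕ) → 2 ≤ k₁ → 2 ≤ k₂ → 2 ≤ k₃ →
    IsCombination (𝕕 (gsh (k₁ ∷ k₂ ∷ [])))
    × IsCombination (𝕕 (gsh (k₁ ∷ k₂ ∷ k₃ ∷ []))))
theorem1p1 = (λ { (suc κ) → derivative-depth-one κ })
  , λ { (suc (suc k₁)) (suc (suc k₂)) (suc (suc k₃)) (s≤s (s≤s _)) (s≤s (s≤s _)) (s≤s (s≤s _)) → combination₂ k₁ k₂ , combination₃ k₁ k₂ k₃ }
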